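{- Let $f(\alpha)=2\cdot 5^{\alpha}-6^{\alpha+1}+4\cdot 7^{\alpha}$ and $g(\alpha)=2\cdot 6^{\alpha}-5^{\alpha}-7^{\alpha}$ for real $\alpha$. Let $x_0\approx -3.09997$ and $x_1\approx -5.46343$ be the roots of the equations $f(\alpha)=0$ and $f(\alpha)+g(\alpha)=0$, respectively. Let $n\ge 3$ and let $B_n\in\Omega_n$ be a polyomino chain having $n$ squares. (i) For $x_1<\alpha<x_0$ and $Z_n^{*}\in\mathcal{Z}_n^{*}$, it holds that $\chi_\alpha(B_n)\le \chi_\alpha(Z_n^{*})$, with equality if and only if $B_n$ is (isomorphic to) a member of $\mathcal{Z}_n^{*}$. (ii) For $\alpha=x_1$ and $Z\in\mathcal{Z}_n$, it holds that $\chi_\alpha(B_n)\le \chi_\alpha(Z)$, with equality if and only if $B_n$ is (isomorphic to) a member of $\mathcal{Z}_n$. (iii) For $\alpha<x_1$, it holds that $\chi_\alpha(B_n)\le \chi_\alpha(Z_n^{\dag})$, with equality if and only if $B_n\cong Z_n^{\dag}$.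
   Context: For a graph $G$ and a nonzero real number $\alpha$, the general sum-connectivity index is $\chi_\alpha(G)=\sum_{uv\in E(G)}(d_u+d_v)^\alpha$, where $d_u$ is the degree of the vertex $u$. A polyomino system is a connected geometric figure obtained by concatenating congruent squares side to side in the plane so that the figure divides the plane into one infinite (external) region and a number of finite (internal) regions, all internal regions being congruent squares. Two squares are adjacent if they share a side. A polyomino chain is a polyomino system in which every square is adjacent to at most two other squares; the squares are arranged in a linear order in which exactly the consecutive squares are adjacent (so for $n\ge 2$ there are two terminal squares; the cyclic $2\times 2$ block of four squares is not considered a chain). A polyomino chain is identified with its graph: vertices are the corners of the squares, edges are the sides of the squares. Degrees are taken in this graph, and $\cong$ denotes graph isomorphism. A square adjacent to exactly one (respectively two) other square(s) is called terminal (respectively non-terminal). A kink is a non-terminal square having a vertex of degree 2. A linear chain is a polyomino chain without kinks. A segment is a maximal linear chain in a polyomino chain, including the kinks and/or terminal squares at its ends; its length is its number of squares. A segment is external if it contains a terminal square, and internal otherwise. $\Omega_n$ is the collection of all polyomino chains with $n$ squares in which no internal segment of length 3 has an edge connecting two vertices of degree 3. $\mathcal{Z}_n^{*}$ is the subclass of $\Omega_n$ consisting of those polyomino chains which do not contain any segment of length equal to 2 or greater than 4, and contain at most one segment of length 4. $\mathcal{Z}_n$ is the subclass of $\Omega_n$ consisting of those polyomino chains in which every internal segment (if one exists) has length 3 or 4, every external segment has length at most 4, at most one external segment has length 2, at most one segment has length 4, and if some internal segment has length 4 then both the external segments have length 3. $Z_n^{\dag}\in\Omega_n$ is the polyomino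 chain with $n$ squares in which every internal segment (if one exists) has length 3, every external segment has length at most 3, and at most one external segment has length 2.
   Formalization: In 𝒵_n the last clause also covers an external segment of length 4: the other external segment must then have length 3. As worded, (ii) fails for n=5: the chain with segments 2,4 lies in 𝒵_5 but has a smaller index than the one with segments 3,3. -}

module Defs where

open import Level using (Level; 0ℓ; _⊔_) renaming (suc to lsuc)
open import Algebra.Apartness.Bundles using (HeytingField; HeytingCommutativeRing)
open import Algebra.Bundles using (CommutativeRing)
import Algebra.Definitions.RawMonoid as RawMonoidDefinitions
open import Data.Fin.Base as Fin using (Fin; toℕ)
import Data.Fin.Properties as Fin
open import Data.Integer.Base as ℤ using (ℤ)
import Data.Integer.Properties as ℤ
open import Data.List.Base using (List; []; _∷_; length; map; filter; foldr; concatMap; tabulate; allFin; cartesianProduct; deduplicate; lookup)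
open import Data.List.Membership.Propositional using (_∈_; _∉_)
open import Data.List.Membership.Propositional.Properties using (∈-concatMap⁻)
import Data.List.Membership.DecPropositional as DecMembership
open import Data.List.Relation.Unary.All using (All; []; _∷_)
import Data.List.Relation.Unary.All as All
open import Data.List.Relation.Unary.Any using (Any; here; there; any?; satisfied)
open import Data.Nat.Base as ℕ using (ℕ; zero; suc; _∸_)
open import Data.Product.Base using (Σ; ∃; ∃₂; _×_; _,_; proj₁; proj₂)
open import Data.Product.Properties using (≡-dec)
open import Data.Sum.Base using (_⊎_; inj₁; inj₂; swap)
open import Function.Base using (_∘_)
open import Function.Bundles using (_↔_; _⇔_; Inverse)
open import Function.Definitions using (Injective)
open import Relation.Binary.Core using (Rel)
open import Relation.Binary.Construct.Closure.ReflexiveTransitive using (Star)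
open import Relation.Binary.Definitions using (Decidable; DecidableEquality; Irreflexive; Symmetric)
open import Relation.Binary.PropositionalEquality using (_≡_; _≢_; refl; cong)
open import Relation.Binary.Structures using (IsStrictPartialOrder)
open import Relation.Nullary.Decidable using (Dec; _×-dec_; _⊎-dec_; ¬?)
open import Relation.Nullary.Negation using (¬_)

-- The real numbers, axiomatised as a complete Archimedean ordered field
-- together with the power function with positive base and arbitrary real
-- exponent.  These axioms determine ℝ and the power function up to unique
-- isomorphism.  They are phrased constructively (apartness instead of ≢, an
-- order that need not be decidable, completeness for Cauchy sequences), so
-- that every classical complete ordered field is also an instance.

record RealNumbers (c ℓ₁ ℓ₂ : Level) : Set (lsuc (c ⊔ ℓ₁ ⊔ ℓ₂)) where
  field
    heytingField : HeytingField c ℓ₁ ℓ₂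

  open HeytingField heytingField public

  commutativeRing : CommutativeRing c ℓ₁
  commutativeRing = HeytingCommutativeRing.commutativeRing heytingCommutativeRing

  open RawMonoidDefinitions (CommutativeRing.+-rawMonoid commutativeRing)
    using () renaming (_×_ to _·_)

  fromℕ : ℕ → Carrier
  fromℕ n = n · 1#

  infix 4 _<_
  field
    _<_                  : Rel Carrier ℓ₂
    isStrictPartialOrder : IsStrictPartialOrder _≈_ _<_
    #⇔<⊎>                : ∀ x y → x # y ⇔ (x < y ⊎ y < x)
    0<1                  : 0# < 1#
    +-monoˡ-<            : ∀ z {x y} → x < y → x + z < y + z
    *-pos                : ∀ {x y} → 0# < x → 0# < y → 0# < x * y
    archimedean          : ∀ x → ∃ λ n → x < fromℕ n

  infix 4 _≤_
  _≤_ : Rel Carrier ℓ₂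
  x ≤ y = ¬ (y < x)

  Close : Carrier → Carrier → Carrier → Set ℓ₂
  Close ε x y = (- ε < x - y) × (x - y < ε)

  Cauchy : (ℕ → Carrier) → Set (c ⊔ ℓ₂)
  Cauchy s = ∀ ε → 0# < ε →
    ∃ λ N → ∀ m n → N ℕ.≤ m → N ℕ.≤ n → Close ε (s m) (s n)

  _ConvergesTo_ : (ℕ → Carrier) → Carrier → Set (c ⊔ ℓ₂)
  s ConvergesTo l = ∀ ε → 0# < ε → ∃ λ N → ∀ n → N ℕ.≤ n → Close ε (s n) l

  field
    complete : ∀ s → Cauchy s → ∃ λ l → s ConvergesTo l

  Positive : Set (c ⊔ ℓ₂)
  Positive = Σ Carrier (0# <_)

  value : Positive → Carrier
  value = proj₁

  infixr 8 _^_
  field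
    _^_           : Positive → Carrier → Positive
    ^-congʳ       : ∀ a {x y} → x ≈ y → value (a ^ x) ≈ value (a ^ y)
    ^-identityʳ   : ∀ a → value (a ^ 1#) ≈ value a
    ^-distribˡ-+  : ∀ a x y → value (a ^ (x + y)) ≈ value (a ^ x) * value (a ^ y)
    ^-distribʳ-*  : ∀ a b c x → value c ≈ value a * value b →
                    value (c ^ x) ≈ value (a ^ x) * value (b ^ x)
    ^-assoc       : ∀ a x y → value ((a ^ x) ^ y) ≈ value (a ^ (x * y))
    ^-monoʳ-<     : ∀ a {x y} → 1# < value a → x < y → value (a ^ x) < value (a ^ y)

  fromℕ-pos : ∀ n → 0# < fromℕ (suc n)
  fromℕ-pos zero    = <-respʳ-≈ (sym (+-identityʳ 1#)) 0<1
    where open IsStrictPartialOrder isStrictPartialOrder using (<-respʳ-≈)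
  fromℕ-pos (suc n) = <-trans 0<1
    (<-respˡ-≈ (+-identityˡ 1#) (<-respʳ-≈ (+-comm _ 1#) (+-monoˡ-< 1# (fromℕ-pos n))))
    where open IsStrictPartialOrder isStrictPartialOrder
            using (<-respʳ-≈; <-respˡ-≈) renaming (trans to <-trans)

  -- The value at base 0 is arbitrary: the bases used below are 5, 6, 7 and
  -- sums of the degrees of the two ends of an edge.
  infixr 8 _^ℕ_
  _^ℕ_ : ℕ → Carrier → Carrier
  zero  ^ℕ x = 0#
  suc n ^ℕ x = value ((fromℕ (suc n) , fromℕ-pos n) ^ x)

  -- ∣ x − (−m/d) ∣ < 1/d
  infix 4 _≈-[_/_]
  _≈-[_/_] : Carrier → ℕ → ℕ → Set ℓ₂
  x ≈-[ m / d ] = Close 1# (fromℕ d * x) (- fromℕ m)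

-- Finite simple graphs

record Graph : Set₁ where
  field
    order      : ℕ
    Adj        : Rel (Fin order) 0ℓ
    adj?       : Decidable Adj
    Adj-sym    : Symmetric Adj
    Adj-irrefl : Irreflexive _≡_ Adj

  degree : Fin order → ℕ
  degree u = length (filter (adj? u) (allFin order))

  -- each edge is listed once, smaller end first
  edges : List (Fin order × Fin order)
  edges = filter (λ (u , v) → (u Fin.<? v) ×-dec adj? u v)
                 (cartesianProduct (allFin order) (allFin order))

infix 4 _≅_
record _≅_ (G H : Graph) : Set where
  private
    module G = Graph G
    module H = Graph H
  field
    vertices  : Fin G.order ↔ Fin H.order
    adjacency : ∀ u v → G.Adj u v ⇔ H.Adj (Inverse.to vertices u) (Inverse.to vertices v)

-- Figures made of unit squares.  A square is named by its lower left corner.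

Point : Set
Point = ℤ × ℤ

Cell : Set
Cell = Point

_≟ᴾ_ : DecidableEquality Point
_≟ᴾ_ = ≡-dec ℤ._≟_ ℤ._≟_

east north : Point → Point
east  (x , y) = ℤ.suc x , y
north (x , y) = x , ℤ.suc y

corners : Cell → List Point
corners c = c ∷ east c ∷ north c ∷ north (east c) ∷ []

-- Every side is oriented eastwards or northwards, so that a side common to two
-- squares is the same pair for both.
Side : Set
Side = Point × Point

sides : Cell → List Side
sides c = (c , east c) ∷ (c , north c)
        ∷ (north c , north (east c)) ∷ (east c , north (east c)) ∷ []

_≟ˢ_ : DecidableEquality Side
_≟ˢ_ = ≡-dec _≟ᴾ_ _≟ᴾ_

_∈ˢ?_ : (s : Side) (ss : List Side) → Dec (s ∈ ss)
_∈ˢ?_ = DecMembership._∈?_ _≟ˢ_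

Adjacent : Rel Cell 0ℓ
Adjacent c d = c ≢ d × Any (_∈ sides d) (sides c)

adjacent? : Decidable Adjacent
adjacent? c d = ¬? (c ≟ᴾ d) ×-dec any? (_∈ˢ? sides d) (sides c)

allSides : List Cell → List Side
allSides = concatMap sides

vertices : List Cell → List Point
vertices = deduplicate _≟ᴾ_ ∘ concatMap corners

Vertex : List Cell → Set
Vertex cs = Fin (length (vertices cs))

position : ∀ cs → Vertex cs → Point
position cs = lookup (vertices cs)

side-ends-distinct : ∀ cs {p q} → (p , q) ∈ allSides cs → p ≢ q
side-ends-distinct cs s∈ with satisfied (∈-concatMap⁻ sides {xs = cs} s∈)
... | c , s∈c = All.lookup (ends c) s∈c
  where
  ends : ∀ c → All (λ s → proj₁ s ≢ proj₂ s) (sides c)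
  ends c = (ℤ.i≢suc[i] ∘ cong proj₁)
         ∷ (ℤ.i≢suc[i] ∘ cong proj₂)
         ∷ (ℤ.i≢suc[i] ∘ cong proj₁)
         ∷ (ℤ.i≢suc[i] ∘ cong proj₂) ∷ []

graph : List Cell → Graph
graph cs = record
  { order      = length (vertices cs)
  ; Adj        = λ u v → (point u , point v) ∈ allSides cs ⊎ (point v , point u) ∈ allSides cs
  ; adj?       = λ u v → ((point u , point v) ∈ˢ? allSides cs) ⊎-dec ((point v , point u) ∈ˢ? allSides cs)
  ; Adj-sym    = swap
  ; Adj-irrefl = λ { refl (inj₁ s∈) → side-ends-distinct cs s∈ refl
                   ; refl (inj₂ s∈) → side-ends-distinct cs s∈ refl }
  }
  where
  point : Vertex cs → Point
  point = position cs

neighbours : List Cell → Cell → List Cell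
neighbours cs c = filter (adjacent? c) cs

Terminal NonTerminal Kink : List Cell → Cell → Set
Terminal    cs c = length (neighbours cs c) ≡ 1
NonTerminal cs c = length (neighbours cs c) ≡ 2
Kink        cs c = NonTerminal cs c ×
  ∃ λ (v : Vertex cs) → position cs v ∈ corners c × Graph.degree (graph cs) v ≡ 2

Linear : List Cell → Set
Linear cs = ∀ {c} → c ∈ cs → ¬ Kink cs c

-- The regions into which the figure divides the plane are its squares and the
-- regions formed by the other cells of the grid.  The latter cells have to
-- form a single region, the infinite one.
OnlySquaresInside : List Cell → Set
OnlySquaresInside cs = ∀ {c d} → c ∉ cs → d ∉ cs →
  Star (λ a b → Adjacent a b × b ∉ cs) c d

record PolyominoChain (n : ℕ) : Set where
  field
    square      : Fin n → Cell
    distinct    : Injective _≡_ _≡_ square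
    consecutive : ∀ i j → Adjacent (square i) (square j) ⇔ ℕ.∣ toℕ i - toℕ j ∣ ≡ 1

  squares : List Cell
  squares = tabulate square

  field
    onlySquaresInside : OnlySquaresInside squares

  chainGraph : Graph
  chainGraph = graph squares

  -- the squares number i to j
  run : Fin n → Fin n → List Cell
  run i j = map square (filter (λ k → (i Fin.≤? k) ×-dec (k Fin.≤? j)) (allFin n))

  record Segment : Set where
    field
      first last : Fin n
      first≤last : first Fin.≤ last
      linear     : Linear (run first last)
      maximal    : ∀ i j → i Fin.≤ first → last Fin.≤ j → Linear (run i j) →
                   i ≡ first × j ≡ last

  open Segment

  Same : Rel Segment 0ℓ
  Same s t = first s ≡ first t × last s ≡ last t

  segmentSquares : Segment → List Cell
  segmentSquares s = run (first s) (last s)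

  segmentLength : Segment → ℕ
  segmentLength = length ∘ segmentSquares

  External Internal : Segment → Set
  External s = Any (Terminal squares) (segmentSquares s)
  Internal s = ¬ External s

  HasEdge33 : Segment → Set
  HasEdge33 s = ∃₂ λ (u v : Vertex squares) →
    (position squares u , position squares v) ∈ allSides (segmentSquares s) ×
    Graph.degree chainGraph u ≡ 3 × Graph.degree chainGraph v ≡ 3

  AtMostOne : (Segment → Set) → Set
  AtMostOne P = ∀ s t → P s → P t → Same s t

open PolyominoChain using (Segment; Internal; External; Same; segmentLength; HasEdge33; AtMostOne; chainGraph)

_≅ᶜ_ : ∀ {m n} → PolyominoChain m → PolyominoChain n → Set
B ≅ᶜ C = chainGraph B ≅ chainGraph C

module _ {n : ℕ} (B : PolyominoChain n) where

  private
    len : Segment B → ℕ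
    len = segmentLength B

  Ω : Set
  Ω = ∀ s → Internal B s → len s ≡ 3 → ¬ HasEdge33 B s

  record 𝒵* : Set where
    field
      inΩ     : Ω
      no2     : ∀ s → len s ≢ 2
      ≤4      : ∀ s → len s ℕ.≤ 4
      single4 : AtMostOne B (λ s → len s ≡ 4)

  -- The last condition is also imposed when the segment of length 4 is
  -- external: the other external segment then has length 3.  If it were only
  -- imposed for internal segments of length 4, chains with segments of lengths
  -- 2, 3, …, 3, 4 would belong to the class; they have the same number of
  -- squares as chains all of whose segments have length 3, but a smaller index.
  record 𝒵 : Set where
    field
      inΩ       : Ω
      internal  : ∀ s → Internal B s → len s ≡ 3 ⊎ len s ≡ 4
      external  : ∀ s → External B s → len s ℕ.≤ 4
      single2   : AtMostOne B (λ s → External B s × len s ≡ 2)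
      single4   : AtMostOne B (λ s → len s ≡ 4)
      4⇒other≡3 : ∀ s t → len s ≡ 4 → External B t → ¬ Same B s t → len t ≡ 3

  record Z† : Set where
    field
      inΩ      : Ω
      internal : ∀ s → Internal B s → len s ≡ 3
      external : ∀ s → External B s → len s ℕ.≤ 3
      single2  : AtMostOne B (λ s → External B s × len s ≡ 2)

module SumConnectivity {c ℓ₁ ℓ₂ : Level} (R : RealNumbers c ℓ₁ ℓ₂) where

  open RealNumbers R

  χ : ∀ {n} → Carrier → PolyominoChain n → Carrier
  χ α B = foldr _+_ 0# (map (λ (u , v) → (degree u ℕ.+ degree v) ^ℕ α) edges)
    where open Graph (chainGraph B)

  f g : Carrier → Carrier
  f α = fromℕ 2 * 5 ^ℕ α - 6 ^ℕ (α + 1#) + fromℕ 4 * 7 ^ℕ α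
  g α = fromℕ 2 * 6 ^ℕ α - 5 ^ℕ α - 7 ^ℕ α

{-# OPTIONS --safe #-}
module Submission where

-- The corners of a square have degrees that depend only on the two squares before it and the two squares after
-- it: two squares that share just a corner are two steps apart, because otherwise the chain would close up around
-- a region and separate the remaining cells (a discrete Jordan argument, by the parity of ray crossings).  So χ is
-- a sum of local terms that are found by enumerating the directions of four consecutive steps.  With
--   E = 6^α − 7^α,   F = 5^α + 2·7^α − 3·6^α = f(α)/2,   A = F + 6^α − 8^α,
-- the result is that χ_α + e·E + x·F + t·A depends on n only, where e and t count the external and the internal
-- segments of length 2 and x is the sum of (length − 3) over the longer segments; moreover e + x + t ≡ n − 3 mod 2.
-- For α < 0 both E and A − F are positive, and F − E = f(α) + g(α).  Hence the deficit e·E + x·F + t·A is least for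
-- t = e = 0, x ≤ 1 if 0 < F < E, for t = 0, e + x ≤ 1 if E = F, and for t = x = 0, e ≤ 1 if E < F.
-- The signs of F and F − E away from the roots follow from 5^δ + 7^δ > 2·6^δ for δ < 0.  In (iii) the maximal
-- chains are staircases with the same kinks up to reversal, and a lattice isometry maps one onto the other.

open import Algebra.Bundles using (CommutativeMonoid; CommutativeRing)
import Algebra.Properties.Ring as RingProperties
import Algebra.Properties.Semiring.Mult as Mult
import Algebra.Solver.Ring.NaturalCoefficients.Default as NaturalSolver
open import Data.Bool.Base using (true; false; if_then_else_; Bool; _∧_; _xor_; not)
open import Data.Bool.Properties using (∧-zeroʳ; xor-same; xor-identityʳ; xor-comm; ¬-not; ∧-conicalˡ; ∧-conicalʳ; not-involutive)
open import Data.Bool.Solver using (module xor-∧-Solver)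
open import Data.Fin.Base as Fin using (zero; suc; Fin; toℕ)
import Data.Fin.Properties as Fin
open import Data.Integer.Base as ℤ using (ℤ; +_; 0ℤ; 1ℤ; -1ℤ)
import Data.Integer.Properties as ℤ
open import Data.Integer.Solver using (module +-*-Solver)
open import Data.List.Base using (List; []; _∷_; _++_; foldr; length; lookup; map; allFin; cartesianProduct; filter; concatMap; applyUpTo)
import Data.List.Membership.DecPropositional as DecMembership
open import Data.List.Membership.Propositional using (_∈_; _∉_; find; lose)
open import Data.List.Membership.Propositional.Properties
open import Data.List.Membership.Propositional.Properties.WithK using (unique∧set⇒bag)
open import Data.List.Properties using (length-map; ≡-dec; filter-≐; map-∘; map-++; length-applyUpTo)
open import Data.List.Relation.Binary.BagAndSetEquality using (∼bag⇒↭)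
open import Data.List.Relation.Binary.Permutation.Propositional as ↭ using (_↭_; ↭-sym; ↭-trans; ↭-reflexive)
open import Data.List.Relation.Binary.Permutation.Propositional.Properties using (↭-length; map⁺)
open import Data.List.Relation.Unary.All as All using (All; []; _∷_; all?)
import Data.List.Relation.Unary.All.Properties as All
open import Data.List.Relation.Unary.AllPairs using ([]; _∷_)
open import Data.List.Relation.Unary.Any as Any using (here; there; Any; any?)
import Data.List.Relation.Unary.Any.Properties as Any
import Data.List.Relation.Unary.Unique.DecPropositional.Properties as DecUnique
open import Data.List.Relation.Unary.Unique.Propositional using (Unique)
import Data.List.Relation.Unary.Unique.Propositional.Properties as Unique
open import Data.Maybe.Base using (Maybe; just; nothing; maybe)
open import Data.Nat.Base as ℕ using (ℕ; suc; zero; _∸_; ∣_-_∣)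
import Data.Nat.Properties as ℕ
open import Data.Product.Base using (∃; _×_; _,_; ∃₂; proj₁; proj₂)
open import Data.Sum.Base using (_⊎_; inj₁; inj₂; [_,_]′; swap)
open import Data.Unit.Base using (⊤; tt)
open import Function.Base using (_∘_; id; case_of_; _⟨_⟩_)
open import Function.Bundles using (mk⇔; Equivalence; mk↔ₛ′; Inverse; _⇔_)
open import Function.Construct.Composition using (_↔-∘_; _⇔-∘_)
open import Function.Construct.Identity using (↔-id; ⇔-id)
open import Level using (Level)
open import Relation.Binary.Construct.Closure.ReflexiveTransitive as Star using (Star)
open import Relation.Binary.Definitions using (tri<; tri≈; tri>; DecidableEquality)
import Relation.Binary.PropositionalEquality as ≡
open import Relation.Binary.Structures using (IsStrictPartialOrder)
open import Relation.Nullary.Decidable using (_×-dec_; Dec; yes; no; does; from-yes; ¬?; _→-dec_; map′; dec-true; dec-false; decidable-stable; toSum)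
open import Relation.Nullary.Negation using (contradiction; ¬_)
open import Defs

-- The sides are regrouped so that each group depends only on the kink indicators a, b of two
-- consecutive squares. Its weights are then 6 + b - a, 6 + a + b and 6 + a - b: a single kink gives
-- 5, 7, 7, no kink gives 6, 6, 6, and two kinks give 6, 6, 8. `F` and `A` are the losses of the
-- last two cases against the first; `E` is the loss when one weight 6 at an end becomes 7.
-- Membership in Ω makes the index a function of the kink sequence: for the pattern kink, straight,
-- kink, a staircase has two free sides of weight 7 in the middle square, a U-turn has 8 and 6. The
-- decimal approximations of the roots enter through x₀ < -3 and x₁ < -4. These make 5^x₀ > 2·7^x₀
-- and 5^x₁ > 3·7^x₁, which is what the weighted form of the convexity inequality requires. The
-- order of the reals is not assumed decidable. Case distinctions between chains are therefore made
-- on the three natural numbers e, x, t, and the parity of their sum ensures that all best chains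
-- have exactly the same deficit.

module Lists where
  open ≡

  private variable
    a b : Level
    A : Set a
    B : Set b

  map-unique : ∀ (h : A → B) {xs} → Unique xs →
               (∀ {x y} → x ∈ xs → y ∈ xs → h x ≡ h y → x ≡ y) → Unique (map h xs)
  map-unique h []                inj = []
  map-unique h (_∷_ {x} {xs} x∉xs u) inj =
    All.map⁺ (All.tabulate λ y∈ hx≡hy → All.lookup x∉xs y∈ (inj (here refl) (there y∈) hx≡hy))
    ∷ map-unique h u (λ x∈ y∈ → inj (there x∈) (there y∈))

  -- Between duplicate-free lists a permutation amounts to equality of the sets of members. Degrees,
  -- numbers of neighbours, lengths of runs and reindexed edge sums are all obtained through this
  -- lemma.
  map-↭ : ∀ (h : A → B) {xs ys} → Unique xs → Unique ys →
          (∀ {x} → x ∈ xs → h x ∈ ys) →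
          (∀ {x y} → x ∈ xs → y ∈ xs → h x ≡ h y → x ≡ y) →
          (∀ {y} → y ∈ ys → ∃ λ x → x ∈ xs × h x ≡ y) → map h xs ↭ ys
  map-↭ h {xs} {ys} uxs uys into inj onto = ∼bag⇒↭ (unique∧set⇒bag (map-unique h uxs inj) uys (mk⇔ to from))
    where
    to : ∀ {y} → y ∈ map h xs → y ∈ ys
    to y∈ with ∈-map⁻ h y∈
    ... | x , x∈ , refl = into x∈
    from : ∀ {y} → y ∈ ys → y ∈ map h xs
    from y∈ with onto y∈
    ... | x , x∈ , refl = ∈-map⁺ h x∈

  map-length : ∀ (h : A → B) {xs ys} → map h xs ↭ ys → length xs ≡ length ys
  map-length h {xs} p = trans (sym (length-map h xs)) (↭-length p)

  lookup-injective : ∀ {xs : List A} → Unique xs → ∀ {i j} → lookup xs i ≡ lookup xs j → i ≡ j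
  lookup-injective (x∉xs ∷ u) {zero}  {zero}  e = refl
  lookup-injective {xs = _ ∷ xs} (x∉xs ∷ u) {zero}  {suc j} e = contradiction e (All.lookup x∉xs (∈-lookup {xs = xs} j))
  lookup-injective {xs = _ ∷ xs} (x∉xs ∷ u) {suc i} {zero}  e = contradiction (sym e) (All.lookup x∉xs (∈-lookup {xs = xs} i))
  lookup-injective (x∉xs ∷ u) {suc i} {suc j} e = cong suc (lookup-injective u e)

  module Sums {c ℓ} (M : CommutativeMonoid c ℓ) where
    open CommutativeMonoid M renaming (refl to ≈-refl; trans to ≈-trans; sym to ≈-sym)

    sum : List Carrier → Carrier
    sum = foldr _∙_ ε

    sum-↭ : ∀ {xs ys} → xs ↭ ys → sum xs ≈ sum ys
    sum-↭ ↭.refl         = ≈-refl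
    sum-↭ (↭.prep x p)   = ∙-congˡ (sum-↭ p)
    sum-↭ (↭.swap x y p) = ≈-trans (∙-congˡ (∙-congˡ (sum-↭ p)))
      (≈-trans (≈-sym (assoc x y _)) (≈-trans (∙-congʳ (comm x y)) (assoc y x _)))
    sum-↭ (↭.trans p q)  = ≈-trans (sum-↭ p) (sum-↭ q)

    sum-++ : ∀ xs ys → sum (xs ++ ys) ≈ sum xs ∙ sum ys
    sum-++ []       ys = ≈-sym (identityˡ _)
    sum-++ (x ∷ xs) ys = ≈-trans (∙-congˡ (sum-++ xs ys)) (≈-sym (assoc x _ _))

    sum-map-cong : ∀ {v w : A → Carrier} xs → (∀ {x} → x ∈ xs → v x ≈ w x) → sum (map v xs) ≈ sum (map w xs)
    sum-map-cong []       e = ≈-refl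
    sum-map-cong (x ∷ xs) e = ∙-cong (e (here refl)) (sum-map-cong xs (e ∘ there))

-- Edge lists of graphs

module Graphs where
  open ≡
  open Lists

  module _ (G : Graph) where
    open Graph G

    ∈-edges⁻ : ∀ {u v} → (u , v) ∈ edges → u Fin.< v × Adj u v
    ∈-edges⁻ e∈ = proj₂ (∈-filter⁻ (λ (u , v) → (u Fin.<? v) ×-dec adj? u v) {xs = cartesianProduct (allFin order) (allFin order)} e∈)

    ∈-edges⁺ : ∀ {u v} → u Fin.< v → Adj u v → (u , v) ∈ edges
    ∈-edges⁺ {u} {v} u<v a = ∈-filter⁺ (λ (u , v) → (u Fin.<? v) ×-dec adj? u v)
      (∈-cartesianProduct⁺ (∈-allFin u) (∈-allFin v)) (u<v , a)

    edges-unique : Unique edges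
    edges-unique = Unique.filter⁺ (λ (u , v) → (u Fin.<? v) ×-dec adj? u v)
      (Unique.cartesianProduct⁺ (Unique.allFin⁺ order) (Unique.allFin⁺ order))

    -- `edges` lists an edge by increasing vertex index, while the target list orients it in its own
    -- way, so `h` may reverse it. Two edges with the same image in opposite orientations would
    -- satisfy both u < v and v < u; hence `h` is injective on edges although injectivity is assumed
    -- of `pair`.
    map-edges-↭ : ∀ {b} {B : Set b} (pair : Fin order → Fin order → B) (h : Fin order × Fin order → B) {ys} → Unique ys →
      (∀ {u v u′ v′} → pair u v ≡ pair u′ v′ → u ≡ u′ × v ≡ v′) →
      (∀ u v → h (u , v) ≡ pair u v ⊎ h (u , v) ≡ pair v u) →
      (∀ {u v} → Adj u v → h (u , v) ∈ ys) →
      (∀ {y} → y ∈ ys → ∃₂ λ u v → Adj u v × h (u , v) ≡ y × h (v , u) ≡ y) →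
      map h edges ↭ ys
    map-edges-↭ {B = B} pair h {ys} unique pair-injective h-pair into onto =
      map-↭ h edges-unique unique (λ e∈ → into (proj₂ (∈-edges⁻ e∈))) inj onto′
      where
      inj : ∀ {e e′} → e ∈ edges → e′ ∈ edges → h e ≡ h e′ → e ≡ e′
      inj {u , v} {u′ , v′} e∈ e′∈ eq with h-pair u v | h-pair u′ v′
      ... | inj₁ p | inj₁ q with pair-injective (trans (sym p) (trans eq q))
      ...   | refl , refl = refl
      inj {u , v} {u′ , v′} e∈ e′∈ eq | inj₂ p | inj₂ q with pair-injective (trans (sym p) (trans eq q))
      ...   | refl , refl = refl
      inj {u , v} {u′ , v′} e∈ e′∈ eq | inj₁ p | inj₂ q with pair-injective (trans (sym p) (trans eq q))
      ...   | refl , refl = contradiction (proj₁ (∈-edges⁻ e∈)) (Fin.<-asym (proj₁ (∈-edges⁻ e′∈)))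
      inj {u , v} {u′ , v′} e∈ e′∈ eq | inj₂ p | inj₁ q with pair-injective (trans (sym p) (trans eq q))
      ...   | refl , refl = contradiction (proj₁ (∈-edges⁻ e∈)) (Fin.<-asym (proj₁ (∈-edges⁻ e′∈)))
      onto′ : ∀ {y} → y ∈ ys → ∃ λ e → e ∈ edges × h e ≡ y
      onto′ y∈ with onto y∈
      ... | u , v , a , e , e′ with Fin.<-cmp u v
      ... | tri< u<v _ _ = (u , v) , ∈-edges⁺ u<v a , e
      ... | tri≈ _ u≡v _ = contradiction a (Adj-irrefl u≡v)
      ... | tri> _ _ v<u = (v , u) , ∈-edges⁺ v<u (Adj-sym a) , e′

-- Unit squares of the grid: translations, shared sides, degrees at points

module Grid where
  open ≡
  open Lists
  open Graphs
  open import Data.List.Relation.Unary.Unique.DecPropositional _≟ᴾ_ using (unique?)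

  data Dir : Set where
    E N W S : Dir

  _≟ᴰ_ : DecidableEquality Dir
  E ≟ᴰ E = yes refl
  E ≟ᴰ N = no λ ()
  E ≟ᴰ W = no λ ()
  E ≟ᴰ S = no λ ()
  N ≟ᴰ E = no λ ()
  N ≟ᴰ N = yes refl
  N ≟ᴰ W = no λ ()
  N ≟ᴰ S = no λ ()
  W ≟ᴰ E = no λ ()
  W ≟ᴰ N = no λ ()
  W ≟ᴰ W = yes refl
  W ≟ᴰ S = no λ ()
  S ≟ᴰ E = no λ ()
  S ≟ᴰ N = no λ ()
  S ≟ᴰ W = no λ ()
  S ≟ᴰ S = yes refl

  opp : Dir → Dir
  opp E = W
  opp N = S
  opp W = E
  opp S = N

  dirs : List Dir
  dirs = E ∷ N ∷ W ∷ S ∷ []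

  ∈-dirs : ∀ d → d ∈ dirs
  ∈-dirs E = here refl
  ∈-dirs N = there (here refl)
  ∈-dirs W = there (there (here refl))
  ∈-dirs S = there (there (there (here refl)))

  all-dir? : ∀ {p} {P : Dir → Set p} → (∀ d → Dec (P d)) → Dec (∀ d → P d)
  all-dir? P? = map′ (λ a d → All.lookup a (∈-dirs d)) (λ f → All.tabulate λ {d} _ → f d) (all? P? dirs)

  -- The offset is the left summand because ℤ.suc x is 1ℤ + x.
  infixl 6 _⊕_ _⊕ˢ_
  _⊕_ : Point → Point → Point
  (x , y) ⊕ (a , b) = a ℤ.+ x , b ℤ.+ y

  _⊕ˢ_ : Point → Side → Side
  p ⊕ˢ (a , b) = p ⊕ a , p ⊕ b

  neg : Point → Point
  neg (a , b) = ℤ.- a , ℤ.- b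

  origin : Point
  origin = 0ℤ , 0ℤ

  off : Dir → Point
  off E = 1ℤ , 0ℤ
  off N = 0ℤ , 1ℤ
  off W = -1ℤ , 0ℤ
  off S = 0ℤ , -1ℤ

  ⊕-assoc : ∀ p a b → p ⊕ a ⊕ b ≡ p ⊕ (a ⊕ b)
  ⊕-assoc (x , y) (a , b) (a′ , b′) = cong₂ _,_ (sym (ℤ.+-assoc a′ a x)) (sym (ℤ.+-assoc b′ b y))

  ⊕-identity : ∀ p → p ⊕ origin ≡ p
  ⊕-identity (x , y) = cong₂ _,_ (ℤ.+-identityˡ x) (ℤ.+-identityˡ y)

  ⊕-neg : ∀ a → a ⊕ neg a ≡ origin
  ⊕-neg (a , b) = cong₂ _,_ (ℤ.+-inverseˡ a) (ℤ.+-inverseˡ b)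

  ⊕-undo : ∀ p a → p ⊕ a ⊕ neg a ≡ p
  ⊕-undo p a = trans (⊕-assoc p a (neg a)) (trans (cong (p ⊕_) (⊕-neg a)) (⊕-identity p))

  ⊕-move : ∀ {p q} a b → p ⊕ a ≡ q ⊕ b → q ≡ p ⊕ (a ⊕ neg b)
  ⊕-move {p} {q} a b e = trans (sym (⊕-undo q b)) (trans (cong (_⊕ neg b) (sym e)) (⊕-assoc p a (neg b)))

  ⊕-comm : ∀ p q → p ⊕ q ≡ q ⊕ p
  ⊕-comm (x , y) (a , b) = cong₂ _,_ (ℤ.+-comm a x) (ℤ.+-comm b y)

  ⊕-cancelˡ : ∀ p {a b} → p ⊕ a ≡ p ⊕ b → a ≡ b
  ⊕-cancelˡ p {a} {b} e = trans (sym (⊕-undo a p)) (trans (cong (_⊕ neg p)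
    (trans (⊕-comm a p) (trans e (⊕-comm p b)))) (⊕-undo b p))

  ⊕ˢ-cancelˡ : ∀ p {s t} → p ⊕ˢ s ≡ p ⊕ˢ t → s ≡ t
  ⊕ˢ-cancelˡ p e = cong₂ _,_ (⊕-cancelˡ p (cong proj₁ e)) (⊕-cancelˡ p (cong proj₂ e))

  ⊕-swap : ∀ p a b → p ⊕ a ⊕ b ≡ p ⊕ b ⊕ a
  ⊕-swap p a b = trans (⊕-assoc p a b) (trans (cong (p ⊕_) (⊕-comm a b)) (sym (⊕-assoc p b a)))

  ⊕-difference : ∀ p a b → p ⊕ a ⊕ (b ⊕ neg a) ≡ p ⊕ b
  ⊕-difference p a b = trans (⊕-assoc p a (b ⊕ neg a)) (cong (p ⊕_)
    (trans (⊕-comm a _) (trans (⊕-assoc b (neg a) a) (trans (cong (b ⊕_) (trans (⊕-comm (neg a) a) (⊕-neg a))) (⊕-identity b)))))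

  move : Dir → Cell → Cell
  move d c = c ⊕ off d

  _∈ᴾ?_ : ∀ (p : Point) ps → Dec (p ∈ ps)
  _∈ᴾ?_ = DecMembership._∈?_ _≟ᴾ_

  -- Translation invariance reduces statements about the sides of squares to finite tables at the
  -- origin. The rewriting is there because `sides c` contains the coordinate `x` itself and not
  -- `0ℤ + x`.
  sides-⊕ : ∀ c → sides c ≡ map (c ⊕ˢ_) (sides origin)
  sides-⊕ (x , y) rewrite ℤ.+-identityˡ x | ℤ.+-identityˡ y = refl

  corners-⊕ : ∀ c → corners c ≡ map (c ⊕_) (corners origin)
  corners-⊕ (x , y) rewrite ℤ.+-identityˡ x | ℤ.+-identityˡ y = refl

  ∈-sides⁻ : ∀ {c s} → s ∈ sides c → ∃ λ o → o ∈ sides origin × s ≡ c ⊕ˢ o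
  ∈-sides⁻ {c} {s} s∈ = ∈-map⁻ (c ⊕ˢ_) (subst (s ∈_) (sides-⊕ c) s∈)

  ∈-sides⁺ : ∀ c {o} → o ∈ sides origin → c ⊕ˢ o ∈ sides c
  ∈-sides⁺ c {o} o∈ = subst (c ⊕ˢ o ∈_) (sym (sides-⊕ c)) (∈-map⁺ (c ⊕ˢ_) o∈)

  ∈-corners⁻ : ∀ {c p} → p ∈ corners c → ∃ λ o → o ∈ corners origin × p ≡ c ⊕ o
  ∈-corners⁻ {c} {p} p∈ = ∈-map⁻ (c ⊕_) (subst (p ∈_) (corners-⊕ c) p∈)

  ∈-corners⁺ : ∀ c {o} → o ∈ corners origin → c ⊕ o ∈ corners c
  ∈-corners⁺ c {o} o∈ = subst (c ⊕ o ∈_) (sym (corners-⊕ c)) (∈-map⁺ (c ⊕_) o∈)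

  Neighbour : Cell → Cell → Set
  Neighbour c d = ∃ λ a → d ≡ move a c

  private
    -- If two squares share a side that is `s` in the first and `t` in the second, both ends of it
    -- yield the offset between the squares, so the two differences agree. Among the sixteen pairs
    -- this leaves the zero offset and the four unit steps.
    common-side : ∀ {s t} → s ∈ sides origin → t ∈ sides origin →
                  proj₁ s ⊕ neg (proj₁ t) ≡ proj₂ s ⊕ neg (proj₂ t) →
                  proj₁ s ⊕ neg (proj₁ t) ∈ origin ∷ map off dirs
    common-side s∈ t∈ = All.lookup (All.lookup table s∈) t∈
      where
      table : All (λ s → All (λ t → proj₁ s ⊕ neg (proj₁ t) ≡ proj₂ s ⊕ neg (proj₂ t) →
                                    proj₁ s ⊕ neg (proj₁ t) ∈ origin ∷ map off dirs) (sides origin)) (sides origin)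
      table = from-yes (all? (λ s → all? (λ t →
        ((proj₁ s ⊕ neg (proj₁ t)) ≟ᴾ (proj₂ s ⊕ neg (proj₂ t))) →-dec
        ((proj₁ s ⊕ neg (proj₁ t)) ∈ᴾ? (origin ∷ map off dirs))) (sides origin)) (sides origin))

    opposite-side : ∀ d → Any (λ t → off d ⊕ˢ t ∈ sides origin) (sides origin)
    opposite-side = from-yes (all-dir? λ d → any? (λ t → (off d ⊕ˢ t) ∈ˢ? sides origin) (sides origin))

    off≢origin : ∀ d → origin ≢ off d
    off≢origin = from-yes (all-dir? λ d → ¬? (origin ≟ᴾ off d))

  ⊕ˢ-assoc : ∀ p a s → p ⊕ a ⊕ˢ s ≡ p ⊕ˢ (a ⊕ˢ s)
  ⊕ˢ-assoc p a (q , r) = cong₂ _,_ (⊕-assoc p a q) (⊕-assoc p a r)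

  move-≢ : ∀ d c → c ≢ move d c
  move-≢ d c e = off≢origin d (⊕-cancelˡ c (trans (⊕-identity c) e))

  Adjacent⇒Neighbour : ∀ {c d} → Adjacent c d → Neighbour c d
  Adjacent⇒Neighbour {c} {d} (c≢d , common) with find common
  ... | s , s∈c , s∈d with ∈-sides⁻ {c} s∈c | ∈-sides⁻ {d} s∈d
  ... | a , a∈ , refl | b , b∈ , e =
    case (common-side a∈ b∈ (⊕-cancelˡ c (trans (sym d≡₁) d≡₂))) d≡₁
    where
    d≡₁ : d ≡ c ⊕ (proj₁ a ⊕ neg (proj₁ b))
    d≡₁ = ⊕-move (proj₁ a) (proj₁ b) (cong proj₁ e)
    d≡₂ : d ≡ c ⊕ (proj₂ a ⊕ neg (proj₂ b))
    d≡₂ = ⊕-move (proj₂ a) (proj₂ b) (cong proj₂ e)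
    case : ∀ {o} → o ∈ origin ∷ map off dirs → d ≡ c ⊕ o → Neighbour c d
    case (here refl) d≡ = contradiction (sym (trans d≡ (⊕-identity c))) c≢d
    case (there o∈) d≡ with ∈-map⁻ off {xs = dirs} o∈
    ... | a , _ , refl = a , d≡

  Neighbour⇒Adjacent : ∀ {c d} → Neighbour c d → Adjacent c d
  Neighbour⇒Adjacent {c} (a , refl) with find (opposite-side a)
  ... | t , t∈ , at∈ = move-≢ a c , lose (∈-sides⁺ c at∈)
    (subst (_∈ sides (move a c)) (⊕ˢ-assoc c (off a) t) (∈-sides⁺ (move a c) t∈))

  open DecUnique _≟ᴾ_ using (deduplicate-!)

  -- The cells, relative to a point p, that have the edge from p in direction d as a side.
  around : Dir → List Point
  around E = origin ∷ off S ∷ []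
  around N = origin ∷ off W ∷ []
  around W = off W ∷ (off W ⊕ off S) ∷ []
  around S = off S ∷ (off W ⊕ off S) ∷ []

  reverse-side : Side → Side
  reverse-side (p , q) = q , p

  orientedSides : List Side
  orientedSides = sides origin ++ map reverse-side (sides origin)

  private
    step-dir : All (λ s → Any (λ d → proj₂ s ⊕ neg (proj₁ s) ≡ off d) dirs) orientedSides
    step-dir = from-yes (all? (λ s → any? (λ d → (proj₂ s ⊕ neg (proj₁ s)) ≟ᴾ off d) dirs) orientedSides)

    -- Seen from the starting point of the side `s`, the cell to which `s` belongs lies at the
    -- offset `neg (proj₁ s)`.
    around-complete : All (λ s → ∀ d → proj₂ s ⊕ neg (proj₁ s) ≡ off d → neg (proj₁ s) ∈ around d) orientedSides
    around-complete = from-yes (all? (λ s → all-dir? λ d →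
      ((proj₂ s ⊕ neg (proj₁ s)) ≟ᴾ off d) →-dec (neg (proj₁ s) ∈ᴾ? around d)) orientedSides)

    around-sound : ∀ d → All (λ o → (neg o , off d ⊕ neg o) ∈ orientedSides) (around d)
    around-sound = from-yes (all-dir? λ d → all? (λ o → (neg o , (off d ⊕ neg o)) ∈ˢ? orientedSides) (around d))

  module _ (cs : List Cell) where

    Edge : Point → Point → Set
    Edge p q = (p , q) ∈ allSides cs ⊎ (q , p) ∈ allSides cs

    ∈-allSides⁻ : ∀ {s} → s ∈ allSides cs → ∃₂ λ c o → c ∈ cs × o ∈ sides origin × s ≡ c ⊕ˢ o
    ∈-allSides⁻ s∈ with find (∈-concatMap⁻ sides {xs = cs} s∈)
    ... | c , c∈ , s∈c with ∈-sides⁻ {c} s∈c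
    ... | o , o∈ , e = c , o , c∈ , o∈ , e

    ∈-allSides⁺ : ∀ {c o} → c ∈ cs → o ∈ sides origin → c ⊕ˢ o ∈ allSides cs
    ∈-allSides⁺ {c} c∈ o∈ = ∈-concatMap⁺ sides {xs = cs} (lose c∈ (∈-sides⁺ c o∈))

    Edge⁻ : ∀ {p q} → Edge p q → ∃₂ λ c o → c ∈ cs × o ∈ orientedSides × (p , q) ≡ c ⊕ˢ o
    Edge⁻ (inj₁ s∈) with ∈-allSides⁻ s∈
    ... | c , o , c∈ , o∈ , e = c , o , c∈ , ∈-++⁺ˡ o∈ , e
    Edge⁻ (inj₂ s∈) with ∈-allSides⁻ s∈
    ... | c , o , c∈ , o∈ , refl =
      c , reverse-side o , c∈ , ∈-++⁺ʳ (sides origin) (∈-map⁺ reverse-side o∈) , refl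

    Edge⁺ : ∀ {c o} → c ∈ cs → o ∈ orientedSides → Edge (c ⊕ proj₁ o) (c ⊕ proj₂ o)
    Edge⁺ c∈ o∈ with ∈-++⁻ (sides origin) o∈
    ... | inj₁ o∈ = inj₁ (∈-allSides⁺ c∈ o∈)
    ... | inj₂ o∈ with ∈-map⁻ reverse-side o∈
    ...   | _ , o∈ , refl = inj₂ (∈-allSides⁺ c∈ o∈)

    Edge⇒around : ∀ {p q} → Edge p q → ∃ λ d → q ≡ p ⊕ off d × Any (λ o → p ⊕ o ∈ cs) (around d)
    Edge⇒around e with Edge⁻ e
    ... | c , o , c∈ , o∈ , refl with find (All.lookup step-dir o∈)
    ... | d , _ , e =
        d , trans (sym (⊕-difference c (proj₁ o) (proj₂ o))) (cong (c ⊕ proj₁ o ⊕_) e)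
      , lose (All.lookup around-complete o∈ d e) (subst (_∈ cs) (sym (⊕-undo c (proj₁ o))) c∈)

    around⇒Edge : ∀ {p} d → Any (λ o → p ⊕ o ∈ cs) (around d) → Edge p (p ⊕ off d)
    around⇒Edge {p} d a with find a
    ... | o , o∈ , c∈ = subst₂ Edge (⊕-undo p o) (⊕-difference p o (off d)) (Edge⁺ c∈ (All.lookup (around-sound d) o∈))

    inner? : ∀ p → (o : Point) → Dec (p ⊕ o ∈ cs)
    inner? p o = (p ⊕ o) ∈ᴾ? cs

    opaque
      -- The degree read off the cells around a point, without vertex indices. In this form the
      -- degree in a whole chain can be compared with the degree in a small window.
      degreeAt : Point → ℕ
      degreeAt p = length (filter (λ d → any? (inner? p) (around d)) dirs)

    ∈-vertices⁺ : ∀ {c o} → c ∈ cs → o ∈ corners origin → c ⊕ o ∈ vertices cs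
    ∈-vertices⁺ {c} c∈ o∈ = ∈-deduplicate⁺ _≟ᴾ_ (∈-concatMap⁺ corners {xs = cs} (lose c∈ (∈-corners⁺ c o∈)))

    ∈-vertices⁻ : ∀ {p} → p ∈ vertices cs → ∃₂ λ c o → c ∈ cs × o ∈ corners origin × p ≡ c ⊕ o
    ∈-vertices⁻ p∈ with find (∈-concatMap⁻ corners {xs = cs} (∈-deduplicate⁻ _≟ᴾ_ (concatMap corners cs) p∈))
    ... | c , c∈ , p∈c with ∈-corners⁻ {c} p∈c
    ... | o , o∈ , e = c , o , c∈ , o∈ , e

    position-injective : ∀ {u v} → position cs u ≡ position cs v → u ≡ v
    position-injective = lookup-injective (deduplicate-! (concatMap corners cs))

    position-surjective : ∀ {p} → p ∈ vertices cs → ∃ λ v → position cs v ≡ p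
    position-surjective p∈ = Any.index p∈ , sym (Any.lookup-index p∈)

    edge-end : ∀ {p q} → Edge p q → p ∈ vertices cs
    edge-end e with Edge⁻ e
    ... | c , o , c∈ , o∈ , refl = ∈-vertices⁺ c∈ (All.lookup ends o∈)
      where
      ends : All (λ s → proj₁ s ∈ corners origin) orientedSides
      ends = from-yes (all? (λ s → proj₁ s ∈ᴾ? corners origin) orientedSides)

    Edge-sym : ∀ {p q} → Edge p q → Edge q p
    Edge-sym = [ inj₂ , inj₁ ]′

    open Graph (graph cs)

    off-injective : ∀ {d e} → off d ≡ off e → d ≡ e
    off-injective {d} {e} = from-yes (all-dir? λ d → all-dir? λ e → (off d ≟ᴾ off e) →-dec (d ≟ᴰ e)) d e

    opaque
      unfolding degreeAt

      degree≡degreeAt : ∀ v → degree v ≡ degreeAt (position cs v)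
      degree≡degreeAt v = trans (map-length (position cs) neighbours↭) (length-map _ dirs′)
        where
        p : Point
        p = position cs v
        dirs′ : List Dir
        dirs′ = filter (λ d → any? (inner? p) (around d)) dirs
        neighbours↭ : map (position cs) (filter (adj? v) (allFin order)) ↭ map (λ d → p ⊕ off d) dirs′
        neighbours↭ = map-↭ (position cs) (Unique.filter⁺ (adj? v) (Unique.allFin⁺ order))
          (Unique.map⁺ (off-injective ∘ ⊕-cancelˡ p) (Unique.filter⁺ (λ d → any? (inner? p) (around d)) dirs-unique))
          into (λ _ _ → position-injective) onto
          where
          dirs-unique : Unique dirs
          dirs-unique = Unique.map⁻ {f = off} (from-yes (unique? (map off dirs)))
          into : ∀ {u} → u ∈ filter (adj? v) (allFin order) → position cs u ∈ map (λ d → p ⊕ off d) dirs′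
          into {u} u∈ =
            let d , e , a = Edge⇒around (proj₂ (∈-filter⁻ (adj? v) {xs = allFin order} u∈))
            in subst (_∈ map (λ d → p ⊕ off d) dirs′) (sym e)
              (∈-map⁺ (λ d → p ⊕ off d) (∈-filter⁺ (λ d → any? (inner? p) (around d)) (∈-dirs d) a))
          onto : ∀ {q} → q ∈ map (λ d → p ⊕ off d) dirs′ → ∃ λ u → u ∈ filter (adj? v) (allFin order) × position cs u ≡ q
          onto {q} q∈ =
            let d , d∈ , q≡ = ∈-map⁻ (λ d → p ⊕ off d) q∈
                e = subst (Edge p) (sym q≡) (around⇒Edge d (proj₂ (∈-filter⁻ (λ d → any? (inner? p) (around d)) {xs = dirs} d∈)))
                u , pos≡ = position-surjective (edge-end (Edge-sym e))
            in u , ∈-filter⁺ (adj? v) (∈-allFin u) (subst (Edge p) (sym pos≡) e) , pos≡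

    ⊕-relative : ∀ c a b → (c ⊕ b) ⊕ neg (c ⊕ a) ≡ b ⊕ neg a
    ⊕-relative (x , y) (a , b) (a′ , b′) = cong₂ _,_ (shift x a a′) (shift y b b′)
      where
      shift : ∀ x a b → ℤ.- (a ℤ.+ x) ℤ.+ (b ℤ.+ x) ≡ ℤ.- a ℤ.+ b
      shift = solve 3 (λ x a b → :- (a :+ x) :+ (b :+ x) := :- a :+ b) refl
        where open +-*-Solver

    -- Sides point east or north and reversed ones do not. Therefore only one orientation of an edge
    -- is a side, and `orient` finds it.
    Edge-irrefl : ∀ {p q} → (p , q) ∈ allSides cs → (q , p) ∉ allSides cs
    Edge-irrefl s∈ t∈ with ∈-allSides⁻ s∈ | ∈-allSides⁻ t∈
    ... | c , o , _ , o∈ , refl | c′ , o′ , _ , o′∈ , e = All.lookup (All.lookup table o∈) o′∈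
      (trans (sym (⊕-relative c (proj₁ o) (proj₂ o)))
        (trans (cong₂ (λ p q → p ⊕ neg q) (cong proj₁ e) (cong proj₂ e)) (⊕-relative c′ (proj₂ o′) (proj₁ o′))))
      where
      table : All (λ s → All (λ t → proj₂ s ⊕ neg (proj₁ s) ≢ proj₁ t ⊕ neg (proj₂ t)) (sides origin)) (sides origin)
      table = from-yes (all? (λ s → all? (λ t → ¬? ((proj₂ s ⊕ neg (proj₁ s)) ≟ᴾ (proj₁ t ⊕ neg (proj₂ t)))) (sides origin)) (sides origin))

    orient : Fin.Fin order × Fin.Fin order → Side
    orient (u , v) = if does ((position cs u , position cs v) ∈ˢ? allSides cs)
                     then (position cs u , position cs v) else (position cs v , position cs u)

    orient-∈ : ∀ {u v} → Adj u v → orient (u , v) ∈ allSides cs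
    orient-∈ {u} {v} a with (position cs u , position cs v) ∈ˢ? allSides cs
    orient-∈ a        | yes s∈ = s∈
    orient-∈ (inj₁ s∈) | no s∉ = contradiction s∈ s∉
    orient-∈ (inj₂ s∈) | no s∉ = s∈

    orient-cases : ∀ u v → orient (u , v) ≡ (position cs u , position cs v) ⊎ orient (u , v) ≡ (position cs v , position cs u)
    orient-cases u v with does ((position cs u , position cs v) ∈ˢ? allSides cs)
    ... | true  = inj₁ refl
    ... | false = inj₂ refl

    orient-edges : ∀ {ss} → Unique ss → (∀ {s} → s ∈ ss → s ∈ allSides cs) → (∀ {s} → s ∈ allSides cs → s ∈ ss) →
                   map orient edges ↭ ss
    orient-edges {ss} u ss⊆ ⊆ss = map-edges-↭ (graph cs) (λ u v → position cs u , position cs v) orient u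
      (λ e → position-injective (cong proj₁ e) , position-injective (cong proj₂ e))
      orient-cases (λ a → ⊆ss (orient-∈ a)) onto
      where
      orient-forward : ∀ {u v} → (position cs u , position cs v) ∈ allSides cs → orient (u , v) ≡ (position cs u , position cs v)
      orient-forward {u} {v} s∈ rewrite dec-true ((position cs u , position cs v) ∈ˢ? allSides cs) s∈ = refl
      orient-backward : ∀ {u v} → (position cs v , position cs u) ∈ allSides cs → orient (u , v) ≡ (position cs v , position cs u)
      orient-backward {u} {v} s∈ rewrite dec-false ((position cs u , position cs v) ∈ˢ? allSides cs) (Edge-irrefl s∈) = refl
      onto : ∀ {s} → s ∈ ss → ∃₂ λ u v → Adj u v × orient (u , v) ≡ s × orient (v , u) ≡ s
      onto {p , q} s∈ =
        let s∈′ = ss⊆ s∈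
            u , u≡ = position-surjective (edge-end (inj₁ s∈′))
            v , v≡ = position-surjective (edge-end (inj₂ s∈′))
            uv∈ = subst₂ (λ p q → (p , q) ∈ allSides cs) (sym u≡) (sym v≡) s∈′
            uv≡ = cong₂ _,_ u≡ v≡
        in u , v , inj₁ uv∈ , trans (orient-forward uv∈) uv≡ , trans (orient-backward uv∈) uv≡

-- Discrete Jordan argument: parity of ray crossings

module Jordan where
  open ≡
  open import Relation.Binary.Construct.Closure.ReflexiveTransitive using (ε)
  open import Relation.Binary.Construct.Closure.ReflexiveTransitive using (_◅_)

  above : ℤ → ℤ → Cell → Bool
  above x y (a , b) = does (a ℤ.≟ x) ∧ does (y ℤ.<? b)

  private
    does-cong : ∀ {P Q : Set} (p? : Dec P) (q? : Dec Q) →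
                (P → Q) → (Q → P) → does p? ≡ does q?
    does-cong (yes _)  (yes _)  f g = refl
    does-cong (no _)   (no _)   f g = refl
    does-cong (yes p)  (no ¬q)  f g = contradiction (f p) ¬q
    does-cong (no ¬p)  (yes q)  f g = contradiction (g q) ¬p

    i<suc[i] : ∀ i → i ℤ.< ℤ.suc i
    i<suc[i] i = ℤ.suc[i]≤j⇒i<j ℤ.≤-refl

  suc-injective : ∀ i j → ℤ.suc i ≡ ℤ.suc j → i ≡ j
  suc-injective i j e = trans (sym (ℤ.pred-suc i)) (trans (cong ℤ.pred e) (ℤ.pred-suc j))

  above-east : ∀ x y c → above (ℤ.suc x) y (east c) ≡ above x y c
  above-east x y (a , b) = cong (_∧ _) (does-cong (ℤ.suc a ℤ.≟ ℤ.suc x) (a ℤ.≟ x) (suc-injective a x) (cong ℤ.suc))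

  above-north : ∀ x y c → c ≢ (x , y) → above x y c ≡ above x y (north c)
  above-north x y (a , b) c≢ with a ℤ.≟ x
  ... | no _ = refl
  ... | yes refl = does-cong (y ℤ.<? b) (y ℤ.<? ℤ.suc b)
    (λ y<b → ℤ.<-trans y<b (i<suc[i] b))
    (λ y<1+b → ℤ.≤∧≢⇒< (subst (y ℤ.≤_) (ℤ.pred-suc b) (ℤ.i<j⇒i≤pred[j] y<1+b)) λ { refl → c≢ refl })

  above-drop : ∀ x y c → c ≢ (x , ℤ.suc y) → above x y c ≡ above x (ℤ.suc y) c
  above-drop x y (a , b) c≢ with a ℤ.≟ x
  ... | no _ = refl
  ... | yes refl = does-cong (y ℤ.<? b) (ℤ.suc y ℤ.<? b)
    (λ y<b → ℤ.≤∧≢⇒< (ℤ.i<j⇒suc[i]≤j y<b) λ { refl → c≢ refl })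
    (ℤ.<-trans (i<suc[i] y))

  data Step (c d : Cell) : Set where
    →E : d ≡ east c → Step c d
    →W : c ≡ east d → Step c d
    →N : d ≡ north c → Step c d
    →S : c ≡ north d → Step c d

  -- Whether the step crosses the vertical ray that starts between columns x and x + 1 and goes up from height y.
  crosses : ℤ → ℤ → ∀ {c d} → Step c d → Bool
  crosses x y {c} (→E _) = above x y c
  crosses x y {_} {d} (→W _) = above x y d
  crosses x y (→N _) = false
  crosses x y (→S _) = false

  -- The rays on the two sides of column `ℤ.suc x` bound the part of that column above height `y`. A
  -- step enters or leaves this strip through one of the rays or through the bottom, and the bottom
  -- is closed because the cell `(ℤ.suc x , y)` is avoided.
  crosses-column : ∀ x y {c d} (s : Step c d) → c ≢ (ℤ.suc x , y) → d ≢ (ℤ.suc x , y) →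
    above (ℤ.suc x) y c xor above (ℤ.suc x) y d ≡ crosses x y s xor crosses (ℤ.suc x) y s
  crosses-column x y {c} (→E refl) _ _ rewrite above-east x y c = solve 2 (λ a b → a :+ b := b :+ a) refl (above (ℤ.suc x) y c) (above x y c)
    where open xor-∧-Solver
  crosses-column x y {_} {d} (→W refl) _ _ rewrite above-east x y d = refl
  crosses-column x y {c} (→N refl) c≢ _ rewrite above-north (ℤ.suc x) y c c≢ = xor-same (above (ℤ.suc x) y (north c))
  crosses-column x y {_} {d} (→S refl) _ d≢ rewrite above-north (ℤ.suc x) y d d≢ = xor-same (above (ℤ.suc x) y (north d))

  -- The two rays are told apart only by a horizontal step at height `ℤ.suc y`, and the left-hand
  -- cell of such a step would be `(x , ℤ.suc y)`.
  crosses-drop : ∀ x y {c d} (s : Step c d) → c ≢ (x , ℤ.suc y) → d ≢ (x , ℤ.suc y) →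
                 crosses x y s ≡ crosses x (ℤ.suc y) s
  crosses-drop x y {c} (→E _) c≢ _ = above-drop x y c c≢
  crosses-drop x y {_} {d} (→W _) _ d≢ = above-drop x y d d≢
  crosses-drop x y (→N _) _ _ = refl
  crosses-drop x y (→S _) _ _ = refl

  module _ (w : ℕ → Cell) (Q : Cell → Set) where

    data Walk : ℕ → Set where
      []  : Q (w 0) → Walk 0
      _∷_ : ∀ {l} → (Step (w l) (w (suc l)) × Q (w (suc l))) → Walk l → Walk (suc l)

    end-Q : ∀ {l} → Walk l → Q (w l)
    end-Q ([] q) = q
    end-Q ((_ , q) ∷ _) = q

    crossings : ℤ → ℤ → ∀ {l} → Walk l → Bool
    crossings x y ([] _) = false
    crossings x y ((s , _) ∷ ss) = crosses x y s xor crossings x y ss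

    module _ {x y : ℤ} where
      crossings-column : ¬ Q (ℤ.suc x , y) → ∀ {l} (ss : Walk l) →
        above (ℤ.suc x) y (w 0) xor above (ℤ.suc x) y (w l) ≡ crossings x y ss xor crossings (ℤ.suc x) y ss
      crossings-column ¬q ([] _) = xor-same (above (ℤ.suc x) y (w 0))
      crossings-column ¬q {suc l} ((s , q) ∷ ss) = trans
        (solve 3 (λ a b c → a :+ c := (b :+ c) :+ (a :+ b)) refl (r (w 0)) (r (w l)) (r (w (suc l))))
        (trans (cong₂ _xor_ (crosses-column x y s (λ { e → ¬q (subst Q e (end-Q ss)) }) (λ { e → ¬q (subst Q e q) })) (crossings-column ¬q ss))
          (solve 4 (λ a b c d → (a :+ b) :+ (c :+ d) := (a :+ c) :+ (b :+ d)) refl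
            (crosses x y s) (crosses (ℤ.suc x) y s) (crossings x y ss) (crossings (ℤ.suc x) y ss)))
        where
        open xor-∧-Solver
        r : Cell → Bool
        r = above (ℤ.suc x) y

      crossings-drop : ¬ Q (x , ℤ.suc y) → ∀ {l} (ss : Walk l) → crossings x y ss ≡ crossings x (ℤ.suc y) ss
      crossings-drop ¬q ([] _) = refl
      crossings-drop ¬q ((s , q) ∷ ss) = cong₂ _xor_
        (crosses-drop x y s (λ { e → ¬q (subst Q e (end-Q ss)) }) (λ { e → ¬q (subst Q e q) })) (crossings-drop ¬q ss)

    -- The closed curve made of the walk and of the diagonal from o to east (north o).  The diagonal is
    -- pushed to the step from o to east o followed by a vertical step, which crosses no ray; the parity of the
    -- crossings is then locally constant off the walk, but differs at north o and east o.
    module _ {l} (ss : Walk l) (o : Cell) (Qo : Q o)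
             (ends : ∀ (r : Cell → Bool) → r (w 0) xor r (w l) ≡ r o xor r (east (north o))) where

      parity : Cell → Bool
      parity (x , y) = crossings x y ss xor above x y o

      -- Moving the ray by one column changes the crossings of the walk by the values of
      -- `above (ℤ.suc x) y` at its ends. By `ends` these may be taken at the ends of the diagonal,
      -- where they give exactly the change of the diagonal's own contribution; the two changes
      -- cancel.
      parity-east : ∀ c → ¬ Q c → ¬ Q (east c) → parity c ≡ parity (east c)
      parity-east (x , y) ¬q ¬q′ = begin
        cˣ xor a                  ≡⟨ solve 3 (λ c a c′ → c :+ a := (c :+ c′) :+ (c′ :+ a)) refl cˣ a cˢ ⟩
        (cˣ xor cˢ) xor (cˢ xor a)  ≡⟨ cong (_xor (cˢ xor a)) (trans (sym (crossings-column ¬q′ ss)) (ends (above (ℤ.suc x) y))) ⟩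
        (a′ xor above (ℤ.suc x) y (east (north o))) xor (cˢ xor a)
          ≡⟨ cong (λ b → (a′ xor b) xor (cˢ xor a)) (trans (above-east x y (north o)) (sym (above-north x y o λ { e → ¬q (subst Q e Qo) }))) ⟩
        (a′ xor a) xor (cˢ xor a)   ≡⟨ solve 3 (λ a a′ c → (a′ :+ a) :+ (c :+ a) := c :+ a′) refl a a′ cˢ ⟩
        cˢ xor a′                 ∎
        where
        open ≡-Reasoning
        open xor-∧-Solver
        cˣ cˢ a a′ : Bool
        cˣ = crossings x y ss
        cˢ = crossings (ℤ.suc x) y ss
        a  = above x y o
        a′ = above (ℤ.suc x) y o

      parity-north : ∀ c → ¬ Q c → ¬ Q (north c) → parity c ≡ parity (north c)
      parity-north (x , y) ¬q ¬q′ = cong₂ _xor_ (crossings-drop ¬q′ ss)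
        (above-drop x y o λ { e → ¬q′ (subst Q e Qo) })

      -- The diagonal separates the two cells. In formulas: it contributes `false` to both parities,
      -- the ray of `north o` may be extended down to height `y`, and the crossings of the two rays
      -- then differ by `above (ℤ.suc x) y` at `o` and at `east (north o)`, which is
      -- `false xor true`.
      parity-corner : ¬ Q (north o) → ¬ Q (east o) → parity (north o) ≢ parity (east o)
      parity-corner ¬qn ¬qe e = contradiction (begin
        true                                          ≡⟨ trans (sym above-self) (sym (above-east x y (north o))) ⟩
        false xor above (ℤ.suc x) y (east (north o))  ≡⟨ cong (_xor above (ℤ.suc x) y (east (north o))) (sym above-left) ⟩
        above (ℤ.suc x) y o xor above (ℤ.suc x) y (east (north o))  ≡⟨ trans (sym (ends (above (ℤ.suc x) y))) (crossings-column ¬qe ss) ⟩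
        cˣ xor cˢ                                     ≡⟨ cong (_xor cˢ) cˣ≡cˢ ⟩
        cˢ xor cˢ                                     ≡⟨ xor-same cˢ ⟩
        false                                         ∎) λ ()
        where
        open ≡-Reasoning
        x y : ℤ
        x = proj₁ o
        y = proj₂ o
        cˣ cˢ : Bool
        cˣ = crossings x y ss
        cˢ = crossings (ℤ.suc x) y ss
        above-self : above x y (north o) ≡ true
        above-self = cong₂ _∧_ (dec-true (x ℤ.≟ x) refl) (dec-true (y ℤ.<? ℤ.suc y) (i<suc[i] y))
        above-left : above (ℤ.suc x) y o ≡ false
        above-left = cong (_∧ does (y ℤ.<? y)) (dec-false (x ℤ.≟ ℤ.suc x) ℤ.i≢suc[i])
        above-below : above x (ℤ.suc y) o ≡ false
        above-below = trans (cong (does (x ℤ.≟ x) ∧_) (dec-false (ℤ.suc y ℤ.<? y) (ℤ.<-asym (i<suc[i] y)))) (∧-zeroʳ (does (x ℤ.≟ x)))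
        cˣ≡cˢ : cˣ ≡ cˢ
        cˣ≡cˢ = begin
          cˣ                                           ≡⟨ crossings-drop ¬qn ss ⟩
          crossings x (ℤ.suc y) ss                     ≡⟨ xor-identityʳ _ ⟨
          crossings x (ℤ.suc y) ss xor false           ≡⟨ cong (crossings x (ℤ.suc y) ss xor_) above-below ⟨
          parity (north o)                             ≡⟨ e ⟩
          cˢ xor above (ℤ.suc x) y o                   ≡⟨ cong (cˢ xor_) above-left ⟩
          cˢ xor false                                 ≡⟨ xor-identityʳ cˢ ⟩
          cˢ                                           ∎

      parity-star : ∀ {c d} → Star (λ a b → Step a b × ¬ Q b) c d → ¬ Q c → parity c ≡ parity d
      parity-star ε ¬q = refl
      parity-star {c} ((→E refl , ¬q′) ◅ ps) ¬q = trans (parity-east c ¬q ¬q′) (parity-star ps ¬q′)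
      parity-star ((→W refl , ¬q′) ◅ ps) ¬q = trans (sym (parity-east _ ¬q′ ¬q)) (parity-star ps ¬q′)
      parity-star {c} ((→N refl , ¬q′) ◅ ps) ¬q = trans (parity-north c ¬q ¬q′) (parity-star ps ¬q′)
      parity-star ((→S refl , ¬q′) ◅ ps) ¬q = trans (sym (parity-north _ ¬q′ ¬q)) (parity-star ps ¬q′)

-- From polyomino chains to sequences of cells and directions

module Chains where
  open ≡
  open Grid
  open Jordan

  Neighbour⇒Step : ∀ {c d} → Neighbour c d → Step c d
  Neighbour⇒Step {x , y} (E , refl) = →E (cong (ℤ.suc x ,_) (ℤ.+-identityˡ y))
  Neighbour⇒Step {x , y} (N , refl) = →N (cong (_, ℤ.suc y) (ℤ.+-identityˡ x))
  Neighbour⇒Step {x , y} (W , refl) = →W (cong₂ _,_ (sym (ℤ.suc-pred x)) (sym (ℤ.+-identityˡ y)))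
  Neighbour⇒Step {x , y} (S , refl) = →S (cong₂ _,_ (sym (ℤ.+-identityˡ x)) (sym (ℤ.suc-pred y)))

  Step⇒Neighbour : ∀ {c d} → Step c d → Neighbour c d
  Step⇒Neighbour {x , y} (→E refl) = E , cong (ℤ.suc x ,_) (sym (ℤ.+-identityˡ y))
  Step⇒Neighbour {x , y} (→N refl) = N , cong (_, ℤ.suc y) (sym (ℤ.+-identityˡ x))
  Step⇒Neighbour {_} {x , y} (→W refl) = W , cong₂ _,_ (sym (ℤ.pred-suc x)) (sym (ℤ.+-identityˡ y))
  Step⇒Neighbour {_} {x , y} (→S refl) = S , cong₂ _,_ (sym (ℤ.+-identityˡ x)) (sym (ℤ.pred-suc y))

  Step-sym : ∀ {c d} → Step c d → Step d c
  Step-sym (→E e) = →W e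
  Step-sym (→W e) = →E e
  Step-sym (→N e) = →S e
  Step-sym (→S e) = →N e

  Neighbour-sym : ∀ {c d} → Neighbour c d → Neighbour d c
  Neighbour-sym = Step⇒Neighbour ∘ Step-sym ∘ Neighbour⇒Step

  flip : Cell → Cell
  flip (x , y) = x , ℤ.- y

  flip-north : ∀ c → flip c ≡ north (flip (north c))
  flip-north (x , y) = cong (x ,_) (sym (trans (cong ℤ.suc (ℤ.neg-distrib-+ 1ℤ y)) (ℤ.suc-pred (ℤ.- y))))

  flip-step : ∀ {c d} → Step c d → Step (flip c) (flip d)
  flip-step (→E refl) = →E refl
  flip-step (→W refl) = →W refl
  flip-step {c} (→N refl) = →S (flip-north c)
  flip-step {_} {d} (→S refl) = →N (flip-north d)

  flip-involutive : ∀ c → flip (flip c) ≡ c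
  flip-involutive (x , y) = cong (x ,_) (ℤ.neg-involutive y)

  Apart : ℕ → ℕ → ℕ → Set
  Apart k i j = j ≡ k ℕ.+ i ⊎ i ≡ k ℕ.+ j

  diagonals : List Point
  diagonals = (1ℤ , 1ℤ) ∷ (-1ℤ , 1ℤ) ∷ (-1ℤ , -1ℤ) ∷ (1ℤ , -1ℤ) ∷ []

  -- The interface through which the local analysis sees a chain. The sequences are total on ℕ, but
  -- they are constrained only up to index `l`, the directions only below `l`. The field `diagonal`
  -- carries the outcome of the Jordan argument.
  record Chain (l : ℕ) : Set where
    field
      s : ℕ → Cell
      d : ℕ → Dir
      step      : ∀ {j} → j ℕ.< l → s (suc j) ≡ move (d j) (s j)
      injective : ∀ {i j} → i ℕ.≤ l → j ℕ.≤ l → s i ≡ s j → i ≡ j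
      adjacent  : ∀ {i j} → i ℕ.≤ l → j ℕ.≤ l → Neighbour (s i) (s j) → Apart 1 i j
      diagonal  : ∀ {i j δ} → i ℕ.≤ l → j ℕ.≤ l → δ ∈ diagonals → s j ≡ s i ⊕ δ → Apart 2 i j

  Apart-trans : ∀ {i j k} → Apart 1 i k → Apart 1 k j → i ≢ j → Apart 2 i j
  Apart-trans (inj₁ refl) (inj₁ refl) _ = inj₁ refl
  Apart-trans (inj₁ refl) (inj₂ refl) i≢j = contradiction refl i≢j
  Apart-trans (inj₂ refl) (inj₁ refl) i≢j = contradiction refl i≢j
  Apart-trans (inj₂ refl) (inj₂ refl) _ = inj₂ refl

  ∣-∣≡1⇒Apart : ∀ i j → ∣ i - j ∣ ≡ 1 → Apart 1 i j
  ∣-∣≡1⇒Apart zero    j       e = inj₁ e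
  ∣-∣≡1⇒Apart (suc i) zero    e = inj₂ e
  ∣-∣≡1⇒Apart (suc i) (suc j) e = [ inj₁ ∘ cong suc , inj₂ ∘ cong suc ]′ (∣-∣≡1⇒Apart i j e)

  clip : ∀ {n l} → n ≡ suc l → ℕ → Fin n
  clip {n} {l} n≡ k = Fin.fromℕ< {k ℕ.⊓ l} (subst (k ℕ.⊓ l ℕ.<_) (sym n≡) (ℕ.s≤s (ℕ.m⊓n≤n k l)))

  toℕ-clip : ∀ {n l k} (n≡ : n ≡ suc l) → k ℕ.≤ l → toℕ (clip n≡ k) ≡ k
  toℕ-clip n≡ k≤l = trans (Fin.toℕ-fromℕ< _) (ℕ.m≤n⇒m⊓n≡m k≤l)

  toℕ≤ : ∀ {n l} → n ≡ suc l → (i : Fin n) → toℕ i ℕ.≤ l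
  toℕ≤ n≡ i = ℕ.s≤s⁻¹ (subst (toℕ i ℕ.<_) n≡ (Fin.toℕ<n i))

  clip-toℕ : ∀ {n l} (n≡ : n ≡ suc l) (i : Fin n) → clip n≡ (toℕ i) ≡ i
  clip-toℕ n≡ i = Fin.toℕ-injective (toℕ-clip n≡ (toℕ≤ n≡ i))

  -- The number of squares is kept a variable, so that the list of squares does not unfold.
  module _ {n l} (n≡ : n ≡ suc l) (B : PolyominoChain n) where
    open PolyominoChain B

    cell : ℕ → Cell
    cell k = square (clip n≡ k)

    cell-injective : ∀ {i j} → i ℕ.≤ l → j ℕ.≤ l → cell i ≡ cell j → i ≡ j
    cell-injective i≤ j≤ e = trans (sym (toℕ-clip n≡ i≤)) (trans (cong toℕ (distinct e)) (toℕ-clip n≡ j≤))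

    cell-adjacent : ∀ {i j} → i ℕ.≤ l → j ℕ.≤ l → Neighbour (cell i) (cell j) → Apart 1 i j
    cell-adjacent {i} {j} i≤ j≤ n = ∣-∣≡1⇒Apart i j (subst₂ (λ i j → ∣ i - j ∣ ≡ 1) (toℕ-clip n≡ i≤) (toℕ-clip n≡ j≤)
      (Equivalence.to (consecutive (clip n≡ i) (clip n≡ j)) (Neighbour⇒Adjacent n)))

    cell-step : ∀ {j} → j ℕ.< l → Neighbour (cell j) (cell (suc j))
    cell-step {j} j< = Adjacent⇒Neighbour (Equivalence.from (consecutive (clip n≡ j) (clip n≡ (suc j)))
      (trans (cong₂ ∣_-_∣ (toℕ-clip n≡ (ℕ.<⇒≤ j<)) (toℕ-clip n≡ j<))
        (trans (cong (∣ j -_∣) (ℕ.+-comm 1 j)) (ℕ.∣m-m+n∣≡n j 1))))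

    ∈-squares⁻ : ∀ {c} → c ∈ squares → ∃ λ k → k ℕ.≤ l × c ≡ cell k
    ∈-squares⁻ c∈ with ∈-tabulate⁻ {f = square} c∈
    ... | i , refl = toℕ i , toℕ≤ n≡ i , cong square (sym (clip-toℕ n≡ i))

    cell-∈ : ∀ k → cell k ∈ squares
    cell-∈ k = ∈-tabulate⁺ {f = square} (clip n≡ k)

    -- ρ is the identity or a reflection that turns the other diagonal into this one.
    private
      module _ (ρ : Cell → Cell) (ρ-involutive : ∀ c → ρ (ρ c) ≡ c) (ρ-step : ∀ {c d} → Step c d → Step (ρ c) (ρ d)) where

        Q : Cell → Set
        Q c = ρ c ∈ squares

        walk : ∀ i k → i ℕ.+ k ℕ.≤ l → Walk (λ t → ρ (cell (i ℕ.+ t))) Q k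
        walk i zero    _  = [] (subst (_∈ squares) (sym (ρ-involutive _)) (cell-∈ (i ℕ.+ 0)))
        walk i (suc k) i+k≤l = (ρ-step (Neighbour⇒Step (subst (λ t → Neighbour (cell (i ℕ.+ k)) (cell t)) (sym (ℕ.+-suc i k))
            (cell-step (subst (ℕ._≤ l) (ℕ.+-suc i k) i+k≤l))))
          , subst (_∈ squares) (sym (ρ-involutive _)) (cell-∈ (i ℕ.+ suc k)))
          ∷ walk i k (ℕ.≤-trans (ℕ.+-monoʳ-≤ i (ℕ.n≤1+n k)) i+k≤l)

        complement-path : ∀ {c d} → ρ c ∉ squares → ρ d ∉ squares → Star (λ a b → Step a b × ¬ Q b) c d
        complement-path c∉ d∉ = subst₂ (Star _) (ρ-involutive _) (ρ-involutive _) (Star.gmap ρ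
          (λ { (a , b∉) → ρ-step (Neighbour⇒Step (Adjacent⇒Neighbour a)) , λ b∈ → b∉ (subst (_∈ squares) (ρ-involutive _) b∈) })
          (onlySquaresInside c∉ d∉))

        between : ∀ {c i j} → i ℕ.≤ l → j ℕ.≤ l → ρ c ∈ squares → Step (ρ (cell i)) c → Step c (ρ (cell j)) →
                  i ≢ j → Apart 2 i j
        between i≤ j≤ c∈ a b i≢j with ∈-squares⁻ c∈
        ... | k , k≤ , e = Apart-trans
          (cell-adjacent i≤ k≤ (Step⇒Neighbour (subst₂ Step (ρ-involutive _) e (ρ-step a))))
          (cell-adjacent k≤ j≤ (Step⇒Neighbour (subst₂ Step e (ρ-involutive _) (ρ-step b)))) i≢j

        -- Two squares that touch at a corner have two common neighbour cells. If one of these is in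
        -- the chain, its index is next to both `i` and `j`. If neither is, the walk along the chain
        -- closed up by the diagonal separates two cells of the complement, which is connected.
        cell-corner : ∀ {i j} → i ℕ.≤ l → j ℕ.≤ l → ρ (cell j) ≡ east (north (ρ (cell i))) → Apart 2 i j
        cell-corner {i} {j} i≤ j≤ e with ρ (north (ρ (cell i))) ∈ᴾ? squares | ρ (east (ρ (cell i))) ∈ᴾ? squares
        ... | yes c∈ | _ = between i≤ j≤ c∈ (→N refl) (→E e) λ { refl → i≢j refl }
          where
          i≢j : i ≢ j
          i≢j refl = ℤ.i≢suc[i] (cong proj₁ e)
        ... | no _ | yes c∈ = between i≤ j≤ c∈ (→E refl) (→N e) λ { refl → ℤ.i≢suc[i] (cong proj₁ e) }
        ... | no n∉ | no e∉ = contradiction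
          (parity-star w Q ss o Qo ends (complement-path n∉ e∉) n∉) (parity-corner w Q ss o Qo ends n∉ e∉)
          where
          o : Cell
          o = ρ (cell i)
          Qo : Q o
          Qo = subst (_∈ squares) (sym (ρ-involutive _)) (cell-∈ i)
          -- The walk starts at the smaller index, whichever of the two squares has it; `ends` is
          -- symmetric in the two ends of the walk.
          lo k : ℕ
          lo = i ℕ.⊓ j
          k = i ℕ.⊔ j ∸ lo
          w : ℕ → Cell
          w t = ρ (cell (lo ℕ.+ t))
          lo+k : lo ℕ.+ k ≡ i ℕ.⊔ j
          lo+k = ℕ.m+[n∸m]≡n (ℕ.≤-trans (ℕ.m⊓n≤m i j) (ℕ.m≤m⊔n i j))
          ss : Walk w Q k
          ss = walk lo k (subst (ℕ._≤ l) (sym lo+k) (ℕ.⊔-lub i≤ j≤))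
          ends : ∀ (r : Cell → Bool) → r (w 0) xor r (w k) ≡ r o xor r (east (north o))
          ends r rewrite ℕ.+-identityʳ lo | lo+k | sym e with ℕ.≤-total i j
          ... | inj₁ i≤j rewrite ℕ.m≤n⇒m⊓n≡m i≤j | ℕ.m≤n⇒m⊔n≡n i≤j = refl
          ... | inj₂ j≤i rewrite ℕ.m≥n⇒m⊓n≡n j≤i | ℕ.m≥n⇒m⊔n≡m j≤i = xor-comm (r (ρ (cell j))) _

    flip-corner : ∀ c {c′} → c′ ≡ c ⊕ (1ℤ , -1ℤ) → flip c′ ≡ east (north (flip c))
    flip-corner (x , y) e = trans (cong flip e) (cong (ℤ.suc x ,_) (ℤ.neg-distrib-+ -1ℤ y))

    -- South-west is north-east with the two squares exchanged; the other two diagonals become these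
    -- two under the reflection `flip`.
    cell-diagonal : ∀ {i j δ} → i ℕ.≤ l → j ℕ.≤ l → δ ∈ diagonals → cell j ≡ cell i ⊕ δ → Apart 2 i j
    cell-diagonal i≤ j≤ (here refl) e = cell-corner id (λ _ → refl) id i≤ j≤ e
    cell-diagonal {i} {j} i≤ j≤ (there (here refl)) e = swap (cell-corner flip flip-involutive flip-step j≤ i≤
      (flip-corner (cell j) (trans (sym (⊕-undo (cell i) (-1ℤ , 1ℤ))) (cong (_⊕ (1ℤ , -1ℤ)) (sym e)))))
    cell-diagonal i≤ j≤ (there (there (here refl))) e = swap (cell-corner id (λ _ → refl) id j≤ i≤
      (trans (sym (⊕-undo _ (-1ℤ , -1ℤ))) (cong (_⊕ (1ℤ , 1ℤ)) (sym e))))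
    cell-diagonal {i} i≤ j≤ (there (there (there (here refl)))) e = cell-corner flip flip-involutive flip-step i≤ j≤ (flip-corner (cell i) e)

    -- The direction is read off a proof of adjacency, which must not be unfolded.
    opaque
      direction : ∀ j → ∃ λ a → j ℕ.< l → cell (suc j) ≡ move a (cell j)
      direction j with j ℕ.<? l
      ... | yes j<l = proj₁ (cell-step j<l) , λ _ → proj₂ (cell-step j<l)
      ... | no j≮l  = E , λ j<l → contradiction j<l j≮l

    chain : Chain l
    chain = record
      { s = cell
      ; d = λ j → proj₁ (direction j)
      ; step = λ {j} → proj₂ (direction j)
      ; injective = cell-injective
      ; adjacent = cell-adjacent
      ; diagonal = cell-diagonal
      }

-- Local configurations: degrees in a window of at most five squares

module Windows where
  open ≡
  open Grid
  open Chains
  import Data.List.Sort.InsertionSort ℕ.≤-decTotalOrder as Sorting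
  open import Data.List.Sort.Base ℕ.≤-totalOrder using (SortingAlgorithm)

  open SortingAlgorithm Sorting.insertionSort using (sort; sort-↭)

  -- Cells near a square, relative to it; the directions of the steps are listed from the square outwards.
  behind ahead : List Dir → List Point
  behind []           = []
  behind (b ∷ [])     = neg (off b) ∷ []
  behind (b ∷ b′ ∷ _) = neg (off b) ∷ (neg (off b) ⊕ neg (off b′)) ∷ []
  ahead []           = []
  ahead (a ∷ [])     = off a ∷ []
  ahead (a ∷ a′ ∷ _) = off a ∷ (off a ⊕ off a′) ∷ []

  window : List Dir → List Dir → List Point
  window bs as = origin ∷ behind bs ++ ahead as

  opaque
    windowDegree : List Point → Point → ℕ
    windowDegree w p = length (filter (λ d → any? (λ o → (p ⊕ o) ∈ᴾ? w) (around d)) dirs)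

  windowWeight : List Point → Side → ℕ
  windowWeight w (p , q) = windowDegree w p ℕ.+ windowDegree w q

  turn : Dir → Dir → Bool
  turn x y = not (does (x ≟ᴰ y))

  toℕᵇ : Bool → ℕ
  toℕᵇ b = if b then 1 else 0

  kink : Dir → Dir → ℕ
  kink x y = toℕᵇ (turn x y)

  module _ (x y : Dir) where
    NoReversal : Set
    NoReversal = y ≢ opp x

    noReversal? : Dec NoReversal
    noReversal? = ¬? (y ≟ᴰ opp x)

  OnJust : (Dir → Set) → Maybe Dir → Set
  OnJust P = maybe P ⊤

  onJust? : ∀ {P : Dir → Set} → (∀ d → Dec (P d)) → ∀ m → Dec (OnJust P m)
  onJust? P? (just d) = P? d
  onJust? P? nothing  = yes tt

  all-maybe-dir? : ∀ {p} {P : Maybe Dir → Set p} → (∀ m → Dec (P m)) → Dec (∀ m → P m)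
  all-maybe-dir? P? = map′ (λ { (n , j) nothing → n ; (n , j) (just d) → j d }) (λ f → f nothing , λ d → f (just d))
    (P? nothing ×-dec all-dir? (λ d → P? (just d)))

  fromMaybeᴸ : Maybe Dir → List Dir
  fromMaybeᴸ = maybe (_∷ []) []

  -- b′, b, a, a′ are the directions of consecutive steps.
  Valid : Maybe Dir → Dir → Dir → Maybe Dir → Set
  Valid mb b a ma = NoReversal b a
    × OnJust (λ b′ → NoReversal b′ b × NoReversal b′ a) mb
    × OnJust (λ a′ → NoReversal a a′ × NoReversal b a′) ma

  valid? : ∀ mb b a ma → Dec (Valid mb b a ma)
  valid? mb b a ma = noReversal? b a
    ×-dec onJust? (λ b′ → noReversal? b′ b ×-dec noReversal? b′ a) mb
    ×-dec onJust? (λ a′ → noReversal? a a′ ×-dec noReversal? b a′) ma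

  -- The premises describe a segment of length 3 between two kinks, and the conclusion makes these
  -- turn in opposite senses. The alternative is a U-turn, whose middle square has a side joining
  -- two vertices of degree 3.
  Staircase : Dir → Dir → Dir → Dir → Set
  Staircase b′ b a a′ = b′ ≢ b → b ≡ a → a ≢ a′ → a′ ≡ b′

  staircase? : ∀ b′ b a a′ → Dec (Staircase b′ b a a′)
  staircase? b′ b a a′ = ¬? (b′ ≟ᴰ b) →-dec ((b ≟ᴰ a) →-dec (¬? (a ≟ᴰ a′) →-dec (a′ ≟ᴰ b′)))

  StaircaseM : Maybe Dir → Dir → Dir → Maybe Dir → Set
  StaircaseM mb b a ma = OnJust (λ b′ → OnJust (Staircase b′ b a) ma) mb

  middle : Maybe Dir → Dir → Dir → Maybe Dir → List Point
  middle mb b a ma = window (b ∷ fromMaybeᴸ mb) (a ∷ fromMaybeᴸ ma)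

  -- The side shared with the next square is left to that square, so that in total each side is
  -- listed once.
  others : Dir → List Side
  others a = filter (λ s → ¬? (s ∈ˢ? map (off a ⊕ˢ_) (sides origin))) (sides origin)

  _≟ᴸ_ : (xs ys : List ℕ) → Dec (xs ≡ ys)
  _≟ᴸ_ = ≡-dec ℕ._≟_

  -- Equality of multisets, expressed through sorting so that the finite tables can be decided by
  -- evaluation.
  SameBag : List ℕ → List ℕ → Set
  SameBag xs ys = sort xs ≡ sort ys

  sameBag⇒↭ : ∀ {xs ys} → SameBag xs ys → xs ↭ ys
  sameBag⇒↭ {xs} {ys} e = ↭-trans (↭-sym (sort-↭ xs)) (↭-trans (↭-reflexive e) (sort-↭ ys))

  kinkBefore : Maybe Dir → Dir → ℕ
  kinkBefore mb b = maybe (λ b′ → kink b′ b) 0 mb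

  kinkAfter : Dir → Maybe Dir → ℕ
  kinkAfter a ma = maybe (kink a) 0 ma

  opaque
    unfolding windowDegree

    -- A kink creates a vertex of degree 2 and, at the opposite corner of its square, one of degree
    -- 4; the subtractions never truncate. The staircase condition bears on the pattern kink,
    -- straight, kink: there the two vertices of degree 4 lie on different free sides of the middle
    -- square, which both get weight 7, whereas a U-turn would give 8 and 6.
    middle-weights : ∀ mb b a ma → Valid mb b a ma → StaircaseM mb b a ma →
      SameBag (map (windowWeight (middle mb b a ma)) (others a))
              (6 ℕ.+ (kinkBefore mb b ℕ.+ kink b a) ∷ 6 ℕ.+ kinkBefore mb b ∸ kink b a ∷ 6 ℕ.+ kinkAfter a ma ∸ kink b a ∷ [])
    middle-weights = from-yes (all-maybe-dir? λ mb → all-dir? λ b → all-dir? λ a → all-maybe-dir? λ ma →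
      valid? mb b a ma →-dec (onJust? (λ b′ → onJust? (staircase? b′ b a) ma) mb →-dec
      (sort (map (windowWeight (middle mb b a ma)) (others a)) ≟ᴸ
       sort (6 ℕ.+ (kinkBefore mb b ℕ.+ kink b a) ∷ 6 ℕ.+ kinkBefore mb b ∸ kink b a ∷ 6 ℕ.+ kinkAfter a ma ∸ kink b a ∷ []))))

    first-weights : ∀ a a′ → NoReversal a a′ →
      SameBag (map (windowWeight (window [] (a ∷ a′ ∷ []))) (others a)) (4 ∷ 5 ∷ 5 ℕ.+ kink a a′ ∷ [])
    first-weights = from-yes (all-dir? λ a → all-dir? λ a′ → noReversal? a a′ →-dec
      (sort (map (windowWeight (window [] (a ∷ a′ ∷ []))) (others a)) ≟ᴸ sort (4 ∷ 5 ∷ 5 ℕ.+ kink a a′ ∷ [])))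

    last-weights : ∀ b b′ → NoReversal b′ b →
      SameBag (map (windowWeight (window (b ∷ b′ ∷ []) [])) (sides origin))
              (6 ℕ.+ kink b′ b ∷ 4 ∷ 5 ∷ 5 ℕ.+ kink b′ b ∷ [])
    last-weights = from-yes (all-dir? λ b → all-dir? λ b′ → noReversal? b′ b →-dec
      (sort (map (windowWeight (window (b ∷ b′ ∷ []) [])) (sides origin)) ≟ᴸ
       sort (6 ℕ.+ kink b′ b ∷ 4 ∷ 5 ∷ 5 ℕ.+ kink b′ b ∷ [])))

  FreeCorner : List Point → Set
  FreeCorner w = Any (λ o → windowDegree w o ≡ 2) (corners origin)

  freeCorner? : ∀ w → Dec (FreeCorner w)
  freeCorner? w = any? (λ o → windowDegree w o ℕ.≟ 2) (corners origin)

  opaque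
    unfolding windowDegree

    turn⇒freeCorner : ∀ mb b a ma → Valid mb b a ma → b ≢ a → FreeCorner (middle mb b a ma)
    turn⇒freeCorner = from-yes (all-maybe-dir? λ mb → all-dir? λ b → all-dir? λ a → all-maybe-dir? λ ma →
      valid? mb b a ma →-dec (¬? (b ≟ᴰ a) →-dec freeCorner? (middle mb b a ma)))

    freeCorner⇒turn : ∀ mb b a ma → Valid mb b a ma → FreeCorner (middle mb b a ma) → b ≢ a
    freeCorner⇒turn = from-yes (all-maybe-dir? λ mb → all-dir? λ b → all-dir? λ a → all-maybe-dir? λ ma →
      valid? mb b a ma →-dec (freeCorner? (middle mb b a ma) →-dec ¬? (b ≟ᴰ a)))

    -- In a U-turn the two vertices of degree 4 lie on the same side of the middle square; the
    -- required side is the one opposite to it.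
    U-turn-edge : ∀ b′ b a a′ → Valid (just b′) b a (just a′) → b′ ≢ b → b ≡ a → a ≢ a′ → a′ ≢ b′ →
      Any (λ s → windowDegree (middle (just b′) b a (just a′)) (proj₁ s) ≡ 3
               × windowDegree (middle (just b′) b a (just a′)) (proj₂ s) ≡ 3) (sides origin)
    U-turn-edge = from-yes (all-dir? λ b′ → all-dir? λ b → all-dir? λ a → all-dir? λ a′ →
      valid? (just b′) b a (just a′) →-dec (¬? (b′ ≟ᴰ b) →-dec ((b ≟ᴰ a) →-dec (¬? (a ≟ᴰ a′) →-dec (¬? (a′ ≟ᴰ b′) →-dec
      any? (λ s → (windowDegree (middle (just b′) b a (just a′)) (proj₁ s) ℕ.≟ 3) ×-dec
                  (windowDegree (middle (just b′) b a (just a′)) (proj₂ s) ℕ.≟ 3)) (sides origin))))))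

  side-ends : All (λ t → proj₁ t ∈ corners origin × proj₂ t ∈ corners origin) (sides origin)
  side-ends = from-yes (all? (λ t → (proj₁ t ∈ᴾ? corners origin) ×-dec (proj₂ t ∈ᴾ? corners origin)) (sides origin))

  nearby : List Point
  nearby = origin ∷ map off dirs ++ diagonals

  private
    corner-nearby : All (λ p → ∀ d → All (λ o → p ⊕ o ∈ nearby) (around d)) (corners origin)
    corner-nearby = from-yes (all? (λ p → all-dir? λ d → all? (λ o → (p ⊕ o) ∈ᴾ? nearby) (around d)) (corners origin))

  opp-off : ∀ d → neg (off d) ≡ off (opp d)
  opp-off = from-yes (all-dir? λ d → neg (off d) ≟ᴾ off (opp d))

  module ChainProperties {l} (C : Chain l) where
    open Chain C

    turnAt : ℕ → Bool
    turnAt j = turn (d j) (d (suc j))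

    -- Used both for all squares and for runs. A kink of a run is judged by degrees in the graph of
    -- the run, so the local analysis has to apply to every interval of squares.
    record Covers (cs : List Cell) (lo hi : ℕ) : Set where
      field
        hi≤l     : hi ℕ.≤ l
        sound    : ∀ {c} → c ∈ cs → ∃ λ k → lo ℕ.≤ k × k ℕ.≤ hi × c ≡ s k
        complete : ∀ {k} → lo ℕ.≤ k → k ℕ.≤ hi → s k ∈ cs

    -- At most two steps are recorded; a shorter list means that the interval begins there, which
    -- distinguishes the windows near an end from those inside.
    data Behind (lo : ℕ) : ℕ → List Dir → Set where
      behind0 : Behind lo lo []
      behind1 : Behind lo (suc lo) (d lo ∷ [])
      behind2 : ∀ {j} → lo ℕ.≤ j → Behind lo (2 ℕ.+ j) (d (suc j) ∷ d j ∷ [])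

    data Ahead (hi : ℕ) : ℕ → List Dir → Set where
      ahead0 : Ahead hi hi []
      ahead1 : ∀ {i} → suc i ≡ hi → Ahead hi i (d i ∷ [])
      ahead2 : ∀ {i} → 2 ℕ.+ i ℕ.≤ hi → Ahead hi i (d i ∷ d (suc i) ∷ [])

    step⁻ : ∀ {j} → j ℕ.< l → s j ≡ s (suc j) ⊕ neg (off (d j))
    step⁻ {j} j<l = trans (sym (⊕-undo (s j) (off (d j)))) (cong (_⊕ neg (off (d j))) (sym (step j<l)))

    module _ {cs lo hi} (cov : Covers cs lo hi) where
      open Covers cov

      step² : ∀ {i} → 2 ℕ.+ i ℕ.≤ l → s (2 ℕ.+ i) ≡ s i ⊕ (off (d i) ⊕ off (d (suc i)))
      step² {i} 2+i≤ = trans (step 2+i≤) (trans (cong (_⊕ off (d (suc i))) (step (ℕ.<⇒≤ 2+i≤))) (⊕-assoc (s i) (off (d i)) (off (d (suc i)))))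

      step⁻² : ∀ {i} → 2 ℕ.+ i ℕ.≤ l → s i ≡ s (2 ℕ.+ i) ⊕ (neg (off (d (suc i))) ⊕ neg (off (d i)))
      step⁻² {i} 2+i≤ = trans (step⁻ (ℕ.<⇒≤ 2+i≤)) (trans (cong (_⊕ neg (off (d i))) (step⁻ 2+i≤)) (⊕-assoc (s (2 ℕ.+ i)) (neg (off (d (suc i)))) (neg (off (d i)))))

      behind-∈ : ∀ {i bs o} → Behind lo i bs → i ℕ.≤ hi → o ∈ behind bs → s i ⊕ o ∈ cs
      behind-∈ behind1 i≤ (here refl) = subst (_∈ cs) (step⁻ (ℕ.≤-trans i≤ hi≤l)) (complete ℕ.≤-refl (ℕ.<⇒≤ i≤))
      behind-∈ (behind2 lo≤j) i≤ (here refl) =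
        subst (_∈ cs) (step⁻ (ℕ.≤-trans i≤ hi≤l)) (complete (ℕ.m≤n⇒m≤1+n lo≤j) (ℕ.<⇒≤ i≤))
      behind-∈ (behind2 lo≤j) i≤ (there (here refl)) =
        subst (_∈ cs) (step⁻² (ℕ.≤-trans i≤ hi≤l)) (complete lo≤j (ℕ.<⇒≤ (ℕ.<⇒≤ i≤)))

      ahead-∈ : ∀ {i as o} → Ahead hi i as → lo ℕ.≤ i → o ∈ ahead as → s i ⊕ o ∈ cs
      ahead-∈ (ahead1 refl) lo≤ (here refl) = subst (_∈ cs) (step hi≤l) (complete (ℕ.m≤n⇒m≤1+n lo≤) ℕ.≤-refl)
      ahead-∈ (ahead2 2+i≤) lo≤ (here refl) =
        subst (_∈ cs) (step (ℕ.≤-trans (ℕ.<⇒≤ 2+i≤) hi≤l)) (complete (ℕ.m≤n⇒m≤1+n lo≤) (ℕ.<⇒≤ 2+i≤))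
      ahead-∈ (ahead2 2+i≤) lo≤ (there (here refl)) =
        subst (_∈ cs) (step² (ℕ.≤-trans 2+i≤ hi≤l)) (complete (ℕ.m≤n⇒m≤1+n (ℕ.m≤n⇒m≤1+n lo≤)) 2+i≤)

      ∈-behind₁ : ∀ {i bs k} → Behind lo i bs → i ≡ suc k → lo ℕ.≤ k → i ℕ.≤ hi → ∃ λ o → o ∈ behind bs × s k ≡ s i ⊕ o
      ∈-behind₁ behind0 refl lo≤k _ = contradiction lo≤k ℕ.1+n≰n
      ∈-behind₁ behind1 refl _ i≤ = _ , here refl , step⁻ (ℕ.≤-trans i≤ hi≤l)
      ∈-behind₁ (behind2 _) refl _ i≤ = _ , here refl , step⁻ (ℕ.≤-trans i≤ hi≤l)

      ∈-behind₂ : ∀ {i bs k} → Behind lo i bs → i ≡ 2 ℕ.+ k → lo ℕ.≤ k → i ℕ.≤ hi → ∃ λ o → o ∈ behind bs × s k ≡ s i ⊕ o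
      ∈-behind₂ behind0 refl lo≤k _ = contradiction (ℕ.<⇒≤ lo≤k) ℕ.1+n≰n
      ∈-behind₂ behind1 refl lo≤k _ = contradiction lo≤k ℕ.1+n≰n
      ∈-behind₂ (behind2 _) refl _ i≤ = _ , there (here refl) , step⁻² (ℕ.≤-trans i≤ hi≤l)

      ∈-ahead₁ : ∀ {i as k} → Ahead hi i as → k ≡ suc i → k ℕ.≤ hi → ∃ λ o → o ∈ ahead as × s k ≡ s i ⊕ o
      ∈-ahead₁ ahead0 refl k≤ = contradiction k≤ ℕ.1+n≰n
      ∈-ahead₁ (ahead1 refl) refl k≤ = _ , here refl , step hi≤l
      ∈-ahead₁ (ahead2 2+i≤) refl k≤ = _ , here refl , step (ℕ.≤-trans k≤ hi≤l)

      ∈-ahead₂ : ∀ {i as k} → Ahead hi i as → k ≡ 2 ℕ.+ i → k ℕ.≤ hi → ∃ λ o → o ∈ ahead as × s k ≡ s i ⊕ o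
      ∈-ahead₂ ahead0 refl k≤ = contradiction (ℕ.<⇒≤ k≤) ℕ.1+n≰n
      ∈-ahead₂ (ahead1 refl) refl k≤ = contradiction k≤ ℕ.1+n≰n
      ∈-ahead₂ (ahead2 2+i≤) refl k≤ = _ , there (here refl) , step² (ℕ.≤-trans k≤ hi≤l)

      module _ {i bs as} (lo≤i : lo ℕ.≤ i) (i≤hi : i ℕ.≤ hi) (B : Behind lo i bs) (A : Ahead hi i as) where

        window-sound : ∀ {o} → o ∈ window bs as → s i ⊕ o ∈ cs
        window-sound (here refl) = subst (_∈ cs) (sym (⊕-identity (s i))) (complete lo≤i i≤hi)
        window-sound (there o∈) with ∈-++⁻ (behind bs) o∈
        ... | inj₁ o∈b = behind-∈ B i≤hi o∈b
        ... | inj₂ o∈a = ahead-∈ A lo≤i o∈a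

        -- A listed cell in the 3 by 3 block around square `i` is that square, adjacent to it or
        -- diagonal to it; by `adjacent` and `diagonal` its index is then within two of `i`.
        window-complete : ∀ {δ} → δ ∈ nearby → s i ⊕ δ ∈ cs → δ ∈ window bs as
        window-complete {δ} δ∈ c∈ with sound c∈
        ... | k , lo≤k , k≤hi , e = nearby-case δ∈
          where
          i≤l : i ℕ.≤ l
          i≤l = ℕ.≤-trans i≤hi hi≤l
          k≤l : k ℕ.≤ l
          k≤l = ℕ.≤-trans k≤hi hi≤l
          from-behind : (∃ λ o → o ∈ behind bs × s k ≡ s i ⊕ o) → δ ∈ window bs as
          from-behind (o , o∈ , e′) = there (∈-++⁺ˡ (subst (_∈ behind bs) (sym (⊕-cancelˡ (s i) (trans e e′))) o∈))
          from-ahead : (∃ λ o → o ∈ ahead as × s k ≡ s i ⊕ o) → δ ∈ window bs as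
          from-ahead (o , o∈ , e′) = there (∈-++⁺ʳ (behind bs) (subst (_∈ ahead as) (sym (⊕-cancelˡ (s i) (trans e e′))) o∈))
          nearby-case : δ ∈ nearby → δ ∈ window bs as
          nearby-case (here refl) = here refl
          nearby-case (there δ∈) with ∈-++⁻ (map off dirs) δ∈
          ... | inj₁ δ∈ with ∈-map⁻ off {xs = dirs} δ∈
          ...   | a , _ , refl with adjacent i≤l k≤l (a , sym e)
          ...     | inj₁ k≡ = from-ahead (∈-ahead₁ A k≡ k≤hi)
          ...     | inj₂ i≡ = from-behind (∈-behind₁ B i≡ lo≤k i≤hi)
          nearby-case (there _) | inj₂ δ∈ with diagonal i≤l k≤l δ∈ (sym e)
          ... | inj₁ k≡ = from-ahead (∈-ahead₂ A k≡ k≤hi)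
          ... | inj₂ i≡ = from-behind (∈-behind₂ B i≡ lo≤k i≤hi)

        opaque
          unfolding degreeAt windowDegree

          degreeAt-corner : ∀ {p} → p ∈ corners origin → degreeAt cs (s i ⊕ p) ≡ windowDegree (window bs as) p
          degreeAt-corner {p} p∈ = cong length (filter-≐ (λ d → any? (inner? cs (s i ⊕ p)) (around d))
            (λ d → any? (λ o → (p ⊕ o) ∈ᴾ? window bs as) (around d)) ((λ {d} → to {d}) , (λ {d} → from {d})) dirs)
            where
            near : ∀ {d o} → o ∈ around d → p ⊕ o ∈ nearby
            near {d} o∈ = All.lookup (All.lookup corner-nearby p∈ d) o∈
            to : ∀ {d} → Any (λ o → s i ⊕ p ⊕ o ∈ cs) (around d) → Any (λ o → p ⊕ o ∈ window bs as) (around d)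
            to {d} a with find a
            ... | o , o∈ , c∈ = lose o∈ (window-complete (near {d} o∈) (subst (_∈ cs) (⊕-assoc (s i) p o) c∈))
            from : ∀ {d} → Any (λ o → p ⊕ o ∈ window bs as) (around d) → Any (λ o → s i ⊕ p ⊕ o ∈ cs) (around d)
            from {d} a with find a
            ... | o , o∈ , w∈ = lose o∈ (subst (_∈ cs) (sym (⊕-assoc (s i) p o)) (window-sound w∈))

    no-reversal₁ : ∀ {j} → 2 ℕ.+ j ℕ.≤ l → NoReversal (d j) (d (suc j))
    no-reversal₁ {j} 2+j≤ e = case injective 2+j≤ (ℕ.≤-trans (ℕ.m≤n+m j 2) 2+j≤) (begin
      s (2 ℕ.+ j)                             ≡⟨ step 2+j≤ ⟩
      s (suc j) ⊕ off (d (suc j))             ≡⟨ cong₂ _⊕_ (step (ℕ.<⇒≤ 2+j≤)) (trans (cong off e) (sym (opp-off (d j)))) ⟩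
      s j ⊕ off (d j) ⊕ neg (off (d j))       ≡⟨ ⊕-undo (s j) (off (d j)) ⟩
      s j                                     ∎) of λ ()
      where open ≡-Reasoning

    -- Otherwise the squares `j` and `3 ℕ.+ j` would be adjacent, closing up a 2 by 2 block.
    no-reversal₂ : ∀ {j} → 3 ℕ.+ j ℕ.≤ l → NoReversal (d j) (d (2 ℕ.+ j))
    no-reversal₂ {j} 3+j≤ e = case adjacent (ℕ.≤-trans (ℕ.m≤n+m j 3) 3+j≤) 3+j≤ (d (suc j) , (begin
      s (3 ℕ.+ j)                                              ≡⟨ step 3+j≤ ⟩
      s (2 ℕ.+ j) ⊕ off (d (2 ℕ.+ j))                          ≡⟨ cong₂ _⊕_ (step (ℕ.<⇒≤ 3+j≤)) (trans (cong off e) (sym (opp-off (d j)))) ⟩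
      s (suc j) ⊕ off (d (suc j)) ⊕ neg (off (d j))            ≡⟨ cong (λ c → c ⊕ off (d (suc j)) ⊕ neg (off (d j))) (step (ℕ.<⇒≤ (ℕ.<⇒≤ 3+j≤))) ⟩
      s j ⊕ off (d j) ⊕ off (d (suc j)) ⊕ neg (off (d j))      ≡⟨ cong (_⊕ neg (off (d j))) (⊕-swap (s j) (off (d j)) (off (d (suc j)))) ⟩
      s j ⊕ off (d (suc j)) ⊕ off (d j) ⊕ neg (off (d j))      ≡⟨ ⊕-undo (s j ⊕ off (d (suc j))) (off (d j)) ⟩
      s j ⊕ off (d (suc j))                                    ∎)) of λ { (inj₁ ()) ; (inj₂ ()) }
      where open ≡-Reasoning

-- The edge sum of a chain as a function of its kink sequence

module Index where
  open ≡
  open import Data.List.Relation.Unary.Unique.DecPropositional _≟ˢ_ using () renaming (unique? to uniqueˢ?)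
  open Lists
  open Grid
  open Chains
  open Windows

  module ChainSides {l} (C : Chain l) where
    open Chain C
    open ChainProperties C

    at : ℕ → List Side → List Side
    at i = map (s i ⊕ˢ_)

    -- The sides of the squares i, …, i + r, each side once.
    sidesFrom : ℕ → ℕ → List Side
    sidesFrom zero    i = at i (sides origin)
    sidesFrom (suc r) i = at i (others (d i)) ++ sidesFrom r (suc i)

    private
      ahead? : ∀ i o → _
      ahead? i o = ¬? (o ∈ˢ? map (off (d i) ⊕ˢ_) (sides origin))

      origin-sides-unique : Unique (sides origin)
      origin-sides-unique = from-yes (uniqueˢ? (sides origin))

    shift-ahead : ∀ {i} → i ℕ.< l → ∀ o → s (suc i) ⊕ˢ o ≡ s i ⊕ˢ (off (d i) ⊕ˢ o)
    shift-ahead {i} i<l o = trans (cong (_⊕ˢ o) (step i<l)) (⊕ˢ-assoc (s i) (off (d i)) o)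

    sidesFrom-sound : ∀ r {i} → r ℕ.+ i ≡ l → ∀ {t} → t ∈ sidesFrom r i →
                      ∃₂ λ k o → i ℕ.≤ k × k ℕ.≤ l × o ∈ sides origin × t ≡ s k ⊕ˢ o
    sidesFrom-sound zero refl t∈ with ∈-map⁻ (s _ ⊕ˢ_) t∈
    ... | o , o∈ , e = _ , o , ℕ.≤-refl , ℕ.≤-refl , o∈ , e
    sidesFrom-sound (suc r) {i} refl t∈ with ∈-++⁻ (at i (others (d i))) t∈
    ... | inj₁ t∈ with ∈-map⁻ (s i ⊕ˢ_) t∈
    ...   | o , o∈ , e = i , o , ℕ.≤-refl , ℕ.m≤n+m i (suc r) , proj₁ (∈-filter⁻ (ahead? i) {xs = sides origin} o∈) , e
    sidesFrom-sound (suc r) {i} refl _ | inj₂ t∈ with sidesFrom-sound r (ℕ.+-suc r i) t∈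
    ... | k , o , i<k , k≤l , o∈ , e = k , o , ℕ.<⇒≤ i<k , k≤l , o∈ , e

    sidesFrom-complete : ∀ r {i} → r ℕ.+ i ≡ l → ∀ {k o} → i ℕ.≤ k → k ℕ.≤ l → o ∈ sides origin → s k ⊕ˢ o ∈ sidesFrom r i
    sidesFrom-complete zero refl i≤k k≤l o∈ with ℕ.≤-antisym i≤k k≤l
    ... | refl = ∈-map⁺ (s _ ⊕ˢ_) o∈
    sidesFrom-complete (suc r) {i} refl {k} {o} i≤k k≤l o∈ with ℕ.m≤n⇒m<n∨m≡n i≤k
    ... | inj₁ i<k = ∈-++⁺ʳ (at i (others (d i))) (sidesFrom-complete r (ℕ.+-suc r i) i<k k≤l o∈)
    ... | inj₂ refl with o ∈ˢ? map (off (d i) ⊕ˢ_) (sides origin)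
    ...   | no o∉ = ∈-++⁺ˡ (∈-map⁺ (s i ⊕ˢ_) (∈-filter⁺ (ahead? i) o∈ o∉))
    ...   | yes o∈′ with ∈-map⁻ (off (d i) ⊕ˢ_) o∈′
    ...     | o′ , o′∈ , refl = ∈-++⁺ʳ (at i (others (d i))) (subst (_∈ sidesFrom r (suc i)) (shift-ahead (ℕ.s≤s (ℕ.m≤n+m i r)) o′)
                  (sidesFrom-complete r (ℕ.+-suc r i) ℕ.≤-refl (ℕ.s≤s (ℕ.m≤n+m i r)) o′∈))

    sidesFrom-unique : ∀ r {i} → r ℕ.+ i ≡ l → Unique (sidesFrom r i)
    sidesFrom-unique zero _ = Unique.map⁺ (⊕ˢ-cancelˡ (s _)) origin-sides-unique
    sidesFrom-unique (suc r) {i} refl = Unique.++⁺ (Unique.map⁺ (⊕ˢ-cancelˡ (s i)) (Unique.filter⁺ (ahead? i) origin-sides-unique))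
      (sidesFrom-unique r (ℕ.+-suc r i)) disjoint
      where
      -- A side shared with a later square makes that square adjacent to square `i`, hence the next
      -- one; but the sides shared with the next square are those that `others` removes.
      disjoint : ∀ {t} → ¬ (t ∈ at i (others (d i)) × t ∈ sidesFrom r (suc i))
      disjoint (t∈ , t∈′) with ∈-map⁻ (s i ⊕ˢ_) t∈ | sidesFrom-sound r (ℕ.+-suc r i) t∈′
      ... | o , o∈ , refl | k , o′ , i<k , k≤l , o′∈ , e with ∈-filter⁻ (ahead? i) {xs = sides origin} o∈
      ... | o∈₀ , o∉ with adjacent (ℕ.m≤n+m i (suc r)) k≤l (Adjacent⇒Neighbour
            ( (λ eq → ℕ.<⇒≢ i<k (injective (ℕ.m≤n+m i (suc r)) k≤l eq))
            , lose (∈-sides⁺ (s i) o∈₀) (subst (_∈ sides (s k)) (sym e) (∈-sides⁺ (s k) o′∈))))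
      ... | inj₂ refl = ℕ.<-asym i<k ℕ.≤-refl
      ... | inj₁ refl = o∉ (subst (_∈ map (off (d i) ⊕ˢ_) (sides origin))
            (sym (⊕ˢ-cancelˡ (s i) (trans e (shift-ahead k≤l o′)))) (∈-map⁺ (off (d i) ⊕ˢ_) o′∈))

  module ChainSum {c ℓ} (M : CommutativeMonoid c ℓ) (P : ℕ → CommutativeMonoid.Carrier M) where
    open CommutativeMonoid M renaming (refl to ≈-refl; trans to ≈-trans; sym to ≈-sym; reflexive to ≈-reflexive)
    open Sums M

    edgeSum : Graph → Carrier
    edgeSum G = sum (map (λ (u , v) → P (degree u ℕ.+ degree v)) edges)
      where open Graph G

    sideWeight : List Cell → Side → ℕ
    sideWeight cs (p , q) = degreeAt cs p ℕ.+ degreeAt cs q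

    edgeSum≈sideSum : ∀ cs {ss} → map (orient cs) (Graph.edges (graph cs)) ↭ ss →
                      edgeSum (graph cs) ≈ sum (map (P ∘ sideWeight cs) ss)
    edgeSum≈sideSum cs {ss} p = ≈-trans (sum-map-cong edges (λ {e} _ → ≈-reflexive (cong P (orient-weight e))))
      (≈-trans (≈-reflexive (cong sum (map-∘ edges))) (sum-↭ (map⁺ (P ∘ sideWeight cs) p)))
      where
      open Graph (graph cs)
      orient-weight : ∀ ((u , v) : Fin order × Fin order) → degree u ℕ.+ degree v ≡ sideWeight cs (orient cs (u , v))
      orient-weight (u , v) rewrite degree≡degreeAt cs u | degree≡degreeAt cs v with orient-cases cs u v
      ... | inj₁ e = cong (sideWeight cs) (sym e)
      ... | inj₂ e = trans (ℕ.+-comm (degreeAt cs (position cs u)) _) (cong (sideWeight cs) (sym e))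

    module TailSum (τ : ℕ → Bool) where

      κ : ℕ → ℕ
      κ j = toℕᵇ (τ j)

      -- `κ j` records a kink at square `suc j`. Terminal squares are never kinks, whence the value
      -- 0 at both ends of the chain.
      before : ℕ → ℕ
      before zero    = 0
      before (suc j) = κ j

      after : ℕ → ℕ → ℕ
      after zero    j = 0
      after (suc r) j = κ j

      firstWeights : List ℕ
      firstWeights = 4 ∷ 5 ∷ 5 ℕ.+ κ 0 ∷ []

      squareWeights : ℕ → ℕ → List ℕ
      squareWeights r j = 6 ℕ.+ (before j ℕ.+ κ j) ∷ 6 ℕ.+ before j ∸ κ j ∷ 6 ℕ.+ after r (suc j) ∸ κ j ∷ []

      lastWeights : ℕ → List ℕ
      lastWeights j = 6 ℕ.+ before j ∷ 4 ∷ 5 ∷ 5 ℕ.+ before j ∷ []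

      -- The contribution of the squares j + 1, …, j + 1 + r, the last one being terminal.
      tail : ℕ → ℕ → Carrier
      tail zero j    = sum (map P (lastWeights j))
      tail (suc r) j = sum (map P (squareWeights r j)) ∙ tail r (suc j)

    module _ {m} (C : Chain (2 ℕ.+ m)) where
      open Chain C
      open ChainProperties C
      open ChainSides C


      open TailSum turnAt

      module _ {cs} (cov : Covers cs 0 (2 ℕ.+ m))
               (staircase : ∀ {j} → 4 ℕ.+ j ℕ.≤ 2 ℕ.+ m → Staircase (d j) (d (suc j)) (d (2 ℕ.+ j)) (d (3 ℕ.+ j))) where

        at-sum : ∀ {i bs as} σs ws → All (_∈ sides origin) σs → i ℕ.≤ 2 ℕ.+ m → Behind 0 i bs → Ahead (2 ℕ.+ m) i as →
                 SameBag (map (windowWeight (window bs as)) σs) ws →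
                 sum (map (P ∘ sideWeight cs) (at i σs)) ≈ sum (map P ws)
        at-sum {i} {bs} {as} σs ws σs⊆ i≤ B A bag = ≈-trans (≈-reflexive (cong sum (sym (map-∘ σs))))
          (≈-trans (sum-map-cong σs (λ σ∈ → ≈-reflexive (cong P (weight (All.lookup side-ends (All.lookup σs⊆ σ∈))))))
            (≈-trans (≈-reflexive (cong sum (map-∘ {g = P} {f = windowWeight (window bs as)} σs)))
              (sum-↭ (map⁺ P (sameBag⇒↭ {map (windowWeight (window bs as)) σs} {ws} bag)))))
          where
          weight : ∀ {σ} → proj₁ σ ∈ corners origin × proj₂ σ ∈ corners origin →
                   sideWeight cs (s i ⊕ˢ σ) ≡ windowWeight (window bs as) σ
          weight (p∈ , q∈) = cong₂ ℕ._+_ (degreeAt-corner cov ℕ.z≤n i≤ B A p∈) (degreeAt-corner cov ℕ.z≤n i≤ B A q∈)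

        others⊆ : ∀ a → All (_∈ sides origin) (others a)
        others⊆ a = All.tabulate λ t∈ → proj₁ (∈-filter⁻ (λ t → ¬? (t ∈ˢ? map (off a ⊕ˢ_) (sides origin))) {xs = sides origin} t∈)

        square-sum : ∀ r j → r ℕ.+ j ≡ m →
          sum (map (P ∘ sideWeight cs) (at (suc j) (others (d (suc j))))) ≈
          sum (map P (squareWeights r j))
        square-sum zero zero refl = at-sum (others (d 1)) (squareWeights zero 0) (others⊆ (d 1)) (ℕ.s≤s ℕ.z≤n) behind1 (ahead1 refl)
          (middle-weights nothing (d 0) (d 1) nothing (no-reversal₁ ℕ.≤-refl , tt , tt) tt)
        square-sum zero (suc j) refl = at-sum (others (d (2 ℕ.+ j))) (squareWeights zero (suc j)) (others⊆ (d (2 ℕ.+ j))) (ℕ.n≤1+n _) (behind2 ℕ.z≤n) (ahead1 refl)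
          (middle-weights (just (d j)) (d (suc j)) (d (2 ℕ.+ j)) nothing
            (no-reversal₁ ℕ.≤-refl , (no-reversal₁ (ℕ.n≤1+n _) , no-reversal₂ ℕ.≤-refl) , tt) tt)
        square-sum (suc r) zero refl = at-sum (others (d 1)) (squareWeights (suc r) 0) (others⊆ (d 1)) (ℕ.s≤s ℕ.z≤n) behind1 (ahead2 (ℕ.s≤s (ℕ.s≤s (ℕ.s≤s ℕ.z≤n))))
          (middle-weights nothing (d 0) (d 1) (just (d 2))
            (no-reversal₁ (ℕ.s≤s (ℕ.s≤s ℕ.z≤n)) , tt , (no-reversal₁ (ℕ.s≤s (ℕ.s≤s (ℕ.s≤s ℕ.z≤n))) , no-reversal₂ (ℕ.s≤s (ℕ.s≤s (ℕ.s≤s ℕ.z≤n))))) tt)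
        square-sum (suc r) (suc j) refl = at-sum (others (d (2 ℕ.+ j))) (squareWeights (suc r) (suc j)) (others⊆ (d (2 ℕ.+ j))) (ℕ.<⇒≤ 3+j≤) (behind2 ℕ.z≤n) (ahead2 4+j≤)
          (middle-weights (just (d j)) (d (suc j)) (d (2 ℕ.+ j)) (just (d (3 ℕ.+ j)))
            ( no-reversal₁ 3+j≤ , (no-reversal₁ (ℕ.<⇒≤ 3+j≤) , no-reversal₂ 3+j≤) , (no-reversal₁ 4+j≤ , no-reversal₂ 4+j≤))
            (staircase 4+j≤))
          where
          4+j≤ : 4 ℕ.+ j ℕ.≤ 2 ℕ.+ (suc r ℕ.+ suc j)
          4+j≤ = ℕ.s≤s (ℕ.s≤s (ℕ.s≤s (ℕ.m≤n+m (suc j) r)))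
          3+j≤ : 3 ℕ.+ j ℕ.≤ 2 ℕ.+ (suc r ℕ.+ suc j)
          3+j≤ = ℕ.<⇒≤ 4+j≤

        tail-sum : ∀ r j → r ℕ.+ j ≡ suc m → sum (map (P ∘ sideWeight cs) (sidesFrom r (suc j))) ≈ tail r j
        tail-sum zero .(suc m) refl = at-sum (sides origin) (lastWeights (suc m)) (All.tabulate λ t∈ → t∈) ℕ.≤-refl (behind2 ℕ.z≤n) ahead0
          (last-weights (d (suc m)) (d m) (no-reversal₁ ℕ.≤-refl))
        tail-sum (suc r) j e = ≈-trans
          (≈-trans (≈-reflexive (cong sum (map-++ (P ∘ sideWeight cs) (at (suc j) (others (d (suc j)))) _)))
                   (sum-++ (map (P ∘ sideWeight cs) (at (suc j) (others (d (suc j))))) _))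
          (∙-cong (square-sum r j (ℕ.suc-injective e)) (tail-sum r (suc j) (trans (ℕ.+-suc r j) e)))

        edgeSum-tail : edgeSum (graph cs) ≈ sum (map P firstWeights) ∙ tail (suc m) 0
        edgeSum-tail = ≈-trans (edgeSum≈sideSum cs (orient-edges cs (sidesFrom-unique (2 ℕ.+ m) l≡) sound′ complete′))
          (≈-trans (≈-reflexive (cong sum (map-++ (P ∘ sideWeight cs) (at 0 (others (d 0))) _)))
            (≈-trans (sum-++ (map (P ∘ sideWeight cs) (at 0 (others (d 0)))) _)
              (∙-cong (at-sum (others (d 0)) firstWeights (others⊆ (d 0)) ℕ.z≤n behind0 (ahead2 (ℕ.s≤s (ℕ.s≤s ℕ.z≤n)))
                         (first-weights (d 0) (d 1) (no-reversal₁ (ℕ.s≤s (ℕ.s≤s ℕ.z≤n)))))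
                      (tail-sum (suc m) 0 (ℕ.+-identityʳ (suc m))))))
          where
          open Covers cov
          l≡ : 2 ℕ.+ m ℕ.+ 0 ≡ 2 ℕ.+ m
          l≡ = ℕ.+-identityʳ (2 ℕ.+ m)
          sound′ : ∀ {t} → t ∈ sidesFrom (2 ℕ.+ m) 0 → t ∈ allSides cs
          sound′ t∈ with sidesFrom-sound (2 ℕ.+ m) l≡ t∈
          ... | k , o , _ , k≤ , o∈ , refl = ∈-allSides⁺ cs (complete ℕ.z≤n k≤) o∈
          complete′ : ∀ {t} → t ∈ allSides cs → t ∈ sidesFrom (2 ℕ.+ m) 0
          complete′ t∈ with ∈-allSides⁻ cs t∈
          ... | c , o , c∈ , o∈ , refl with sound c∈
          ...   | k , _ , k≤ , refl = sidesFrom-complete (2 ℕ.+ m) l≡ ℕ.z≤n k≤ o∈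

-- Graph isomorphisms preserve degrees and edge sums

module Iso where
  open ≡
  open Lists
  open Graphs
  open Index

  module _ {G H : Graph} (i : G ≅ H) where
    private
      module G = Graph G
      module H = Graph H
    open _≅_ i renaming (vertices to bijection)
    open Inverse bijection using (to; from; strictlyInverseˡ; strictlyInverseʳ)

    ≅-sym : H ≅ G
    ≅-sym = record
      { vertices  = mk↔ₛ′ from to strictlyInverseʳ strictlyInverseˡ
      ; adjacency = λ u v → mk⇔
          (λ a → Equivalence.from (adjacency (from u) (from v)) (subst₂ H.Adj (sym (strictlyInverseˡ u)) (sym (strictlyInverseˡ v)) a))
          (λ a → subst₂ H.Adj (strictlyInverseˡ u) (strictlyInverseˡ v) (Equivalence.to (adjacency (from u) (from v)) a))
      }

    ≅-trans : ∀ {K} → H ≅ K → G ≅ K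
    ≅-trans j = record
      { vertices  = J.vertices ↔-∘ bijection
      ; adjacency = λ u v → J.adjacency (to u) (to v) ⇔-∘ adjacency u v
      }
      where module J = _≅_ j

    to-injective : ∀ {u v} → to u ≡ to v → u ≡ v
    to-injective {u} {v} e = trans (sym (strictlyInverseʳ u)) (trans (cong from e) (strictlyInverseʳ v))

    degree-≅ : ∀ u → G.degree u ≡ H.degree (to u)
    degree-≅ u = map-length to (map-↭ to (Unique.filter⁺ (G.adj? u) (Unique.allFin⁺ G.order))
      (Unique.filter⁺ (H.adj? (to u)) (Unique.allFin⁺ H.order))
      (λ {v} v∈ → ∈-filter⁺ (H.adj? (to u)) (∈-allFin (to v)) (Equivalence.to (adjacency u v) (proj₂ (∈-filter⁻ (G.adj? u) {xs = allFin G.order} v∈))))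
      (λ _ _ → to-injective)
      (λ {w} w∈ → from w , ∈-filter⁺ (G.adj? u) (∈-allFin (from w)) (Equivalence.from (adjacency u (from w))
        (subst (H.Adj (to u)) (sym (strictlyInverseˡ w)) (proj₂ (∈-filter⁻ (H.adj? (to u)) {xs = allFin H.order} w∈)))) , strictlyInverseˡ w))

    image : Fin G.order × Fin G.order → Fin H.order × Fin H.order
    image (u , v) with to u Fin.<? to v
    ... | yes _ = to u , to v
    ... | no _  = to v , to u

    image-cases : ∀ u v → image (u , v) ≡ (to u , to v) ⊎ image (u , v) ≡ (to v , to u)
    image-cases u v with to u Fin.<? to v
    ... | yes _ = inj₁ refl
    ... | no _  = inj₂ refl

    image-edges : map image G.edges ↭ H.edges
    image-edges = map-edges-↭ G (λ u v → to u , to v) image (edges-unique H)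
      (λ e → to-injective (cong proj₁ e) , to-injective (cong proj₂ e)) image-cases into onto
      where
      into : ∀ {u v} → G.Adj u v → image (u , v) ∈ H.edges
      into {u} {v} a with to u Fin.<? to v
      ... | yes u<v = ∈-edges⁺ H u<v (Equivalence.to (adjacency u v) a)
      ... | no u≮v = ∈-edges⁺ H (Fin.≤∧≢⇒< (ℕ.≮⇒≥ u≮v) (λ e → G.Adj-irrefl (to-injective (sym e)) a))
                       (H.Adj-sym (Equivalence.to (adjacency u v) a))
      forward : ∀ {u v} → to u Fin.< to v → image (u , v) ≡ (to u , to v)
      forward {u} {v} u<v with to u Fin.<? to v
      ... | yes _  = refl
      ... | no u≮v = contradiction u<v u≮v
      backward : ∀ {u v} → to u Fin.< to v → image (v , u) ≡ (to u , to v)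
      backward {u} {v} u<v with to v Fin.<? to u
      ... | yes v<u = contradiction u<v (Fin.<-asym v<u)
      ... | no _    = refl
      onto : ∀ {e} → e ∈ H.edges → ∃₂ λ u v → G.Adj u v × image (u , v) ≡ e × image (v , u) ≡ e
      onto {u , v} e∈ with ∈-edges⁻ H e∈
      ... | u<v , a = from u , from v
        , Equivalence.from (adjacency (from u) (from v)) (subst₂ H.Adj (sym (strictlyInverseˡ u)) (sym (strictlyInverseˡ v)) a)
        , trans (forward lt) pair≡ , trans (backward lt) pair≡
        where
        lt : to (from u) Fin.< to (from v)
        lt = subst₂ Fin._<_ (sym (strictlyInverseˡ u)) (sym (strictlyInverseˡ v)) u<v
        pair≡ : (to (from u) , to (from v)) ≡ (u , v)
        pair≡ = cong₂ _,_ (strictlyInverseˡ u) (strictlyInverseˡ v)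

    module _ {c ℓ} (M : CommutativeMonoid c ℓ) (P : ℕ → CommutativeMonoid.Carrier M) where
      open CommutativeMonoid M using (_≈_) renaming (trans to ≈-trans; reflexive to ≈-reflexive)
      open Sums M
      open ChainSum M P using (edgeSum)

      edgeSum-≅ : edgeSum G ≈ edgeSum H
      edgeSum-≅ = ≈-trans (sum-map-cong G.edges (λ {e} _ → ≈-reflexive (cong P (weight e))))
        (≈-trans (≈-reflexive (cong sum (map-∘ G.edges))) (sum-↭ (map⁺ (λ (u , v) → P (H.degree u ℕ.+ H.degree v)) image-edges)))
        where
        weight : ∀ ((u , v) : Fin G.order × Fin G.order) →
                 G.degree u ℕ.+ G.degree v ≡ H.degree (proj₁ (image (u , v))) ℕ.+ H.degree (proj₂ (image (u , v)))
        weight (u , v) rewrite degree-≅ u | degree-≅ v with image-cases u v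
        ... | inj₁ e = cong (λ (u , v) → H.degree u ℕ.+ H.degree v) (sym e)
        ... | inj₂ e = trans (ℕ.+-comm (H.degree (to u)) _) (cong (λ (u , v) → H.degree u ℕ.+ H.degree v) (sym e))

-- Counting and parity in the kink sequence

module Counting where
  open ≡
  open import Algebra.Properties.CommutativeSemigroup ℕ.+-commutativeSemigroup using () renaming (interchange to +-interchange)
  open Windows using (toℕᵇ)
  open import Data.Nat.Base using (_+_)
  open import Data.Nat.Base using (_≤_)
  open import Data.Nat.Base using (_<_)
  open import Data.Nat.Base using (z≤n)
  open import Data.Nat.Base using (s≤s)

  count : (ℕ → Bool) → ℕ → ℕ → ℕ
  count Q zero    j = 0
  count Q (suc r) j = toℕᵇ (Q j) + count Q r (suc j)

  module _ (Q : ℕ → Bool) where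

    Hit : ℕ → ℕ → ℕ → Set
    Hit r j i = j ≤ i × i < r + j × Q i ≡ true

    private
      shift : ∀ {r j i} → Hit r (suc j) i → Hit (suc r) j i
      shift {r} {j} {i} (j<i , i< , q) = ℕ.<⇒≤ j<i , subst (i <_) (ℕ.+-suc r j) i< , q

      unshift : ∀ {r j i} → Hit (suc r) j i → i ≢ j → Hit r (suc j) i
      unshift {r} {j} {i} (j≤i , i< , q) i≢j = ℕ.≤∧≢⇒< j≤i (λ e → i≢j (sym e)) , subst (i <_) (sym (ℕ.+-suc r j)) i< , q

    hit⇒1≤count : ∀ r {j i} → Hit r j i → 1 ≤ count Q r j
    hit⇒1≤count zero (j≤i , i<j , _) = contradiction (ℕ.≤-trans i<j j≤i) ℕ.1+n≰n
    hit⇒1≤count (suc r) {j} {i} h with i ℕ.≟ j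
    ... | yes refl rewrite proj₂ (proj₂ h) = s≤s z≤n
    ... | no i≢j = ℕ.≤-trans (hit⇒1≤count r (unshift h i≢j)) (ℕ.m≤n+m _ (toℕᵇ (Q j)))

    hits⇒2≤count : ∀ r {j i i′} → Hit r j i → Hit r j i′ → i ≢ i′ → 2 ≤ count Q r j
    hits⇒2≤count zero (j≤i , i<j , _) _ _ = contradiction (ℕ.≤-trans i<j j≤i) ℕ.1+n≰n
    hits⇒2≤count (suc r) {j} {i} {i′} h h′ i≢i′ with i ℕ.≟ j | i′ ℕ.≟ j
    ... | yes refl | yes refl = contradiction refl i≢i′
    ... | yes refl | no i′≢j rewrite proj₂ (proj₂ h) = s≤s (hit⇒1≤count r (unshift h′ i′≢j))
    ... | no i≢j   | yes refl rewrite proj₂ (proj₂ h′) = s≤s (hit⇒1≤count r (unshift h i≢j))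
    ... | no i≢j   | no i′≢j = ℕ.≤-trans (hits⇒2≤count r (unshift h i≢j) (unshift h′ i′≢j) i≢i′) (ℕ.m≤n+m _ (toℕᵇ (Q j)))

    1≤count⇒hit : ∀ r {j} → 1 ≤ count Q r j → ∃ (Hit r j)
    1≤count⇒hit (suc r) {j} 1≤ with Q j in eq
    ... | true  = j , ℕ.≤-refl , s≤s (ℕ.m≤n+m j r) , eq
    ... | false with 1≤count⇒hit r 1≤
    ...   | i , h = i , shift h

    2≤count⇒hits : ∀ r {j} → 2 ≤ count Q r j → ∃₂ λ i i′ → Hit r j i × Hit r j i′ × i ≢ i′
    2≤count⇒hits (suc r) {j} 2≤ with Q j in eq
    ... | false with 2≤count⇒hits r 2≤
    ...   | i , i′ , h , h′ , i≢i′ = i , i′ , shift h , shift h′ , i≢i′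
    2≤count⇒hits (suc r) {j} 2≤ | true with 1≤count⇒hit r (ℕ.s≤s⁻¹ 2≤)
    ...   | i , h = j , i , (ℕ.≤-refl , s≤s (ℕ.m≤n+m j r) , eq) , shift h , λ { refl → ℕ.1+n≰n (proj₁ h) }

  odd : ℕ → Bool
  odd zero    = false
  odd (suc n) = not (odd n)

  odd-+ : ∀ m n → odd (m + n) ≡ odd m xor odd n
  odd-+ zero    n = refl
  odd-+ (suc m) n rewrite odd-+ m n with odd m | odd n
  ... | true  | true  = refl
  ... | true  | false = refl
  ... | false | true  = refl
  ... | false | false = refl

  odd-injective : ∀ {m n} → m ≤ 1 → n ≤ 1 → odd m ≡ odd n → m ≡ n
  odd-injective z≤n       z≤n       _ = refl
  odd-injective (s≤s z≤n) (s≤s z≤n) _ = refl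
  odd-injective z≤n       (s≤s z≤n) ()
  odd-injective (s≤s z≤n) z≤n       ()

  module _ (τ : ℕ → Bool) where

    bothTurn bothStraight : ℕ → Bool
    bothTurn     j = τ j ∧ τ (suc j)
    bothStraight j = not (τ j) ∧ not (τ (suc j))

    -- Of the `r` consecutive pairs, those with equal entries are counted on the left. The remaining
    -- ones are the changes of value between `j` and `r + j`, and their number has the parity of
    -- `τ j xor τ (r + j)`.
    changes-parity : ∀ r j → odd (count bothStraight r j + count bothTurn r j) ≡ (τ j xor τ (r + j)) xor odd r
    changes-parity zero j with τ j
    ... | true  = refl
    ... | false = refl
    changes-parity (suc r) j = begin
      odd ((toℕᵇ (bothStraight j) + x) + (toℕᵇ (bothTurn j) + t))
        ≡⟨ cong odd (+-interchange (toℕᵇ (bothStraight j)) x (toℕᵇ (bothTurn j)) t) ⟩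
      odd ((toℕᵇ (bothStraight j) + toℕᵇ (bothTurn j)) + (x + t))
        ≡⟨ odd-+ (toℕᵇ (bothStraight j) + toℕᵇ (bothTurn j)) (x + t) ⟩
      odd (toℕᵇ (bothStraight j) + toℕᵇ (bothTurn j)) xor odd (x + t)
        ≡⟨ cong₂ _xor_ (equal-parity (τ j) (τ (suc j))) (changes-parity r (suc j)) ⟩
      not (τ j xor τ (suc j)) xor ((τ (suc j) xor τ (r + suc j)) xor odd r)
        ≡⟨ telescope (τ j) (τ (suc j)) (τ (r + suc j)) (odd r) ⟩
      (τ j xor τ (r + suc j)) xor not (odd r)
        ≡⟨ cong (λ i → (τ j xor τ i) xor not (odd r)) (ℕ.+-suc r j) ⟩
      (τ j xor τ (suc r + j)) xor not (odd r) ∎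
      where
      open ≡-Reasoning
      x t : ℕ
      x = count bothStraight r (suc j)
      t = count bothTurn r (suc j)
      equal-parity : ∀ a b → odd (toℕᵇ (not a ∧ not b) + toℕᵇ (a ∧ b)) ≡ not (a xor b)
      equal-parity true  true  = refl
      equal-parity true  false = refl
      equal-parity false true  = refl
      equal-parity false false = refl
      telescope : ∀ a b c o → not (a xor b) xor ((b xor c) xor o) ≡ (a xor c) xor not o
      telescope true  true  true  true  = refl
      telescope true  true  true  false = refl
      telescope true  true  false true  = refl
      telescope true  true  false false = refl
      telescope true  false true  true  = refl
      telescope true  false true  false = refl
      telescope true  false false true  = refl
      telescope true  false false false = refl
      telescope false true  true  true  = refl
      telescope false true  true  false = refl
      telescope false true  false true  = refl
      telescope false true  false false = refl
      telescope false false true  true  = refl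
      telescope false false true  false = refl
      telescope false false false true  = refl
      telescope false false false false = refl

    -- For the chain with kinks at the squares j + 1 with τ j: the numbers of external segments of length 2,
    -- of squares in excess of 3 in the longer segments, and of internal segments of length 2.
    module _ (m : ℕ) where
      #ends #straight #turns : ℕ
      #ends     = toℕᵇ (τ 0) + toℕᵇ (τ m)
      #straight = count bothStraight m 0
      #turns    = count bothTurn m 0

      -- The two boundary values left over by `changes-parity` are cancelled by the short ends.
      -- Hence totals that are at most 1 agree for all chains with the same number of squares.
      total-parity : odd (#ends + (#straight + #turns)) ≡ odd m
      total-parity = begin
        odd (#ends + (#straight + #turns))                       ≡⟨ odd-+ #ends _ ⟩
        odd #ends xor odd (#straight + #turns)                   ≡⟨ cong₂ _xor_ (odd-+ (toℕᵇ (τ 0)) _) (changes-parity m 0) ⟩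
        (odd (toℕᵇ (τ 0)) xor odd (toℕᵇ (τ m))) xor ((τ 0 xor τ (m + 0)) xor odd m)
          ≡⟨ cong (λ i → (odd (toℕᵇ (τ 0)) xor odd (toℕᵇ (τ m))) xor ((τ 0 xor τ i) xor odd m)) (ℕ.+-identityʳ m) ⟩
        (odd (toℕᵇ (τ 0)) xor odd (toℕᵇ (τ m))) xor ((τ 0 xor τ m) xor odd m)
          ≡⟨ cancel (τ 0) (τ m) (odd m) ⟩
        odd m                                                    ∎
        where
        open ≡-Reasoning
        cancel : ∀ a b o → (odd (toℕᵇ a) xor odd (toℕᵇ b)) xor ((a xor b) xor o) ≡ o
        cancel true  true  o = refl
        cancel true  false true = refl
        cancel true  false false = refl
        cancel false true  true = refl
        cancel false true  false = refl
        cancel false false o = refl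

-- Kinks are changes of direction

module Kinks where
  open ≡
  open Lists
  open Grid
  open Chains
  open Windows

  module ChainKinks {l} (C : Chain l) where
    open Chain C
    open ChainProperties C

    data Place (lo hi : ℕ) : ℕ → Set where
      isolated : lo ≡ hi → Place lo hi lo
      start    : lo ℕ.< hi → Place lo hi lo
      finish   : ∀ {j} → lo ℕ.≤ j → suc j ≡ hi → Place lo hi (suc j)
      inside   : ∀ {j} → lo ℕ.≤ j → suc j ℕ.< hi → Place lo hi (suc j)

    place : ∀ {lo hi} k → lo ℕ.≤ k → k ℕ.≤ hi → Place lo hi k
    place {lo} k lo≤k k≤hi with ℕ.m≤n⇒m<n∨m≡n lo≤k | ℕ.m≤n⇒m<n∨m≡n k≤hi
    ... | inj₂ refl        | inj₁ k<hi = start k<hi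
    ... | inj₂ refl        | inj₂ k≡hi = isolated k≡hi
    ... | inj₁ (ℕ.s≤s lo≤) | inj₁ k<hi = inside lo≤ k<hi
    ... | inj₁ (ℕ.s≤s lo≤) | inj₂ k≡hi = finish lo≤ k≡hi

    #neighbours : ∀ {lo hi k} → Place lo hi k → ℕ
    #neighbours (isolated _) = 0
    #neighbours (start _)    = 1
    #neighbours (finish _ _) = 1
    #neighbours (inside _ _) = 2

    interior : ∀ {lo hi k} (p : Place lo hi k) → #neighbours p ≡ 2 → ∃ λ j → k ≡ suc j × lo ℕ.≤ j × suc j ℕ.< hi
    interior (inside lo≤j sj<hi) _ = _ , refl , lo≤j , sj<hi

    module _ {cs lo hi} (cov : Covers cs lo hi) (unique : Unique cs) where
      open Covers cov

      private
        count-neighbours : ∀ {k} ys → lo ℕ.≤ k → k ℕ.≤ hi → Unique ys → All (λ c → c ∈ cs × Neighbour (s k) c) ys →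
                           (∀ {i} → lo ℕ.≤ i → i ℕ.≤ hi → Apart 1 k i → s i ∈ ys) → length (neighbours cs (s k)) ≡ length ys
        count-neighbours {k} ys lo≤k k≤hi uys sub sup = map-length id (map-↭ id (Unique.filter⁺ (adjacent? (s k)) unique) uys
          into (λ _ _ e → e) (λ {y} y∈ → y , ∈-filter⁺ (adjacent? (s k)) (proj₁ (All.lookup sub y∈)) (Neighbour⇒Adjacent (proj₂ (All.lookup sub y∈))) , refl))
          where
          into : ∀ {c} → c ∈ neighbours cs (s k) → c ∈ ys
          into c∈ with ∈-filter⁻ (adjacent? (s k)) {xs = cs} c∈
          ... | c∈cs , a with sound c∈cs
          ... | i , lo≤i , i≤hi , refl = sup lo≤i i≤hi (adjacent (ℕ.≤-trans k≤hi hi≤l) (ℕ.≤-trans i≤hi hi≤l) (Adjacent⇒Neighbour a))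

        next : ∀ {k} → lo ℕ.≤ k → k ℕ.< hi → s (suc k) ∈ cs × Neighbour (s k) (s (suc k))
        next {k} lo≤k k<hi = complete (ℕ.m≤n⇒m≤1+n lo≤k) k<hi , d k , step (ℕ.≤-trans k<hi hi≤l)

        previous : ∀ {k} → lo ℕ.≤ k → k ℕ.< hi → s k ∈ cs × Neighbour (s (suc k)) (s k)
        previous {k} lo≤k k<hi = complete lo≤k (ℕ.<⇒≤ k<hi) , Neighbour-sym (d k , step (ℕ.≤-trans k<hi hi≤l))

      opaque
        length-neighbours : ∀ {k} (p : Place lo hi k) → length (neighbours cs (s k)) ≡ #neighbours p
        length-neighbours (isolated refl) = count-neighbours [] ℕ.≤-refl ℕ.≤-refl [] []
          λ { lo≤i i≤lo (inj₁ refl) → contradiction i≤lo ℕ.1+n≰n ; lo≤i i≤lo (inj₂ refl) → contradiction lo≤i ℕ.1+n≰n }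
        length-neighbours (start lo<hi) = count-neighbours (s (suc lo) ∷ []) ℕ.≤-refl (ℕ.<⇒≤ lo<hi) ([] ∷ []) (next ℕ.≤-refl lo<hi ∷ [])
          λ { lo≤i i≤hi (inj₁ refl) → here refl ; lo≤i i≤hi (inj₂ refl) → contradiction lo≤i ℕ.1+n≰n }
        length-neighbours (finish {j} lo≤j refl) = count-neighbours (s j ∷ []) (ℕ.m≤n⇒m≤1+n lo≤j) ℕ.≤-refl ([] ∷ []) (previous lo≤j ℕ.≤-refl ∷ [])
          λ { lo≤i i≤hi (inj₁ refl) → contradiction i≤hi ℕ.1+n≰n ; lo≤i i≤hi (inj₂ refl) → here refl }
        length-neighbours (inside {j} lo≤j sj<hi) = count-neighbours (s j ∷ s (2 ℕ.+ j) ∷ []) (ℕ.m≤n⇒m≤1+n lo≤j) (ℕ.<⇒≤ sj<hi)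
          (((λ e → case injective (ℕ.≤-trans (ℕ.<⇒≤ (ℕ.<⇒≤ sj<hi)) hi≤l) (ℕ.≤-trans sj<hi hi≤l) e of λ ()) ∷ []) ∷ [] ∷ [])
          (previous lo≤j (ℕ.<⇒≤ sj<hi) ∷ next (ℕ.m≤n⇒m≤1+n lo≤j) sj<hi ∷ [])
          λ { lo≤i i≤hi (inj₁ refl) → there (here refl) ; lo≤i i≤hi (inj₂ refl) → here refl }

        private
          middle-window : ∀ {j} → lo ℕ.≤ j → suc j ℕ.< hi → ∃₂ λ mb ma →
            Behind lo (suc j) (d j ∷ fromMaybeᴸ mb) × Ahead hi (suc j) (d (suc j) ∷ fromMaybeᴸ ma) × Valid mb (d j) (d (suc j)) ma
          middle-window {j} lo≤j sj<hi with ℕ.m≤n⇒m<n∨m≡n lo≤j | ℕ.m≤n⇒m<n∨m≡n sj<hi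
          ... | inj₂ refl | inj₂ refl = nothing , nothing , behind1 , ahead1 refl , no-reversal₁ hi≤l , tt , tt
          ... | inj₂ refl | inj₁ 3+j≤ = nothing , just _ , behind1 , ahead2 3+j≤ , no-reversal₁ (ℕ.≤-trans sj<hi hi≤l) , tt
            , (no-reversal₁ (ℕ.≤-trans 3+j≤ hi≤l) , no-reversal₂ (ℕ.≤-trans 3+j≤ hi≤l))
          ... | inj₁ (ℕ.s≤s lo≤j′) | inj₂ refl = just _ , nothing , behind2 lo≤j′ , ahead1 refl , no-reversal₁ hi≤l
            , (no-reversal₁ (ℕ.<⇒≤ hi≤l) , no-reversal₂ hi≤l) , tt
          ... | inj₁ (ℕ.s≤s lo≤j′) | inj₁ 3+j≤ = just _ , just _ , behind2 lo≤j′ , ahead2 3+j≤ , no-reversal₁ (ℕ.<⇒≤ 3+j≤l)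
            , (no-reversal₁ (ℕ.<⇒≤ (ℕ.<⇒≤ 3+j≤l)) , no-reversal₂ (ℕ.<⇒≤ 3+j≤l)) , (no-reversal₁ 3+j≤l , no-reversal₂ 3+j≤l)
            where
            3+j≤l : 3 ℕ.+ j ℕ.≤ l
            3+j≤l = ℕ.≤-trans 3+j≤ hi≤l

        -- Having two neighbours places the square strictly inside the interval; the free corner is
        -- then transferred to the window, where the table decides.
        Kink⇒turn : ∀ {k} → lo ℕ.≤ k → k ℕ.≤ hi → Kink cs (s k) → ∃ λ j → k ≡ suc j × lo ℕ.≤ j × suc j ℕ.< hi × d j ≢ d (suc j)
        Kink⇒turn {k} lo≤k k≤hi (nt , v , v∈ , deg) =
          let j , k≡ , lo≤j , sj<hi = interior (place k lo≤k k≤hi) (trans (sym (length-neighbours (place k lo≤k k≤hi))) nt)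
              mb , ma , b , a , valid = middle-window lo≤j sj<hi
              o , o∈ , pos≡ = ∈-corners⁻ {s k} v∈
          in j , k≡ , lo≤j , sj<hi , freeCorner⇒turn mb (d j) (d (suc j)) ma valid
            (lose o∈ (trans (sym (degreeAt-corner cov (subst (lo ℕ.≤_) k≡ lo≤k) (subst (ℕ._≤ hi) k≡ k≤hi) b a o∈))
              (trans (cong (degreeAt cs) (sym (trans pos≡ (cong (λ k → s k ⊕ o) k≡)))) (trans (sym (degree≡degreeAt cs v)) deg))))

        turn⇒Kink : ∀ {j} → lo ℕ.≤ j → suc j ℕ.< hi → d j ≢ d (suc j) → Kink cs (s (suc j))
        turn⇒Kink {j} lo≤j sj<hi turn =
          let mb , ma , b , a , valid = middle-window lo≤j sj<hi
              o , o∈ , deg = find (turn⇒freeCorner mb (d j) (d (suc j)) ma valid turn)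
              lo≤sj = ℕ.m≤n⇒m≤1+n lo≤j
              sj≤hi = ℕ.<⇒≤ sj<hi
              v , pos≡ = position-surjective cs (∈-vertices⁺ cs (complete lo≤sj sj≤hi) o∈)
          in length-neighbours (inside lo≤j sj<hi) , v , subst (_∈ corners (s (suc j))) (sym pos≡) (∈-corners⁺ (s (suc j)) o∈)
           , trans (degree≡degreeAt cs v) (trans (cong (degreeAt cs) pos≡) (trans (degreeAt-corner cov lo≤sj sj≤hi b a o∈) deg))

    turnAt⁺ : ∀ {j} → d j ≢ d (suc j) → turnAt j ≡ true
    turnAt⁺ {j} ne with d j ≟ᴰ d (suc j)
    ... | yes e = contradiction e ne
    ... | no _  = refl

    turnAt⁻ : ∀ {j} → turnAt j ≡ true → d j ≢ d (suc j)
    turnAt⁻ {j} t with d j ≟ᴰ d (suc j)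
    ... | no ne = ne

-- Segments as intervals between kinks or terminal squares

module Segments where
  open ≡
  open Lists
  open Grid
  open Chains
  open Windows
  open Kinks

  module ChainSegments {n m} (n≡ : n ≡ 3 ℕ.+ m) (B : PolyominoChain n) where
    open PolyominoChain B
    l : ℕ
    l = 2 ℕ.+ m
    C : Chain l
    C = chain n≡ B
    open Chain C
    open ChainProperties C
    open ChainKinks C public

    squares-cover : Covers squares 0 l
    squares-cover = record
      { hi≤l = ℕ.≤-refl
      ; sound = λ c∈ → let k , k≤l , e = ∈-squares⁻ n≡ B c∈ in k , ℕ.z≤n , k≤l , e
      ; complete = λ {k} _ _ → cell-∈ n≡ B k
      }

    squares-unique : Unique squares
    squares-unique = Unique.tabulate⁺ distinct

    private
      between? : ∀ (i j k : Fin n) → Dec (i Fin.≤ k × k Fin.≤ j)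
      between? i j k = (i Fin.≤? k) ×-dec (k Fin.≤? j)

    run-cover : ∀ i j → Covers (run i j) (toℕ i) (toℕ j)
    run-cover i j = record
      { hi≤l = toℕ≤ n≡ j
      ; sound = sound
      ; complete = complete
      }
      where
      sound : ∀ {c} → c ∈ run i j → ∃ λ k → toℕ i ℕ.≤ k × k ℕ.≤ toℕ j × c ≡ s k
      sound c∈ with ∈-map∘filter⁻ square (between? i j) {f = square} {xs = allFin n} c∈
      ... | k , _ , refl , i≤k , k≤j = toℕ k , i≤k , k≤j , cong square (sym (clip-toℕ n≡ k))
      complete : ∀ {k} → toℕ i ℕ.≤ k → k ℕ.≤ toℕ j → s k ∈ run i j
      complete {k} i≤k k≤j = ∈-map∘filter⁺ square (between? i j) (clip n≡ k , ∈-allFin (clip n≡ k) , refl ,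
        subst (toℕ i ℕ.≤_) (sym k≡) i≤k , subst (ℕ._≤ toℕ j) (sym k≡) k≤j)
        where
        k≡ : toℕ (clip n≡ k) ≡ k
        k≡ = toℕ-clip n≡ (ℕ.≤-trans k≤j (toℕ≤ n≡ j))

    run-unique : ∀ i j → Unique (run i j)
    run-unique i j = Unique.map⁺ distinct (Unique.filter⁺ (between? i j) (Unique.allFin⁺ n))

    length-run : ∀ i j → toℕ i ℕ.≤ toℕ j → length (run i j) ≡ suc (toℕ j ∸ toℕ i)
    length-run i j i≤j = trans (length-map square (filter (between? i j) (allFin n)))
      (trans (map-length toℕ (map-↭ toℕ (Unique.filter⁺ (between? i j) (Unique.allFin⁺ n))
        (Unique.applyUpTo⁺₁ (toℕ i ℕ.+_) (suc (toℕ j ∸ toℕ i)) (λ a<b _ e → ℕ.<⇒≢ a<b (ℕ.+-cancelˡ-≡ (toℕ i) _ _ e)))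
        into (λ _ _ → Fin.toℕ-injective) onto))
      (length-applyUpTo (toℕ i ℕ.+_) (suc (toℕ j ∸ toℕ i))))
      where
      into : ∀ {k} → k ∈ filter (between? i j) (allFin n) → toℕ k ∈ applyUpTo (toℕ i ℕ.+_) (suc (toℕ j ∸ toℕ i))
      into {k} k∈ with proj₂ (∈-filter⁻ (between? i j) {xs = allFin n} k∈)
      ... | i≤k , k≤j = subst (_∈ applyUpTo (toℕ i ℕ.+_) (suc (toℕ j ∸ toℕ i))) (ℕ.m+[n∸m]≡n i≤k)
        (∈-applyUpTo⁺ (toℕ i ℕ.+_) (ℕ.s≤s (ℕ.∸-monoˡ-≤ (toℕ i) k≤j)))
      onto : ∀ {k} → k ∈ applyUpTo (toℕ i ℕ.+_) (suc (toℕ j ∸ toℕ i)) → ∃ λ k′ → k′ ∈ filter (between? i j) (allFin n) × toℕ k′ ≡ k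
      onto k∈ with ∈-applyUpTo⁻ (toℕ i ℕ.+_) k∈
      ... | o , o< , refl = clip n≡ (toℕ i ℕ.+ o)
        , ∈-filter⁺ (between? i j) (∈-allFin (clip n≡ (toℕ i ℕ.+ o)))
            (subst (toℕ i ℕ.≤_) (sym k≡) (ℕ.m≤m+n (toℕ i) o) , subst (ℕ._≤ toℕ j) (sym k≡) k≤j) , k≡
        where
        k≤j : toℕ i ℕ.+ o ℕ.≤ toℕ j
        k≤j = subst (toℕ i ℕ.+ o ℕ.≤_) (ℕ.m+[n∸m]≡n i≤j) (ℕ.+-monoʳ-≤ (toℕ i) (ℕ.s≤s⁻¹ o<))
        k≡ : toℕ (clip n≡ (toℕ i ℕ.+ o)) ≡ toℕ i ℕ.+ o
        k≡ = toℕ-clip n≡ (ℕ.≤-trans k≤j (toℕ≤ n≡ j))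

    NoTurn : ℕ → ℕ → Set
    NoTurn a b = ∀ {j} → a ℕ.≤ j → suc j ℕ.< b → turnAt j ≡ false

    opaque
      Linear⇒NoTurn : ∀ i j → Linear (run i j) → NoTurn (toℕ i) (toℕ j)
      Linear⇒NoTurn i j lin {k} i≤k k<j = ¬-not λ t → lin (Covers.complete (run-cover i j) {suc k} (ℕ.m≤n⇒m≤1+n i≤k) (ℕ.<⇒≤ k<j))
        (turn⇒Kink (run-cover i j) (run-unique i j) {k} i≤k k<j (turnAt⁻ t))

      NoTurn⇒Linear : ∀ i j → NoTurn (toℕ i) (toℕ j) → Linear (run i j)
      NoTurn⇒Linear i j nt c∈ kink =
        let k , i≤k , k≤j , c≡ = Covers.sound (run-cover i j) c∈
            _ , _ , i≤k′ , k′<j , ne = Kink⇒turn (run-cover i j) (run-unique i j) {k} i≤k k≤j (subst (Kink (run i j)) c≡ kink)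
        in contradiction (trans (sym (nt i≤k′ k′<j)) (turnAt⁺ ne)) λ ()

    Start End : ℕ → Set
    Start a = a ≡ 0 ⊎ ∃ λ j → a ≡ suc j × turnAt j ≡ true
    End b   = b ≡ l ⊎ ∃ λ j → b ≡ suc j × turnAt j ≡ true

    -- The description of a segment by indices. As `turnAt j` concerns the square `suc j`, the
    -- delimiting kinks in `Start` and `End` appear with a successor, and `NoTurn` speaks of the
    -- squares strictly between `a` and `b`.
    record Span (a b : ℕ) : Set where
      field
        a<b    : a ℕ.< b
        b≤l    : b ℕ.≤ l
        noTurn : NoTurn a b
        starts : Start a
        ends   : End b

    left right : Segment → ℕ
    left  = toℕ ∘ Segment.first
    right = toℕ ∘ Segment.last

    Terminal⇒ : ∀ {k} → k ℕ.≤ l → Terminal squares (s k) → k ≡ 0 ⊎ k ≡ l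
    Terminal⇒ {k} k≤l terminal = at-end p (trans (sym (length-neighbours squares-cover squares-unique p)) terminal)
      where
      p : Place 0 l k
      p = place k ℕ.z≤n k≤l
      at-end : ∀ {k} (p : Place 0 l k) → #neighbours p ≡ 1 → k ≡ 0 ⊎ k ≡ l
      at-end (start _)    _ = inj₁ refl
      at-end (finish _ e) _ = inj₂ e

    Terminal⇐ : ∀ {k} → k ℕ.≤ l → k ≡ 0 ⊎ k ≡ l → Terminal squares (s k)
    Terminal⇐ {k} k≤l e = trans (length-neighbours squares-cover squares-unique (p e)) (one e)
      where
      p : ∀ {k} → k ≡ 0 ⊎ k ≡ l → Place 0 l k
      p (inj₁ refl) = start (ℕ.s≤s ℕ.z≤n)
      p (inj₂ refl) = finish ℕ.z≤n refl
      one : ∀ {k} (e : k ≡ 0 ⊎ k ≡ l) → #neighbours (p e) ≡ 1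
      one (inj₁ refl) = refl
      one (inj₂ refl) = refl

    module _ (sg : Segment) where
      open Segment sg
      private
        a b : ℕ
        a = left sg
        b = right sg

        b≤l : b ℕ.≤ l
        b≤l = toℕ≤ n≡ last

        noTurn : NoTurn a b
        noTurn = Linear⇒NoTurn first last linear

        maximal′ : ∀ {i j} → i ℕ.≤ a → b ℕ.≤ j → j ℕ.≤ l → NoTurn i j → i ≡ a × j ≡ b
        maximal′ {i} {j} i≤a b≤j j≤l nt =
          let e , e′ = maximal (clip n≡ i) (clip n≡ j) (subst (ℕ._≤ a) (sym i≡) i≤a) (subst (b ℕ.≤_) (sym j≡) b≤j)
                         (NoTurn⇒Linear (clip n≡ i) (clip n≡ j) (subst₂ NoTurn (sym i≡) (sym j≡) nt))
          in trans (sym i≡) (cong toℕ e) , trans (sym j≡) (cong toℕ e′)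
          where
          j≡ : toℕ (clip n≡ j) ≡ j
          j≡ = toℕ-clip n≡ j≤l
          i≡ : toℕ (clip n≡ i) ≡ i
          i≡ = toℕ-clip n≡ (ℕ.≤-trans i≤a (ℕ.≤-trans first≤last b≤l))

        -- A single square is not maximal, because a run of two squares has no non-terminal square
        -- and so no kink. It is extended to the right, or to the left if it is the last square.
        proper : a ℕ.< b
        proper with ℕ.m≤n⇒m<n∨m≡n first≤last
        ... | inj₁ a<b = a<b
        ... | inj₂ a≡b with ℕ.m≤n⇒m<n∨m≡n b≤l
        ...   | inj₁ b<l = contradiction (proj₂ (maximal′ ℕ.≤-refl (ℕ.n≤1+n b) b<l
                  λ a≤j sj<sb → contradiction (ℕ.≤-trans (subst (suc _ ℕ.≤_) (sym a≡b) (ℕ.s≤s⁻¹ sj<sb)) a≤j) ℕ.1+n≰n)) ℕ.1+n≢n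
        ...   | inj₂ b≡l = contradiction (trans (proj₁ (maximal′ (subst (suc m ℕ.≤_) (sym (trans a≡b b≡l)) (ℕ.n≤1+n (suc m))) (ℕ.≤-reflexive b≡l) ℕ.≤-refl
                  λ sm≤j sj<l → contradiction (ℕ.≤-trans (ℕ.s≤s⁻¹ sj<l) sm≤j) ℕ.1+n≰n)) (trans a≡b b≡l)) (ℕ.1+n≢n ∘ sym)

        -- If the square `suc k` were not a kink, the segment could be extended by the square `k`.
        starts : ∀ {k} → k ≡ a → Start k
        starts {zero}  _ = inj₁ refl
        starts {suc k} e with turnAt k in eq
        ... | true  = inj₂ (k , refl , eq)
        ... | false = contradiction (trans (proj₁ (maximal′ (subst (k ℕ.≤_) e (ℕ.n≤1+n k)) ℕ.≤-refl b≤l nt)) (sym e)) (ℕ.1+n≢n ∘ sym)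
          where
          nt : NoTurn k b
          nt k≤j sj<b with ℕ.m≤n⇒m<n∨m≡n k≤j
          ... | inj₁ k<j  = noTurn (subst (ℕ._≤ _) e k<j) sj<b
          ... | inj₂ refl = eq

        ends : ∀ {k} → k ≡ b → End k
        ends {zero}  e = contradiction (subst (a ℕ.<_) (sym e) proper) λ ()
        ends {suc k} e with turnAt k in eq | ℕ.m≤n⇒m<n∨m≡n b≤l
        ... | true  | _ = inj₂ (k , refl , eq)
        ... | false | inj₂ b≡l = inj₁ (trans e b≡l)
        ... | false | inj₁ b<l = contradiction (proj₂ (maximal′ ℕ.≤-refl (ℕ.n≤1+n b) b<l nt)) ℕ.1+n≢n
          where
          nt : NoTurn a (suc b)
          nt {j} a≤j sj<sb with ℕ.m≤n⇒m<n∨m≡n (ℕ.s≤s⁻¹ sj<sb)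
          ... | inj₁ sj<b = noTurn a≤j sj<b
          ... | inj₂ sj≡b with trans sj≡b (sym e)
          ...   | refl = eq

      opaque
        span : Span a b
        span = record { a<b = proper ; b≤l = b≤l ; noTurn = noTurn ; starts = starts refl ; ends = ends refl }

        segmentLength≡ : segmentLength sg ≡ suc (b ∸ a)
        segmentLength≡ = length-run first last first≤last

        External⇒ : External sg → a ≡ 0 ⊎ b ≡ l
        External⇒ ext =
          let c , c∈ , terminal = find ext
              k , a≤k , k≤b , c≡ = Covers.sound (run-cover first last) c∈
          in [ (λ k≡0 → inj₁ (ℕ.n≤0⇒n≡0 (subst (a ℕ.≤_) k≡0 a≤k))) , (λ k≡l → inj₂ (ℕ.≤-antisym b≤l (subst (ℕ._≤ b) k≡l k≤b))) ]′
               (Terminal⇒ {k} (ℕ.≤-trans k≤b b≤l) (subst (Terminal squares) c≡ terminal))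

        External⇐ : a ≡ 0 ⊎ b ≡ l → External sg
        External⇐ (inj₁ a≡0) = lose {x = s a} (Covers.complete (run-cover first last) {a} ℕ.≤-refl first≤last)
          (Terminal⇐ {a} (ℕ.≤-trans first≤last b≤l) (inj₁ a≡0))
        External⇐ (inj₂ b≡l) = lose {x = s b} (Covers.complete (run-cover first last) {b} first≤last ℕ.≤-refl)
          (Terminal⇐ {b} b≤l (inj₂ b≡l))

    Same⁺ : ∀ {sg tg} → left sg ≡ left tg → right sg ≡ right tg → Same sg tg
    Same⁺ e e′ = Fin.toℕ-injective e , Fin.toℕ-injective e′

    module _ {a b} (sp : Span a b) where
      open Span sp
      private
        a≡ : toℕ (clip n≡ a) ≡ a
        a≡ = toℕ-clip n≡ (ℕ.≤-trans (ℕ.<⇒≤ a<b) b≤l)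
        b≡ : toℕ (clip n≡ b) ≡ b
        b≡ = toℕ-clip n≡ b≤l

        i≮a : ∀ {i j} → NoTurn i j → b ℕ.≤ j → ¬ (i ℕ.< a)
        i≮a nt b≤j i<a with starts
        ... | inj₁ refl = contradiction i<a λ ()
        ... | inj₂ (k , refl , t) = case trans (sym t) (nt (ℕ.s≤s⁻¹ i<a) (ℕ.≤-trans a<b b≤j)) of λ ()

        b≮j : ∀ {i j} → NoTurn i j → i ℕ.≤ a → j ℕ.≤ l → ¬ (b ℕ.< j)
        b≮j nt i≤a j≤l b<j with ends
        ... | inj₁ refl = contradiction (ℕ.≤-trans b<j j≤l) ℕ.1+n≰n
        ... | inj₂ (k , refl , t) = case trans (sym t) (nt (ℕ.≤-trans i≤a (ℕ.s≤s⁻¹ a<b)) b<j) of λ ()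

      opaque
        segment : Segment
        segment = record
          { first = clip n≡ a
          ; last = clip n≡ b
          ; first≤last = subst₂ ℕ._≤_ (sym a≡) (sym b≡) (ℕ.<⇒≤ a<b)
          ; linear = NoTurn⇒Linear (clip n≡ a) (clip n≡ b) (subst₂ NoTurn (sym a≡) (sym b≡) noTurn)
          ; maximal = λ i j i≤ ≤j lin →
              let i≤a = subst (toℕ i ℕ.≤_) a≡ i≤
                  b≤j = subst (ℕ._≤ toℕ j) b≡ ≤j
                  nt  = Linear⇒NoTurn i j lin in
              Fin.toℕ-injective (trans (ℕ.≤-antisym i≤a (ℕ.≮⇒≥ (i≮a nt b≤j))) (sym a≡)) ,
              Fin.toℕ-injective (trans (ℕ.≤-antisym (ℕ.≮⇒≥ (b≮j nt i≤a (toℕ≤ n≡ j))) b≤j) (sym b≡))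
          }

        left-segment : left segment ≡ a
        left-segment = a≡

        right-segment : right segment ≡ b
        right-segment = b≡

    previousStart : ∀ i → ∃ λ a → a ℕ.≤ i × Start a × (∀ {j} → a ℕ.≤ j → j ℕ.< i → turnAt j ≡ false)
    previousStart zero = 0 , ℕ.z≤n , inj₁ refl , λ _ ()
    previousStart (suc i) with turnAt i in eq
    ... | true  = suc i , ℕ.≤-refl , inj₂ (i , refl , eq) , λ i<j j<i → contradiction (ℕ.≤-trans j<i i<j) ℕ.1+n≰n
    ... | false with previousStart i
    ...   | a , a≤i , st , nt = a , ℕ.m≤n⇒m≤1+n a≤i , st , λ {j} a≤j j<si →
            [ nt a≤j , (λ { refl → eq }) ]′ (ℕ.m≤n⇒m<n∨m≡n (ℕ.s≤s⁻¹ j<si))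

    nextEnd : ∀ r {i} → r ℕ.+ suc i ≡ l → ∃ λ b → i ℕ.< b × b ℕ.≤ l × End b × (∀ {j} → i ℕ.≤ j → suc j ℕ.< b → turnAt j ≡ false)
    nextEnd zero refl = l , ℕ.≤-refl , ℕ.≤-refl , inj₁ refl , λ i≤j sj<l → contradiction (ℕ.≤-trans (ℕ.s≤s⁻¹ sj<l) i≤j) ℕ.1+n≰n
    nextEnd (suc r) {i} e with turnAt i in eq
    ... | true = suc i , ℕ.≤-refl , subst (suc i ℕ.≤_) e (ℕ.m≤n+m (suc i) (suc r)) , inj₂ (i , refl , eq)
      , λ i≤j sj<b → contradiction (ℕ.≤-trans (ℕ.s≤s⁻¹ sj<b) i≤j) ℕ.1+n≰n
    ... | false with nextEnd r (trans (ℕ.+-suc r (suc i)) e)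
    ...   | b , si<b , b≤l , en , nt = b , ℕ.<⇒≤ si<b , b≤l , en , λ {j} i≤j sj<b →
            [ (λ i<j → nt i<j sj<b) , (λ { refl → eq }) ]′ (ℕ.m≤n⇒m<n∨m≡n i≤j)

    opaque
      span-around : ∀ {i} → i ℕ.< l → ∃₂ λ a b → Span a b × a ℕ.≤ i × i ℕ.< b
      span-around {i} i<l with previousStart i | nextEnd (l ∸ suc i) {i} (ℕ.m∸n+n≡m i<l)
      ... | a , a≤i , st , nt | b , i<b , b≤l , en , nt′ = a , b , record
        { a<b = ℕ.<-≤-trans (ℕ.s≤s a≤i) i<b
        ; b≤l = b≤l
        ; noTurn = λ {j} a≤j sj<b → [ nt a≤j , (λ i≤j → nt′ i≤j sj<b) ]′ (ℕ.<-≤-connex j i)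
        ; starts = st
        ; ends = en
        } , a≤i , i<b

    opaque
      -- A U-turn would give a segment from square `suc j` to square `3 ℕ.+ j`: it has length 3, it
      -- is internal since neither of these is an end of the chain, and it has the edge found by
      -- `U-turn-edge`. Equality of directions is decidable, so refuting the U-turn suffices.
      staircase : Ω B → ∀ {j} → 4 ℕ.+ j ℕ.≤ l → Staircase (d j) (d (suc j)) (d (2 ℕ.+ j)) (d (3 ℕ.+ j))
      staircase ω {j} 4+j≤l t e t′ = decidable-stable (d (3 ℕ.+ j) ≟ᴰ d j) λ ne → ω (segment sp) internal length≡3 (edge33 ne)
        where
        sp : Span (suc j) (3 ℕ.+ j)
        sp = record
          { a<b = ℕ.n≤1+n _
          ; b≤l = ℕ.<⇒≤ 4+j≤l
          ; noTurn = λ {k} j<k k<2+j → case ℕ.≤-antisym j<k (ℕ.s≤s⁻¹ (ℕ.s≤s⁻¹ k<2+j)) of λ { refl → ¬-not λ t → turnAt⁻ t e }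
          ; starts = inj₂ (j , refl , turnAt⁺ t)
          ; ends = inj₂ (2 ℕ.+ j , refl , turnAt⁺ t′)
          }
        internal : Internal (segment sp)
        internal ext = [ (λ e → case trans (sym (left-segment sp)) e of λ ())
                       , (λ e → ℕ.<⇒≢ 4+j≤l (trans (sym (right-segment sp)) e)) ]′ (External⇒ (segment sp) ext)
        length≡3 : segmentLength (segment sp) ≡ 3
        length≡3 = trans (segmentLength≡ (segment sp)) (cong₂ (λ a b → suc (b ∸ a)) (left-segment sp)
          (trans (right-segment sp) refl) ⟨ trans ⟩ cong suc (ℕ.m+n∸n≡m 2 (suc j)))
        3+j≤l : 3 ℕ.+ j ℕ.≤ l
        3+j≤l = ℕ.<⇒≤ 4+j≤l
        edge33 : d (3 ℕ.+ j) ≢ d j → HasEdge33 (segment sp)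
        edge33 ne = proj₁ u , proj₁ v
          , subst₂ (λ p q → (p , q) ∈ allSides (segmentSquares (segment sp))) (sym (proj₂ u)) (sym (proj₂ v))
              (∈-allSides⁺ (segmentSquares (segment sp)) (Covers.complete (run-cover (Segment.first (segment sp)) (Segment.last (segment sp)))
                (subst (ℕ._≤ 2 ℕ.+ j) (sym (left-segment sp)) (ℕ.n≤1+n _)) (subst (2 ℕ.+ j ℕ.≤_) (sym (right-segment sp)) (ℕ.n≤1+n _))) σ∈)
          , degree≡3 (proj₁ u) (proj₂ u) (proj₁ (All.lookup side-ends σ∈)) (proj₁ (proj₂ (proj₂ found)))
          , degree≡3 (proj₁ v) (proj₂ v) (proj₂ (All.lookup side-ends σ∈)) (proj₂ (proj₂ (proj₂ found)))
          where
          w : List Point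
          w = middle (just (d j)) (d (suc j)) (d (2 ℕ.+ j)) (just (d (3 ℕ.+ j)))
          found : ∃ λ σ → σ ∈ sides origin × windowDegree w (proj₁ σ) ≡ 3 × windowDegree w (proj₂ σ) ≡ 3
          found = find (U-turn-edge (d j) (d (suc j)) (d (2 ℕ.+ j)) (d (3 ℕ.+ j))
            (no-reversal₁ 3+j≤l , (no-reversal₁ (ℕ.<⇒≤ 3+j≤l) , no-reversal₂ 3+j≤l) , (no-reversal₁ 4+j≤l , no-reversal₂ 4+j≤l)) t e t′ ne)
          σ : Side
          σ = proj₁ found
          σ∈ : σ ∈ sides origin
          σ∈ = proj₁ (proj₂ found)
          side∈ : s (2 ℕ.+ j) ⊕ˢ σ ∈ allSides squares
          side∈ = ∈-allSides⁺ squares (cell-∈ n≡ B (2 ℕ.+ j)) σ∈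
          u : ∃ λ v → position squares v ≡ s (2 ℕ.+ j) ⊕ proj₁ σ
          u = position-surjective squares (edge-end squares (inj₁ side∈))
          v : ∃ λ v → position squares v ≡ s (2 ℕ.+ j) ⊕ proj₂ σ
          v = position-surjective squares (edge-end squares (inj₂ side∈))
          degree≡3 : ∀ v {o} → position squares v ≡ s (2 ℕ.+ j) ⊕ o → o ∈ corners origin →
                     windowDegree (middle (just (d j)) (d (suc j)) (d (2 ℕ.+ j)) (just (d (3 ℕ.+ j)))) o ≡ 3 →
                     Graph.degree chainGraph v ≡ 3
          degree≡3 v pv o∈ deg = trans (degree≡degreeAt squares v) (trans (cong (degreeAt squares) pv)
            (trans (degreeAt-corner squares-cover ℕ.z≤n (ℕ.<⇒≤ (ℕ.<⇒≤ 4+j≤l)) (behind2 ℕ.z≤n) (ahead2 4+j≤l) o∈) deg))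

-- The extremal classes in terms of the three counts

module Classes where
  open ≡
  open Windows
  open Counting
  open Segments

  module SegmentCounts {n m} (n≡ : n ≡ 3 ℕ.+ m) (B : PolyominoChain n) where
    open PolyominoChain B
    open ChainSegments n≡ B
    open ChainProperties C using (turnAt)

    private
      τ : ℕ → Bool
      τ = turnAt

    ends straights turns : ℕ
    ends      = #ends τ m
    straights = #straight τ m
    turns     = #turns τ m

    StraightAt TurnsAt : ℕ → Set
    StraightAt = Hit (bothStraight τ) m 0
    TurnsAt    = Hit (bothTurn τ) m 0

    straightAt⁺ : ∀ {i} → i ℕ.< m → τ i ≡ false → τ (suc i) ≡ false → StraightAt i
    straightAt⁺ {i} i<m e e′ = ℕ.z≤n , subst (i ℕ.<_) (sym (ℕ.+-identityʳ m)) i<m , cong₂ (λ a b → not a ∧ not b) e e′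

    turnsAt⁺ : ∀ {i} → i ℕ.< m → τ i ≡ true → τ (suc i) ≡ true → TurnsAt i
    turnsAt⁺ {i} i<m e e′ = ℕ.z≤n , subst (i ℕ.<_) (sym (ℕ.+-identityʳ m)) i<m , cong₂ _∧_ e e′

    module _ {i} (h : StraightAt i) where
      straight-< : i ℕ.< m
      straight-< = subst (i ℕ.<_) (ℕ.+-identityʳ m) (proj₁ (proj₂ h))

      straight-here : τ i ≡ false
      straight-here = trans (sym (not-involutive (τ i))) (cong not (∧-conicalˡ _ _ (proj₂ (proj₂ h))))

      straight-next : τ (suc i) ≡ false
      straight-next = trans (sym (not-involutive (τ (suc i)))) (cong not (∧-conicalʳ (not (τ i)) _ (proj₂ (proj₂ h))))

    first-span : τ 0 ≡ true → Span 0 1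
    first-span t = record
      { a<b = ℕ.≤-refl ; b≤l = ℕ.s≤s ℕ.z≤n ; noTurn = λ _ → λ { (ℕ.s≤s ()) } ; starts = inj₁ refl ; ends = inj₂ (0 , refl , t) }

    last-span : τ m ≡ true → Span (suc m) (2 ℕ.+ m)
    last-span t = record
      { a<b = ℕ.≤-refl ; b≤l = ℕ.≤-refl ; starts = inj₂ (m , refl , t) ; ends = inj₁ refl
      ; noTurn = λ m<j j<m → contradiction (ℕ.≤-trans (ℕ.s≤s⁻¹ j<m) m<j) ℕ.1+n≰n }

    turns-span : ∀ {i} → TurnsAt i → Span (suc i) (2 ℕ.+ i)
    turns-span {i} (_ , i<m , h) = record
      { a<b = ℕ.≤-refl ; b≤l = ℕ.s≤s (ℕ.s≤s (ℕ.<⇒≤ (subst (i ℕ.<_) (ℕ.+-identityʳ m) i<m)))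
      ; noTurn = λ i<j j<i → contradiction (ℕ.≤-trans (ℕ.s≤s⁻¹ j<i) i<j) ℕ.1+n≰n
      ; starts = inj₂ (i , refl , ∧-conicalˡ _ _ h) ; ends = inj₂ (suc i , refl , ∧-conicalʳ (τ i) _ h) }

    -- Neither `suc i` nor `2 ℕ.+ i` is a kink, so the segment that contains both squares cannot
    -- stop at either of them.
    straight-span : ∀ {i} → StraightAt i → ∃₂ λ a b → Span a b × a ℕ.≤ i × 3 ℕ.+ i ℕ.≤ b
    straight-span {i} h =
      let a , b , sp , a≤1+i , 1+i<b = span-around {suc i} (ℕ.s≤s (ℕ.m≤n⇒m≤1+n (straight-< h)))
      in a , b , sp , start-before (Span.starts sp) a≤1+i , end-after (Span.b≤l sp) (Span.ends sp) 1+i<b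
      where
      start-before : ∀ {a} → Start a → a ℕ.≤ suc i → a ℕ.≤ i
      start-before (inj₁ refl) _ = ℕ.z≤n
      start-before (inj₂ (k , refl , t)) k<1+i = ℕ.≤∧≢⇒< (ℕ.s≤s⁻¹ k<1+i) λ { refl → case trans (sym t) (straight-here h) of λ () }
      end-after : ∀ {b} → b ℕ.≤ l → End b → suc i ℕ.< b → 3 ℕ.+ i ℕ.≤ b
      end-after _ (inj₁ refl) _ = ℕ.s≤s (ℕ.s≤s (straight-< h))
      end-after _ (inj₂ (k , refl , t)) 1+i<b = ℕ.s≤s (ℕ.≤∧≢⇒< (ℕ.s≤s⁻¹ 1+i<b) λ { refl → case trans (sym t) (straight-next h) of λ () })

    long-straight : ∀ {a b} → Span a b → 3 ℕ.+ a ℕ.≤ b → StraightAt a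
    long-straight sp 3+a≤b = straightAt⁺ (ℕ.s≤s⁻¹ (ℕ.s≤s⁻¹ (ℕ.≤-trans 3+a≤b b≤l))) (noTurn ℕ.≤-refl (ℕ.<⇒≤ 3+a≤b)) (noTurn (ℕ.n≤1+n _) 3+a≤b)
      where open Span sp

    longer-straight : ∀ {a b} → Span a b → 4 ℕ.+ a ℕ.≤ b → 2 ℕ.≤ straights
    longer-straight {a} sp 4+a≤b = hits⇒2≤count (bothStraight τ) m (long-straight sp (ℕ.<⇒≤ 4+a≤b))
      (straightAt⁺ (ℕ.s≤s⁻¹ (ℕ.s≤s⁻¹ (ℕ.≤-trans 4+a≤b b≤l))) (noTurn (ℕ.n≤1+n a) (ℕ.<⇒≤ 4+a≤b)) (noTurn (ℕ.m≤n+m a 2) 4+a≤b)) (ℕ.1+n≢n ∘ sym)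
      where open Span sp

    start-turn : ∀ {a} → Start a → a ≢ 0 → ∃ λ k → a ≡ suc k × τ k ≡ true
    start-turn (inj₁ e) ne = contradiction e ne
    start-turn (inj₂ t) _  = t

    end-turn : ∀ {b} → End b → b ≢ l → ∃ λ k → b ≡ suc k × τ k ≡ true
    end-turn (inj₁ e) ne = contradiction e ne
    end-turn (inj₂ t) _  = t

    short-first : ∀ {b} → Span 0 b → b ≡ 1 → τ 0 ≡ true
    short-first sp refl with end-turn (Span.ends sp) (λ ())
    ... | _ , refl , t = t

    short-last : ∀ {a} → Span a l → a ≡ suc m → τ m ≡ true
    short-last sp refl with start-turn (Span.starts sp) (λ ())
    ... | _ , refl , t = t

    short-internal : ∀ {a} → Span a (suc a) → a ≢ 0 → suc a ≢ l → 1 ℕ.≤ turns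
    short-internal sp a≢0 b≢l with start-turn (Span.starts sp) a≢0 | end-turn (Span.ends sp) b≢l
    ... | k , refl , t | _ , refl , t′ = hit⇒1≤count (bothTurn τ) m
      (turnsAt⁺ (ℕ.s≤s⁻¹ (ℕ.s≤s⁻¹ (ℕ.≤∧≢⇒< (Span.b≤l sp) b≢l))) t t′)

    toℕᵇ-true : ∀ {a} → a ≡ true → toℕᵇ a ≡ 1
    toℕᵇ-true refl = refl

    first-end : τ 0 ≡ true → 1 ℕ.≤ ends
    first-end t = subst (λ k → 1 ℕ.≤ k ℕ.+ toℕᵇ (τ m)) (sym (toℕᵇ-true t)) (ℕ.s≤s ℕ.z≤n)

    last-end : τ m ≡ true → 1 ℕ.≤ ends
    last-end t = subst (λ k → 1 ℕ.≤ toℕᵇ (τ 0) ℕ.+ k) (sym (toℕᵇ-true t)) (ℕ.m≤n+m 1 (toℕᵇ (τ 0)))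

    both-ends : τ 0 ≡ true → τ m ≡ true → 2 ℕ.≤ ends
    both-ends t t′ = subst₂ (λ j k → 2 ℕ.≤ j ℕ.+ k) (sym (toℕᵇ-true t)) (sym (toℕᵇ-true t′)) ℕ.≤-refl

    ends-cases : 1 ℕ.≤ ends → τ 0 ≡ true ⊎ τ m ≡ true
    ends-cases 1≤ with τ 0 | τ m
    ... | true  | _    = inj₁ refl
    ... | false | true = inj₂ refl

    ends≥2 : 2 ℕ.≤ ends → τ 0 ≡ true × τ m ≡ true
    ends≥2 2≤ with τ 0 | τ m
    ... | true  | true  = refl , refl
    ends≥2 (ℕ.s≤s ()) | true  | false
    ends≥2 (ℕ.s≤s ()) | false | true

    short-external : ∀ {a b} → Span a b → b ≡ suc a → a ≡ 0 ⊎ b ≡ l → (a ≡ 0 × τ 0 ≡ true) ⊎ (b ≡ l × τ m ≡ true)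
    short-external sp e (inj₁ refl) = inj₁ (refl , short-first sp e)
    short-external sp e (inj₂ refl) = inj₂ (refl , short-last sp (ℕ.suc-injective (sym e)))

    short : ∀ {a b} → Span a b → b ≡ suc a → 1 ℕ.≤ ends ⊎ 1 ℕ.≤ turns
    short {a} {b} sp refl with a ℕ.≟ 0 | b ℕ.≟ l
    ... | yes a≡0 | _       = inj₁ ([ first-end ∘ proj₂ , last-end ∘ proj₂ ]′ (short-external sp refl (inj₁ a≡0)))
    ... | no _    | yes b≡l = inj₁ ([ first-end ∘ proj₂ , last-end ∘ proj₂ ]′ (short-external sp refl (inj₂ b≡l)))
    ... | no a≢0  | no b≢l  = inj₂ (short-internal sp a≢0 b≢l)

    module _ (sg : Segment) where
      right≡ : ∀ {k} → segmentLength sg ≡ suc k → right sg ≡ k ℕ.+ left sg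
      right≡ {k} e = trans (sym (ℕ.m∸n+n≡m (ℕ.<⇒≤ (Span.a<b (span sg)))))
        (cong (ℕ._+ left sg) (ℕ.suc-injective (trans (sym (segmentLength≡ sg)) e)))

      right≤ : ∀ {k} → segmentLength sg ℕ.≤ suc k → right sg ℕ.≤ k ℕ.+ left sg
      right≤ {k} le = subst (ℕ._≤ k ℕ.+ left sg) (ℕ.m∸n+n≡m (ℕ.<⇒≤ (Span.a<b (span sg))))
        (ℕ.+-monoˡ-≤ (left sg) (ℕ.s≤s⁻¹ (subst (ℕ._≤ suc k) (segmentLength≡ sg) le)))

      right≥ : ∀ {k} → suc k ℕ.≤ segmentLength sg → k ℕ.+ left sg ℕ.≤ right sg
      right≥ {k} le = subst (k ℕ.+ left sg ℕ.≤_) (ℕ.m∸n+n≡m (ℕ.<⇒≤ (Span.a<b (span sg))))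
        (ℕ.+-monoˡ-≤ (left sg) (ℕ.s≤s⁻¹ (subst (suc k ℕ.≤_) (segmentLength≡ sg) le)))

      length≥2 : 2 ℕ.≤ segmentLength sg
      length≥2 = subst (2 ℕ.≤_) (sym (segmentLength≡ sg)) (ℕ.s≤s (ℕ.m<n⇒0<n∸m (Span.a<b (span sg))))

      length≤4 : straights ℕ.≤ 1 → segmentLength sg ℕ.≤ 4
      length≤4 x≤1 = ℕ.≮⇒≥ λ 5≤ → ℕ.1+n≰n (ℕ.≤-trans (longer-straight (span sg) (right≥ 5≤)) x≤1)

      straight4 : segmentLength sg ≡ 4 → StraightAt (left sg)
      straight4 e = long-straight (span sg) (right≥ (ℕ.≤-reflexive (sym e)))

      internal≢2 : turns ≡ 0 → Internal sg → segmentLength sg ≢ 2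
      internal≢2 t≡0 int e = ℕ.1+n≰n (subst (1 ℕ.≤_) t≡0 (short-internal (subst (Span (left sg)) (right≡ e) (span sg))
        (λ a≡0 → int (External⇐ sg (inj₁ a≡0))) (λ b≡l → int (External⇐ sg (inj₂ (trans (right≡ e) b≡l))))))

    length-segment : ∀ {a b} (sp : Span a b) → segmentLength (segment sp) ≡ suc (b ∸ a)
    length-segment sp = trans (segmentLength≡ (segment sp)) (cong₂ (λ b a → suc (b ∸ a)) (right-segment sp) (left-segment sp))

    length-segment₂ : ∀ {a} (sp : Span a (suc a)) → segmentLength (segment sp) ≡ 2
    length-segment₂ {a} sp = trans (length-segment sp) (cong suc (ℕ.m+n∸n≡m 1 a))

    single-straight : straights ℕ.≤ 1 → AtMostOne (λ s → segmentLength s ≡ 4)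
    single-straight x≤1 sg tg e e′ with left sg ℕ.≟ left tg
    ... | yes l≡ = Same⁺ {sg} {tg} l≡ (trans (right≡ sg e) (trans (cong (3 ℕ.+_) l≡) (sym (right≡ tg e′))))
    ... | no l≢  = contradiction (ℕ.≤-trans (hits⇒2≤count (bothStraight τ) m (straight4 sg e) (straight4 tg e′) l≢) x≤1) ℕ.1+n≰n

    -- The segment around two consecutive straight squares has at least four squares; the bound on
    -- the lengths leaves exactly these four and so fixes its left end.
    4-segment : (∀ s → segmentLength s ℕ.≤ 4) → ∀ {i} → StraightAt i → ∃ λ sg → left sg ≡ i × segmentLength sg ≡ 4
    4-segment ≤4 {i} h =
      let a , b , sp , a≤i , 3+i≤b = straight-span h
          sg = segment sp
          b≤3+a = subst₂ (λ b a → b ℕ.≤ 3 ℕ.+ a) (right-segment sp) (left-segment sp) (right≤ sg (≤4 sg))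
          i≡a = ℕ.≤-antisym (ℕ.+-cancelˡ-≤ 3 i a (ℕ.≤-trans 3+i≤b b≤3+a)) a≤i
      in sg , trans (left-segment sp) (sym i≡a)
       , trans (length-segment sp) (trans (cong (λ b → suc (b ∸ a)) (ℕ.≤-antisym b≤3+a (subst (λ i → 3 ℕ.+ i ℕ.≤ b) i≡a 3+i≤b)))
                                          (cong suc (ℕ.m+n∸n≡m 3 a)))

    straights≤1 : (∀ s → segmentLength s ℕ.≤ 4) → AtMostOne (λ s → segmentLength s ≡ 4) → straights ℕ.≤ 1
    straights≤1 ≤4 single = ℕ.≮⇒≥ λ 2≤ →
      let i , i′ , h , h′ , i≢i′ = 2≤count⇒hits (bothStraight τ) m 2≤
          sg , left≡ , e = 4-segment ≤4 h
          tg , left≡′ , e′ = 4-segment ≤4 h′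
      in i≢i′ (trans (sym left≡) (trans (cong Fin.toℕ (proj₁ (single sg tg e e′))) left≡′))
      where import Data.Fin.Base as Fin

    turns≡0 : (∀ s → Internal s → segmentLength s ≢ 2) → turns ≡ 0
    turns≡0 no2 = ℕ.n≤0⇒n≡0 (ℕ.≮⇒≥ λ 1≤ →
      let i , h = 1≤count⇒hit (bothTurn τ) m 1≤
          sp = turns-span h
          i<m = subst (i ℕ.<_) (ℕ.+-identityʳ m) (proj₁ (proj₂ h))
      in no2 (segment sp) (λ ext → [ (λ e → ℕ.1+n≢0 (trans (sym (left-segment sp)) e))
                                   , (λ e → ℕ.<⇒≢ (ℕ.s≤s (ℕ.s≤s i<m)) (trans (sym (right-segment sp)) e)) ]′ (External⇒ (segment sp) ext))
             (length-segment₂ sp))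

    first-external : ∀ {b} (sp : Span 0 b) → External (segment sp)
    first-external sp = External⇐ (segment sp) (inj₁ (left-segment sp))

    last-external : ∀ {a} (sp : Span a l) → External (segment sp)
    last-external sp = External⇐ (segment sp) (inj₂ (right-segment sp))

    ends≤1 : AtMostOne (λ s → External s × segmentLength s ≡ 2) → ends ℕ.≤ 1
    ends≤1 single = ℕ.≮⇒≥ λ 2≤ →
      let t , t′ = ends≥2 2≤
          sp = first-span t
          sp′ = last-span t′
          same = single (segment sp) (segment sp′) (first-external sp , length-segment₂ sp) (last-external sp′ , length-segment₂ sp′)
      in ℕ.1+n≢0 (trans (sym (left-segment sp′)) (trans (cong Fin.toℕ (sym (proj₁ same))) (left-segment sp)))
      where import Data.Fin.Base as Fin

    single-short : ends ℕ.≤ 1 → AtMostOne (λ s → External s × segmentLength s ≡ 2)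
    single-short e≤1 sg tg (ext , e) (ext′ , e′)
      with short-external (span sg) (right≡ sg e) (External⇒ sg ext) | short-external (span tg) (right≡ tg e′) (External⇒ tg ext′)
    ... | inj₁ (p , _) | inj₁ (q , _) = Same⁺ {sg} {tg} (trans p (sym q)) (trans (right≡ sg e) (trans (cong suc (trans p (sym q))) (sym (right≡ tg e′))))
    ... | inj₂ (p , _) | inj₂ (q , _) = Same⁺ {sg} {tg}
      (ℕ.suc-injective (trans (sym (right≡ sg e)) (trans (trans p (sym q)) (right≡ tg e′)))) (trans p (sym q))
    ... | inj₁ (_ , t) | inj₂ (_ , t′) = contradiction (ℕ.≤-trans (both-ends t t′) e≤1) ℕ.1+n≰n
    ... | inj₂ (_ , t) | inj₁ (_ , t′) = contradiction (ℕ.≤-trans (both-ends t′ t) e≤1) ℕ.1+n≰n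

    ends≡0 : (∀ s → segmentLength s ≢ 2) → ends ≡ 0
    ends≡0 no2 = ℕ.n≤0⇒n≡0 (ℕ.≮⇒≥ λ 1≤ → [ (λ t → no2 (segment (first-span t)) (length-segment₂ (first-span t)))
                                            , (λ t → no2 (segment (last-span t)) (length-segment₂ (last-span t))) ]′ (ends-cases 1≤))

    external-short : 1 ℕ.≤ ends → ∃ λ s → External s × segmentLength s ≡ 2
    external-short 1≤ = [ (λ t → segment (first-span t) , first-external (first-span t) , length-segment₂ (first-span t))
                        , (λ t → segment (last-span t) , last-external (last-span t) , length-segment₂ (last-span t)) ]′ (ends-cases 1≤)

    external? : ∀ s → External s ⊎ Internal s
    external? s = [ inj₁ ∘ External⇐ s ∘ inj₁
                  , (λ p → [ inj₁ ∘ External⇐ s ∘ inj₂ , (λ q → inj₂ λ ext → [ p , q ]′ (External⇒ s ext)) ]′ (toSum (right s ℕ.≟ l))) ]′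
                  (toSum (left s ℕ.≟ 0))

    𝒵*⇒ : 𝒵* B → turns ≡ 0 × ends ≡ 0 × straights ℕ.≤ 1
    𝒵*⇒ z = turns≡0 (λ s _ → no2 s) , ends≡0 no2 , straights≤1 ≤4 single4
      where open 𝒵* z

    𝒵*⇐ : Ω B → turns ≡ 0 → ends ≡ 0 → straights ℕ.≤ 1 → 𝒵* B
    𝒵*⇐ ω t≡0 e≡0 x≤1 = record
      { inΩ = ω
      ; no2 = λ s e → [ (λ 1≤ → ℕ.1+n≰n (subst (1 ℕ.≤_) e≡0 1≤)) , (λ 1≤ → ℕ.1+n≰n (subst (1 ℕ.≤_) t≡0 1≤)) ]′ (short (span s) (right≡ s e))
      ; ≤4 = λ s → length≤4 s x≤1
      ; single4 = single-straight x≤1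
      }

    -- Each of the two counts is at most 1. Both cannot be 1: the external segment of length 2 and
    -- the segment of length 4 would contradict `4⇒other≡3`.
    𝒵⇒ : 𝒵 B → turns ≡ 0 × ends ℕ.+ straights ℕ.≤ 1
    𝒵⇒ z = turns≡0 (λ s int e → [ (λ e′ → case trans (sym e) e′ of λ ()) , (λ e′ → case trans (sym e) e′ of λ ()) ]′ (internal s int))
         , one (ends≤1 single2) (straights≤1 ≤4 single4)
             λ 1≤e 1≤x → let s , ext , e = external-short 1≤e
                             _ , h = 1≤count⇒hit (bothStraight τ) m 1≤x
                             s′ , _ , e′ = 4-segment ≤4 h
                         in case trans (sym e) (4⇒other≡3 s′ s e′ ext (λ same → case trans (sym e′) (trans (same-length {s′} {s} same) e) of λ ())) of λ ()
      where
      open 𝒵 z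
      ≤4 : ∀ s → segmentLength s ℕ.≤ 4
      ≤4 s = [ external s , (λ int → [ (λ e → subst (ℕ._≤ 4) (sym e) (ℕ.n≤1+n 3)) , ℕ.≤-reflexive ]′ (internal s int)) ]′ (external? s)
      same-length : ∀ {s t} → Same s t → segmentLength s ≡ segmentLength t
      same-length {s} {t} (e , e′) = trans (segmentLength≡ s) (trans (cong₂ (λ i j → suc (Fin.toℕ j ∸ Fin.toℕ i)) e e′) (sym (segmentLength≡ t)))
        where import Data.Fin.Base as Fin
      one : ∀ {j k} → j ℕ.≤ 1 → k ℕ.≤ 1 → (1 ℕ.≤ j → 1 ℕ.≤ k → 1 ≡ 0) → j ℕ.+ k ℕ.≤ 1
      one ℕ.z≤n k≤1 _ = k≤1
      one (ℕ.s≤s ℕ.z≤n) ℕ.z≤n _ = ℕ.≤-refl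
      one (ℕ.s≤s ℕ.z≤n) (ℕ.s≤s ℕ.z≤n) f = case f ℕ.≤-refl ℕ.≤-refl of λ ()

    𝒵⇐ : Ω B → turns ≡ 0 → ends ℕ.+ straights ℕ.≤ 1 → 𝒵 B
    𝒵⇐ ω t≡0 e+x≤1 = record
      { inΩ = ω
      ; internal = λ s int → 3-or-4 (ℕ.≤∧≢⇒< (length≥2 s) (internal≢2 s t≡0 int ∘ sym)) (length≤4 s x≤1)
      ; external = λ s _ → length≤4 s x≤1
      ; single2 = single-short (ℕ.m+n≤o⇒m≤o ends e+x≤1)
      ; single4 = single-straight x≤1
      -- If `t` had length 2, it would count in `ends` while `s` counts in `straights`, a total of
      -- 2; if it had length 4, it would be the same segment as `s`.
      ; 4⇒other≡3 = λ s t e ext ¬same → [ id , (λ e′ → contradiction (single-straight x≤1 s t e e′) ¬same) ]′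
          (3-or-4 (ℕ.≤∧≢⇒< (length≥2 t) (λ e′ → ℕ.1+n≰n (ℕ.≤-trans (ℕ.+-mono-≤ (ends≥1 t ext (sym e′))
            (hit⇒1≤count (bothStraight τ) m (straight4 s e))) e+x≤1))) (length≤4 t x≤1))
      }
      where
      open import Function.Base using (id)
      x≤1 : straights ℕ.≤ 1
      x≤1 = ℕ.m+n≤o⇒n≤o ends e+x≤1
      ends≥1 : ∀ t → External t → segmentLength t ≡ 2 → 1 ℕ.≤ ends
      ends≥1 t ext e = [ first-end ∘ proj₂ , last-end ∘ proj₂ ]′ (short-external (span t) (right≡ t e) (External⇒ t ext))
      3-or-4 : ∀ {k} → 3 ℕ.≤ k → k ℕ.≤ 4 → k ≡ 3 ⊎ k ≡ 4
      3-or-4 {3} _ _ = inj₁ refl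
      3-or-4 {4} _ _ = inj₂ refl
      3-or-4 {suc (suc (suc (suc (suc k))))} _ (ℕ.s≤s (ℕ.s≤s (ℕ.s≤s (ℕ.s≤s ()))))
      3-or-4 {1} (ℕ.s≤s ()) _
      3-or-4 {2} (ℕ.s≤s (ℕ.s≤s ())) _

    Z†⇒ : Z† B → turns ≡ 0 × straights ≡ 0 × ends ℕ.≤ 1
    Z†⇒ z = turns≡0 (λ s int e → case trans (sym e) (internal s int) of λ ())
          , ℕ.n≤0⇒n≡0 (ℕ.≮⇒≥ λ 1≤x →
              let _ , h = 1≤count⇒hit (bothStraight τ) m 1≤x
                  s , _ , e = 4-segment (λ s → ℕ.m≤n⇒m≤1+n (≤3 s)) h
              in ℕ.1+n≰n (subst (ℕ._≤ 3) e (≤3 s)))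
          , ends≤1 single2
      where
      open Z† z
      ≤3 : ∀ s → segmentLength s ℕ.≤ 3
      ≤3 s = [ external s , (λ int → ℕ.≤-reflexive (internal s int)) ]′ (external? s)

-- Isometries of the grid and the graph isomorphisms they induce

module Isometries where
  open ≡
  open Grid

  -- φ moves points and F moves cells, which are named by their lower left corners; r is the effect on the
  -- corners of a cell, relative to these.
  record Motion : Set where
    field
      φ : Point → Point
      F : Cell → Cell
      r : Point → Point
      φ-⊕     : ∀ c a → φ (c ⊕ a) ≡ F c ⊕ r a
      r-sides : ∀ {o} → o ∈ orientedSides → (r (proj₁ o) , r (proj₂ o)) ∈ orientedSides

    map-edge : ∀ {cs ds} → (∀ {c} → c ∈ cs → F c ∈ ds) → ∀ {p q} → Edge cs p q → Edge ds (φ p) (φ q)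
    map-edge {cs} {ds} into {p} {q} e =
      let c , o , c∈ , o∈ , pq≡ = Edge⁻ cs e
      in subst₂ (Edge ds)
        (trans (sym (φ-⊕ c (proj₁ o))) (cong φ (sym (cong proj₁ pq≡))))
        (trans (sym (φ-⊕ c (proj₂ o))) (cong φ (sym (cong proj₂ pq≡))))
        (Edge⁺ ds (into c∈) (r-sides o∈))

  record Isometry : Set where
    field
      forth back : Motion
    open Motion forth public using (φ; F)
    open Motion back public using () renaming (φ to φ⁻¹; F to F⁻¹)
    field
      φ⁻¹∘φ : ∀ p → φ⁻¹ (φ p) ≡ p
      φ∘φ⁻¹ : ∀ p → φ (φ⁻¹ p) ≡ p
      F⁻¹∘F : ∀ c → F⁻¹ (F c) ≡ c
      ρ      : Dir → Dir
      F-move : ∀ d c → F (move d c) ≡ move (ρ d) (F c)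

  private
    corner-edge : ∀ {o} → o ∈ corners origin → Any (λ s → o ≡ proj₁ s) orientedSides
    corner-edge = All.lookup (from-yes (all? (λ o → any? (λ s → o ≟ᴾ proj₁ s) orientedSides) (corners origin)))

  -- Every corner of a square is an end of one of its sides. A point map that preserves edges
  -- therefore maps vertices to vertices.
  vertex-edge : ∀ cs {p} → p ∈ vertices cs → ∃ λ q → Edge cs p q
  vertex-edge cs p∈ =
    let c , o , c∈ , o∈ , p≡ = ∈-vertices⁻ cs p∈
        σ , σ∈ , o≡ = find (corner-edge o∈)
    in c ⊕ proj₂ σ , subst (λ p → Edge cs p (c ⊕ proj₂ σ)) (trans (cong (c ⊕_) (sym o≡)) (sym p≡)) (Edge⁺ cs c∈ σ∈)

  EdgeMap : List Cell → List Cell → (Point → Point) → Set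
  EdgeMap cs ds φ = ∀ p q → Edge cs p q → Edge ds (φ p) (φ q)

  private
    image : ∀ cs ds φ → EdgeMap cs ds φ → ∀ v → ∃ λ w → position ds w ≡ φ (position cs v)
    image cs ds φ φ-edge v =
      let q , e = vertex-edge cs (∈-lookup {xs = vertices cs} v)
      in position-surjective ds (edge-end ds (φ-edge (position cs v) q e))

    image-inverse : ∀ cs ds φ ψ (φ-edge : EdgeMap cs ds φ) (ψ-edge : EdgeMap ds cs ψ) → (∀ p → φ (ψ p) ≡ p) →
                    ∀ v → proj₁ (image cs ds φ φ-edge (proj₁ (image ds cs ψ ψ-edge v))) ≡ v
    image-inverse cs ds φ ψ φ-edge ψ-edge φ∘ψ v = position-injective ds
      (trans (proj₂ (image cs ds φ φ-edge (proj₁ (image ds cs ψ ψ-edge v))))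
        (trans (cong φ (proj₂ (image ds cs ψ ψ-edge v))) (φ∘ψ (position ds v))))

  points-≅ : ∀ cs ds φ ψ → EdgeMap cs ds φ → EdgeMap ds cs ψ → (∀ p → ψ (φ p) ≡ p) → (∀ p → φ (ψ p) ≡ p) →
             graph cs ≅ graph ds
  points-≅ cs ds φ ψ φ-edge ψ-edge ψ∘φ φ∘ψ = record
    { vertices = mk↔ₛ′ (λ v → proj₁ (image cs ds φ φ-edge v)) (λ v → proj₁ (image ds cs ψ ψ-edge v))
        (image-inverse cs ds φ ψ φ-edge ψ-edge φ∘ψ) (image-inverse ds cs ψ φ ψ-edge φ-edge ψ∘φ)
    ; adjacency = λ u v → mk⇔
        (λ e → subst₂ (Edge ds) (sym (proj₂ (image cs ds φ φ-edge u))) (sym (proj₂ (image cs ds φ φ-edge v))) (φ-edge _ _ e))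
        (λ e → subst₂ (Edge cs) (ψ∘φ (position cs u)) (ψ∘φ (position cs v))
          (ψ-edge _ _ (subst₂ (Edge ds) (proj₂ (image cs ds φ φ-edge u)) (proj₂ (image cs ds φ φ-edge v)) e)))
    }

  isometry-≅ : ∀ (i : Isometry) {cs ds} → (∀ {c} → c ∈ cs → Isometry.F i c ∈ ds) →
               (∀ {d} → d ∈ ds → ∃ λ c → c ∈ cs × d ≡ Isometry.F i c) → graph cs ≅ graph ds
  isometry-≅ i {cs} {ds} into onto = points-≅ cs ds φ φ⁻¹
    (λ _ _ → Motion.map-edge forth {cs} {ds} into)
    (λ _ _ → Motion.map-edge back {ds} {cs} λ d∈ → let c , c∈ , d≡ = onto d∈ in
      subst (_∈ cs) (sym (trans (cong F⁻¹ d≡) (F⁻¹∘F c))) c∈)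
    φ⁻¹∘φ φ∘φ⁻¹
    where open Isometry i

  identity : Isometry
  identity = record
    { forth = same ; back = same ; φ⁻¹∘φ = λ _ → refl ; φ∘φ⁻¹ = λ _ → refl ; F⁻¹∘F = λ _ → refl
    ; ρ = id ; F-move = λ _ _ → refl }
    where
    same : Motion
    same = record { φ = id ; F = id ; r = id ; φ-⊕ = λ _ _ → refl ; r-sides = id }

  infixr 9 _⟫_
  _⟫_ : Isometry → Isometry → Isometry
  i ⟫ j = record
    { forth = I.forth then J.forth
    ; back  = J.back then I.back
    ; φ⁻¹∘φ = λ p → trans (cong I.φ⁻¹ (J.φ⁻¹∘φ (I.φ p))) (I.φ⁻¹∘φ p)
    ; φ∘φ⁻¹ = λ p → trans (cong J.φ (I.φ∘φ⁻¹ (J.φ⁻¹ p))) (J.φ∘φ⁻¹ p)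
    ; F⁻¹∘F = λ c → trans (cong I.F⁻¹ (J.F⁻¹∘F (I.F c))) (I.F⁻¹∘F c)
    ; ρ = J.ρ ∘ I.ρ
    ; F-move = λ d c → trans (cong J.F (I.F-move d c)) (J.F-move (I.ρ d) (I.F c))
    }
    where
    module I = Isometry i
    module J = Isometry j
    _then_ : Motion → Motion → Motion
    f then g = record
      { φ = Motion.φ g ∘ Motion.φ f
      ; F = Motion.F g ∘ Motion.F f
      ; r = Motion.r g ∘ Motion.r f
      ; φ-⊕ = λ c a → trans (cong (Motion.φ g) (Motion.φ-⊕ f c a)) (Motion.φ-⊕ g (Motion.F f c) (Motion.r f a))
      ; r-sides = Motion.r-sides g ∘ Motion.r-sides f
      }

  translate : Point → Isometry
  translate t = record
    { forth = by t ; back = by (neg t)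
    ; φ⁻¹∘φ = λ p → ⊕-undo p t
    ; φ∘φ⁻¹ = λ p → undo p
    ; F⁻¹∘F = λ c → ⊕-undo c t
    ; ρ = id
    ; F-move = λ d c → ⊕-swap c (off d) t
    }
    where
    by : Point → Motion
    by t = record { φ = _⊕ t ; F = _⊕ t ; r = id ; φ-⊕ = λ c a → ⊕-swap c a t ; r-sides = id }
    undo : ∀ p → p ⊕ neg t ⊕ t ≡ p
    undo p = trans (⊕-swap p (neg t) t) (⊕-undo p t)

  private
    closed : ∀ (r : Point → Point) → All (λ o → (r (proj₁ o) , r (proj₂ o)) ∈ orientedSides) orientedSides →
             ∀ {o} → o ∈ orientedSides → (r (proj₁ o) , r (proj₂ o)) ∈ orientedSides
    closed r table o∈ = All.lookup table o∈

    swapᴾ : Point → Point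
    swapᴾ (x , y) = y , x

    negateᴾ : Point → Point
    negateᴾ (x , y) = ℤ.- x , y

    -- The lower left corner of the reflected cell is the image of the lower right corner, whence
    -- the successor; `mirror` is the corresponding exchange of the corners within a cell.
    negateᶜ : Cell → Cell
    negateᶜ (x , y) = ℤ.- ℤ.suc x , y

    mirror : Point → Point
    mirror (a , b) = 1ℤ ℤ.- a , b

  swapAxes : Isometry
  swapAxes = record
    { forth = exchange ; back = exchange ; φ⁻¹∘φ = λ _ → refl ; φ∘φ⁻¹ = λ _ → refl ; F⁻¹∘F = λ _ → refl
    ; ρ = swapᴰ
    ; F-move = λ { E c → refl ; N c → refl ; W c → refl ; S c → refl }
    }
    where
    exchange : Motion
    exchange = record
      { φ = swapᴾ ; F = swapᴾ ; r = swapᴾ ; φ-⊕ = λ _ _ → refl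
      ; r-sides = closed swapᴾ (from-yes (all? (λ o → (swapᴾ (proj₁ o) , swapᴾ (proj₂ o)) ∈ˢ? orientedSides) orientedSides)) }
    swapᴰ : Dir → Dir
    swapᴰ E = N
    swapᴰ N = E
    swapᴰ W = S
    swapᴰ S = W

  reflectX : Isometry
  reflectX = record
    { forth = negate ; back = negate
    ; φ⁻¹∘φ = λ (x , y) → cong (_, y) (ℤ.neg-involutive x)
    ; φ∘φ⁻¹ = λ (x , y) → cong (_, y) (ℤ.neg-involutive x)
    ; F⁻¹∘F = λ (x , y) → cong (_, y) (solve 1 (λ x → :- (con 1ℤ :+ :- (con 1ℤ :+ x)) := x) refl x)
    ; ρ = reflectᴰ
    ; F-move = λ { E (x , y) → cong (_, 0ℤ ℤ.+ y) (solve 1 (λ x → :- (con 1ℤ :+ (con 1ℤ :+ x)) := con -1ℤ :+ :- (con 1ℤ :+ x)) refl x)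
                 ; N (x , y) → cong (_, 1ℤ ℤ.+ y) (solve 1 (λ x → :- (con 1ℤ :+ (con 0ℤ :+ x)) := con 0ℤ :+ :- (con 1ℤ :+ x)) refl x)
                 ; W (x , y) → cong (_, 0ℤ ℤ.+ y) (solve 1 (λ x → :- (con 1ℤ :+ (con -1ℤ :+ x)) := con 1ℤ :+ :- (con 1ℤ :+ x)) refl x)
                 ; S (x , y) → cong (_, -1ℤ ℤ.+ y) (solve 1 (λ x → :- (con 1ℤ :+ (con 0ℤ :+ x)) := con 0ℤ :+ :- (con 1ℤ :+ x)) refl x) }
    }
    where
    open +-*-Solver
    negate : Motion
    negate = record
      { φ = negateᴾ ; F = negateᶜ ; r = mirror
      ; φ-⊕ = λ (x , y) (a , b) → cong (_, b ℤ.+ y) (solve 2 (λ x a → :- (a :+ x) := (con 1ℤ :- a) :+ :- (con 1ℤ :+ x)) refl x a)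
      ; r-sides = closed mirror (from-yes (all? (λ o → (mirror (proj₁ o) , mirror (proj₂ o)) ∈ˢ? orientedSides) orientedSides)) }
    reflectᴰ : Dir → Dir
    reflectᴰ E = W
    reflectᴰ N = N
    reflectᴰ W = E
    reflectᴰ S = S

  -- The symmetries of the square act transitively on ordered pairs of perpendicular directions, and
  -- they are generated by `swapAxes` and `reflectX`.
  to-axes : ∀ u v → v ≢ u → v ≢ opp u → ∃ λ i → Isometry.ρ i u ≡ E × Isometry.ρ i v ≡ N
  to-axes E N _ _ = identity , refl , refl
  to-axes N E _ _ = swapAxes , refl , refl
  to-axes W N _ _ = reflectX , refl , refl
  to-axes N W _ _ = reflectX ⟫ swapAxes , refl , refl
  to-axes S E _ _ = swapAxes ⟫ reflectX , refl , refl
  to-axes S W _ _ = reflectX ⟫ swapAxes ⟫ reflectX , refl , refl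
  to-axes W S _ _ = swapAxes ⟫ reflectX ⟫ swapAxes ⟫ reflectX , refl , refl
  to-axes E S _ _ = swapAxes ⟫ reflectX ⟫ swapAxes , refl , refl
  to-axes E E p _ = contradiction refl p
  to-axes N N p _ = contradiction refl p
  to-axes W W p _ = contradiction refl p
  to-axes S S p _ = contradiction refl p
  to-axes E W _ p = contradiction refl p
  to-axes W E _ p = contradiction refl p
  to-axes N S _ p = contradiction refl p
  to-axes S N _ p = contradiction refl p

-- Uniqueness of the alternating staircase up to isometry

module Staircases where
  open ≡
  open Grid
  open Windows
  open Counting
  open Isometries

  turn⇒≢ : ∀ {x y} → turn x y ≡ true → x ≢ y
  turn⇒≢ {x} {y} t with x ≟ᴰ y
  ... | no ne = ne

  ¬turn⇒≡ : ∀ {x y} → turn x y ≡ false → x ≡ y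
  ¬turn⇒≡ {x} {y} t with x ≟ᴰ y
  ... | yes e = e

  turn-opp : ∀ x y → turn (opp y) (opp x) ≡ turn x y
  turn-opp = from-yes (all-dir? λ x → all-dir? λ y → turn (opp y) (opp x) Bool.≟ turn x y)
    where import Data.Bool.Properties as Bool

  opp-involutive : ∀ d → opp (opp d) ≡ d
  opp-involutive = from-yes (all-dir? λ d → opp (opp d) ≟ᴰ d)

  perpendicular : Dir → Dir
  perpendicular E = N
  perpendicular N = E
  perpendicular W = N
  perpendicular S = E

  perpendicular-≢ : ∀ d → perpendicular d ≢ d × perpendicular d ≢ opp d
  perpendicular-≢ = from-yes (all-dir? λ d → ¬? (perpendicular d ≟ᴰ d) ×-dec ¬? (perpendicular d ≟ᴰ opp d))

  record Zigzag (m : ℕ) (s : ℕ → Cell) : Set where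
    field
      d          : ℕ → Dir
      step       : ∀ {j} → j ℕ.< 2 ℕ.+ m → s (suc j) ≡ move (d j) (s j)
      noReversal : ∀ {j} → suc j ℕ.< 2 ℕ.+ m → NoReversal (d j) (d (suc j))
      staircase  : ∀ {j} → 3 ℕ.+ j ℕ.< 2 ℕ.+ m → Staircase (d j) (d (suc j)) (d (2 ℕ.+ j)) (d (3 ℕ.+ j))

    τ : ℕ → Bool
    τ j = turn (d j) (d (suc j))

    field
      alternating : ∀ {j} → j ℕ.< m → τ (suc j) ≡ not (τ j)

    alternating-odd : τ 0 ≡ false → ∀ {j} → j ℕ.≤ m → τ j ≡ odd j
    alternating-odd τ₀ {zero}  _   = τ₀
    alternating-odd τ₀ {suc j} j<m = trans (alternating j<m) (cong not (alternating-odd τ₀ (ℕ.<⇒≤ j<m)))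

  staircase-opp : ∀ w x y z → Staircase w x y z → Staircase (opp z) (opp y) (opp x) (opp w)
  staircase-opp w x y z st z≢y y≡x x≢w = cong opp (sym (st (x≢w ∘ cong opp ∘ sym)
    (trans (sym (opp-involutive x)) (trans (cong opp (sym y≡x)) (opp-involutive y))) (z≢y ∘ cong opp ∘ sym)))

  -- A chain that begins with a segment of length 2 is to be read from its other end. The steps are
  -- then taken in reverse order and in opposite directions, and all conditions are symmetric under
  -- this.
  reverse : ∀ {m s} → Zigzag m s → Zigzag m (λ k → s (2 ℕ.+ m ∸ k))
  reverse {m} {s} z = record
    { d = d′
    ; step = λ {j} j< → back-step (suc m ∸ j) j (ℕ.m∸n+n≡m (ℕ.s≤s⁻¹ j<))
    ; noReversal = λ {j} j< → back-noReversal (m ∸ j) j (ℕ.m∸n+n≡m (ℕ.s≤s⁻¹ (ℕ.s≤s⁻¹ j<)))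
    ; staircase = λ {j} j< → back-staircase (suc m ∸ (3 ℕ.+ j)) j (ℕ.m∸n+n≡m (ℕ.s≤s⁻¹ j<))
    ; alternating = λ {j} j< → back-alternating (m ∸ suc j) j (ℕ.m∸n+n≡m j<)
    }
    where
    open Zigzag z
    d′ : ℕ → Dir
    d′ j = opp (d (suc m ∸ j))

    ∸≡ : ∀ {a b c} → a ℕ.+ b ≡ c → c ∸ b ≡ a
    ∸≡ {a} {b} refl = ℕ.m+n∸n≡m a b

    d′≡ : ∀ a b → a ℕ.+ b ≡ suc m → d′ b ≡ opp (d a)
    d′≡ a b e = cong (opp ∘ d) (∸≡ e)

    shift : ∀ a {b c} → a ℕ.+ suc b ≡ c → suc a ℕ.+ b ≡ c
    shift a {b} e = trans (sym (ℕ.+-suc a b)) e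

    back-step : ∀ a b → a ℕ.+ b ≡ suc m → s (2 ℕ.+ m ∸ suc b) ≡ move (d′ b) (s (2 ℕ.+ m ∸ b))
    back-step a b e = trans (cong s (∸≡ e)) (trans
      (trans (sym (⊕-undo (s a) (off (d a)))) (cong₂ _⊕_ (sym (step (subst (a ℕ.<_) (cong suc e) (ℕ.s≤s (ℕ.m≤m+n a b))))) (opp-off (d a))))
      (cong₂ move (sym (d′≡ a b e)) (cong s (sym (∸≡ (cong suc e))))))

    back-noReversal : ∀ a b → a ℕ.+ b ≡ m → NoReversal (d′ b) (d′ (suc b))
    back-noReversal a b e rev = noReversal (subst (suc a ℕ.<_) (cong (2 ℕ.+_) e) (ℕ.s≤s (ℕ.s≤s (ℕ.m≤m+n a b)))) (begin
      d (suc a)              ≡⟨ opp-involutive _ ⟨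
      opp (opp (d (suc a)))  ≡⟨ cong opp (d′≡ (suc a) b (cong suc e)) ⟨
      opp (d′ b)             ≡⟨ rev ⟨
      d′ (suc b)             ≡⟨ d′≡ a (suc b) (trans (ℕ.+-suc a b) (cong suc e)) ⟩
      opp (d a)              ∎)
      where open ≡-Reasoning

    back-staircase : ∀ a b → a ℕ.+ (3 ℕ.+ b) ≡ suc m → Staircase (d′ b) (d′ (suc b)) (d′ (2 ℕ.+ b)) (d′ (3 ℕ.+ b))
    back-staircase a b e
      rewrite d′≡ (3 ℕ.+ a) b (shift (2 ℕ.+ a) (shift (suc a) (shift a e)))
            | d′≡ (2 ℕ.+ a) (suc b) (shift (suc a) (shift a e))
            | d′≡ (suc a) (2 ℕ.+ b) (shift a e)
            | d′≡ a (3 ℕ.+ b) e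
      = staircase-opp (d a) (d (suc a)) (d (2 ℕ.+ a)) (d (3 ℕ.+ a))
          (staircase (ℕ.s≤s (subst (3 ℕ.+ a ℕ.≤_) (shift (2 ℕ.+ a) (shift (suc a) (shift a e))) (ℕ.m≤m+n (3 ℕ.+ a) b))))

    back-turn : ∀ a b → a ℕ.+ b ≡ m → turn (d′ b) (d′ (suc b)) ≡ τ a
    back-turn a b e rewrite d′≡ (suc a) b (cong suc e) | d′≡ a (suc b) (trans (ℕ.+-suc a b) (cong suc e)) = turn-opp (d a) (d (suc a))

    back-alternating : ∀ a b → a ℕ.+ suc b ≡ m → turn (d′ (suc b)) (d′ (2 ℕ.+ b)) ≡ not (turn (d′ b) (d′ (suc b)))
    back-alternating a b e rewrite back-turn a (suc b) e | back-turn (suc a) b (shift a e) =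
      trans (sym (not-involutive (τ a))) (cong not (sym (alternating (subst (suc a ℕ.≤_) (shift a e) (ℕ.m≤m+n (suc a) b)))))

  -- The model staircase: segments of length 3 that run alternately east and north.
  axes : ℕ → Dir
  axes 0 = E
  axes 1 = E
  axes 2 = N
  axes 3 = N
  axes (suc (suc (suc (suc j)))) = axes j

  path : ℕ → Cell
  path zero    = origin
  path (suc j) = move (axes j) (path j)

  opaque
    pathCells : ℕ → List Cell
    pathCells n = applyUpTo path n

    ∈-pathCells⁺ : ∀ {n k} → k ℕ.< n → path k ∈ pathCells n
    ∈-pathCells⁺ = ∈-applyUpTo⁺ path

    ∈-pathCells⁻ : ∀ {n c} → c ∈ pathCells n → ∃ λ k → k ℕ.< n × c ≡ path k
    ∈-pathCells⁻ = ∈-applyUpTo⁻ path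

  module _ {m s} (z : Zigzag m s) (τ₀ : Zigzag.τ z 0 ≡ false) where
    open Zigzag z

    straight-at : ∀ {j} → j ℕ.≤ m → odd j ≡ false → d j ≡ d (suc j)
    straight-at j≤m e = ¬turn⇒≡ (trans (alternating-odd τ₀ j≤m) e)

    turn-at : ∀ {j} → j ℕ.≤ m → odd j ≡ true → d j ≢ d (suc j)
    turn-at j≤m e = turn⇒≢ (trans (alternating-odd τ₀ j≤m) e)

    -- For odd `j` the staircase condition from step `j` on gives `d (3 ℕ.+ j) ≡ d j`, and step
    -- `4 ℕ.+ j` repeats step `3 ℕ.+ j`. For even `j` it is applied one step later, and `d (suc j)`
    -- equals `d j`.
    periodic : ∀ {j} → 3 ℕ.+ j ℕ.≤ m → d (4 ℕ.+ j) ≡ d j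
    periodic {j} 3+j≤m with odd j in eq
    ... | true  = trans (sym (straight-at 3+j≤m (cong (not ∘ not ∘ not) eq)))
      (staircase (ℕ.m≤n⇒m≤1+n (ℕ.s≤s 3+j≤m)) (turn-at (ℕ.<⇒≤ (ℕ.<⇒≤ (ℕ.<⇒≤ 3+j≤m))) eq)
        (straight-at (ℕ.<⇒≤ (ℕ.<⇒≤ 3+j≤m)) (cong not eq)) (turn-at (ℕ.<⇒≤ 3+j≤m) (cong (not ∘ not) eq)))
    ... | false = trans (staircase (ℕ.s≤s (ℕ.s≤s 3+j≤m)) (turn-at (ℕ.<⇒≤ (ℕ.<⇒≤ 3+j≤m)) (cong not eq))
        (straight-at (ℕ.<⇒≤ 3+j≤m) (cong (not ∘ not) eq)) (turn-at 3+j≤m (cong (not ∘ not ∘ not) eq)))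
      (sym (straight-at (ℕ.<⇒≤ (ℕ.<⇒≤ (ℕ.<⇒≤ 3+j≤m))) eq))

    private
      first-straight : d 1 ≡ d 0
      first-straight = sym (straight-at ℕ.z≤n refl)

      second : ∀ k → k ≡ m → ∃ λ v → v ≢ d 0 × v ≢ opp (d 0) × (1 ℕ.≤ m → d 2 ≡ v)
      -- Three squares in line determine no second direction; a perpendicular one is chosen
      -- arbitrarily.
      second zero    refl = perpendicular (d 0) , proj₁ (perpendicular-≢ (d 0)) , proj₂ (perpendicular-≢ (d 0)) , λ ()
      second (suc k) refl = d 2
        , (λ e → turn-at (ℕ.s≤s ℕ.z≤n) refl (trans first-straight (sym e)))
        , (λ e → noReversal (ℕ.s≤s (ℕ.s≤s (ℕ.s≤s ℕ.z≤n))) (trans e (cong opp (sym first-straight)))) , λ _ → refl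

    opaque
      to-axes-path : ∃ λ i → ∀ {j} → j ℕ.≤ suc m → Isometry.ρ i (d j) ≡ axes j
      to-axes-path =
        let v , v≢ , v≢opp , d₂ = second m refl
            i , ρu , ρv = to-axes (d 0) v v≢ v≢opp
        in i , λ {j} → aligned i ρu (λ 1≤m → trans (cong (Isometry.ρ i) (d₂ 1≤m)) ρv) {j}
        where
        aligned : ∀ i → Isometry.ρ i (d 0) ≡ E → (1 ℕ.≤ m → Isometry.ρ i (d 2) ≡ N) → ∀ {j} → j ℕ.≤ suc m → Isometry.ρ i (d j) ≡ axes j
        aligned i ρ₀ ρ₂ {0} _ = ρ₀
        aligned i ρ₀ ρ₂ {1} _ = trans (cong (Isometry.ρ i) first-straight) ρ₀
        aligned i ρ₀ ρ₂ {2} 2≤ = ρ₂ (ℕ.s≤s⁻¹ 2≤)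
        aligned i ρ₀ ρ₂ {3} 3≤ = trans (cong (Isometry.ρ i) (sym (straight-at (ℕ.s≤s⁻¹ 3≤) refl))) (ρ₂ (ℕ.<⇒≤ (ℕ.s≤s⁻¹ 3≤)))
        aligned i ρ₀ ρ₂ {suc (suc (suc (suc j)))} 4+j≤ = trans (cong (Isometry.ρ i) (periodic (ℕ.s≤s⁻¹ 4+j≤)))
          (aligned i ρ₀ ρ₂ {j} (ℕ.≤-trans (ℕ.m≤n+m j 4) 4+j≤))

      to-path : ∃ λ i → ∀ {j} → j ℕ.≤ 2 ℕ.+ m → Isometry.F i (s j) ≡ path j
      to-path =
        let i , aligned = to-axes-path
            i′ = i ⟫ translate (neg (Isometry.F i (s 0)))
        in i′ , λ {j} → along i′ aligned (⊕-neg (Isometry.F i (s 0))) {j}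
        where
        along : ∀ i → (∀ {j} → j ℕ.≤ suc m → Isometry.ρ i (d j) ≡ axes j) → Isometry.F i (s 0) ≡ origin →
                ∀ {j} → j ℕ.≤ 2 ℕ.+ m → Isometry.F i (s j) ≡ path j
        along i aligned start {zero} _ = start
        along i aligned start {suc j} j< = trans (cong (Isometry.F i) (step j<))
          (trans (Isometry.F-move i (d j) (s j)) (cong₂ move (aligned (ℕ.s≤s⁻¹ j<)) (along i aligned start (ℕ.<⇒≤ j<))))

    path-≅ : ∀ {cs} → (∀ {c} → c ∈ cs → ∃ λ k → k ℕ.≤ 2 ℕ.+ m × c ≡ s k) → (∀ {k} → k ℕ.≤ 2 ℕ.+ m → s k ∈ cs) →
             graph cs ≅ graph (pathCells (3 ℕ.+ m))
    path-≅ {cs} sound complete = isometry-≅ i into onto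
      where
      i : Isometry
      i = proj₁ to-path
      into : ∀ {c} → c ∈ cs → Isometry.F i c ∈ pathCells (3 ℕ.+ m)
      into c∈ = let k , k≤ , c≡ = sound c∈ in
        subst (_∈ pathCells (3 ℕ.+ m)) (sym (trans (cong (Isometry.F i) c≡) (proj₂ to-path k≤))) (∈-pathCells⁺ (ℕ.s≤s k≤))
      onto : ∀ {c} → c ∈ pathCells (3 ℕ.+ m) → ∃ λ c′ → c′ ∈ cs × c ≡ Isometry.F i c′
      onto c∈ = let k , k< , c≡ = ∈-pathCells⁻ c∈ in
        s k , complete (ℕ.s≤s⁻¹ k<) , trans c≡ (sym (proj₂ to-path (ℕ.s≤s⁻¹ k<)))

-- Real powers and the signs of F and F - E

module RealPowers where

  module RealProperties {c ℓ₁ ℓ₂ : Level} (R : RealNumbers c ℓ₁ ℓ₂) where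

    open RealNumbers R
    open IsStrictPartialOrder isStrictPartialOrder public
      using (<-respʳ-≈; <-respˡ-≈) renaming (trans to <-trans; irrefl to <-irrefl)
    open CommutativeRing commutativeRing using (ring; semiring; commutativeSemiring)
    open Mult semiring using (×-homo-+; ×1-homo-*)
    open RingProperties ring using (-‿involutive; +-cancelʳ)
    open NaturalSolver commutativeSemiring
    open import Relation.Binary.Reasoning.Setoid setoid

    numeral : ∀ {k} → ℕ → Polynomial k
    numeral zero    = con 0
    numeral (suc n) = con 1 :+ numeral n

    ≡⇒≈ : ∀ {x y} → x ≡.≡ y → x ≈ y
    ≡⇒≈ ≡.refl = refl

    <-resp₂ : ∀ {x x′ y y′} → x ≈ x′ → y ≈ y′ → x < y → x′ < y′
    <-resp₂ p q = <-respˡ-≈ p ∘ <-respʳ-≈ q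

    <⇒≉ : ∀ {x y} → x < y → ¬ (x ≈ y)
    <⇒≉ x<y x≈y = <-irrefl x≈y x<y

    <⇒≤ : ∀ {x y} → x < y → x ≤ y
    <⇒≤ x<y y<x = <-irrefl refl (<-trans x<y y<x)

    ≈⇒≤ : ∀ {x y} → x ≈ y → x ≤ y
    ≈⇒≤ x≈y = <-irrefl (sym x≈y)

    ≮∧≯⇒≈ : ∀ {x y} → ¬ (x < y) → ¬ (y < x) → x ≈ y
    ≮∧≯⇒≈ {x} {y} x≮y y≮x =
      proj₁ (tight x y) ([ x≮y , y≮x ]′ ∘ Equivalence.to (#⇔<⊎> x y))

    -- Takes the place of trichotomy, which the axioms do not give; the case split in `f+g<0` rests
    -- on it.
    <-cotrans : ∀ {x y} → x < y → ∀ z → x < z ⊎ z < y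
    <-cotrans {x} {y} x<y z with #-cotrans (Equivalence.from (#⇔<⊎> x y) (inj₁ x<y)) z
    ... | inj₁ x#z with Equivalence.to (#⇔<⊎> x z) x#z
    ...   | inj₁ x<z = inj₁ x<z
    ...   | inj₂ z<x = inj₂ (<-trans z<x x<y)
    <-cotrans {x} {y} x<y z | inj₂ z#y with Equivalence.to (#⇔<⊎> z y) z#y
    ...   | inj₁ z<y = inj₂ z<y
    ...   | inj₂ y<z = inj₁ (<-trans x<y y<z)

    +-monoʳ-< : ∀ z {x y} → x < y → z + x < z + y
    +-monoʳ-< z = <-resp₂ (+-comm _ z) (+-comm _ z) ∘ +-monoˡ-< z

    +-mono-< : ∀ {x y u v} → x < y → u < v → x + u < y + v
    +-mono-< x<y u<v = <-trans (+-monoˡ-< _ x<y) (+-monoʳ-< _ u<v)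

    +-cancelʳ-< : ∀ z {x y} → x + z < y + z → x < y
    +-cancelʳ-< z = <-resp₂ (undo _) (undo _) ∘ +-monoˡ-< (- z)
      where
      undo : ∀ x → x + z + - z ≈ x
      undo x = trans (+-assoc _ _ _) (trans (+-congˡ (-‿inverseʳ z)) (+-identityʳ x))

    0<x+y : ∀ {x y} → 0# < x → 0# < y → 0# < x + y
    0<x+y 0<x 0<y = <-respˡ-≈ (+-identityʳ 0#) (+-mono-< 0<x 0<y)

    x<x+y : ∀ x {y} → 0# < y → x < x + y
    x<x+y x 0<y = <-respˡ-≈ (+-identityʳ x) (+-monoʳ-< x 0<y)

    difference : ∀ {x y} → x < y → ∃ λ h → 0# < h × y ≈ x + h
    difference {x} {y} x<y = y + - x , <-respˡ-≈ (-‿inverseʳ x) (+-monoˡ-< (- x) x<y) , (begin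
      y              ≈⟨ +-identityʳ y ⟨
      y + 0#         ≈⟨ +-congˡ (-‿inverseˡ x) ⟨
      y + (- x + x)  ≈⟨ +-assoc _ _ _ ⟨
      y + - x + x    ≈⟨ +-comm _ _ ⟩
      x + (y + - x)  ∎)

    *-monoˡ-< : ∀ {z x y} → 0# < z → x < y → z * x < z * y
    *-monoˡ-< {z} {x} 0<z x<y with difference x<y
    ... | h , 0<h , y≈x+h = <-respʳ-≈
      (trans (sym (distribˡ z x h)) (*-congˡ (sym y≈x+h))) (x<x+y (z * x) (*-pos 0<z 0<h))

    *-cancelˡ-≈ : ∀ {z x y} → 0# < z → z * x ≈ z * y → x ≈ y
    *-cancelˡ-≈ 0<z e = ≮∧≯⇒≈ (λ l → <-irrefl e (*-monoˡ-< 0<z l))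
                              (λ l → <-irrefl (sym e) (*-monoˡ-< 0<z l))

    x+x-cancel-≈ : ∀ {x y} → x + x ≈ y + y → x ≈ y
    x+x-cancel-≈ e = ≮∧≯⇒≈ (λ l → <-irrefl e (+-mono-< l l)) (λ l → <-irrefl (sym e) (+-mono-< l l))

    pow : Positive → Carrier → Carrier
    pow a x = value (a ^ x)

    pow-pos : ∀ a x → 0# < pow a x
    pow-pos a x = proj₂ (a ^ x)

    pow-0 : ∀ a → pow a 0# ≈ 1#
    pow-0 a = *-cancelˡ-≈ (pow-pos a 1#) (begin
      pow a 1# * pow a 0#  ≈⟨ ^-distribˡ-+ a 1# 0# ⟨
      pow a (1# + 0#)      ≈⟨ ^-congʳ a (+-identityʳ 1#) ⟩
      pow a 1#             ≈⟨ *-identityʳ _ ⟨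
      pow a 1# * 1#        ∎)

    inverse : Positive → Positive
    inverse a = a ^ - 1#

    *-inverse : ∀ a → value (inverse a) * value a ≈ 1#
    *-inverse a = begin
      value (inverse a) * value a    ≈⟨ *-congˡ (^-identityʳ a) ⟨
      pow a (- 1#) * pow a 1#        ≈⟨ ^-distribˡ-+ a (- 1#) 1# ⟨
      pow a (- 1# + 1#)              ≈⟨ ^-congʳ a (-‿inverseˡ 1#) ⟩
      pow a 0#                       ≈⟨ pow-0 a ⟩
      1#                             ∎

    *-cancelˡ-< : ∀ {z x y} → 0# < z → z * x < z * y → x < y
    *-cancelˡ-< {z} 0<z = <-resp₂ (undo _) (undo _) ∘ *-monoˡ-< (proj₂ (inverse (z , 0<z)))
      where
      undo : ∀ x → value (inverse (z , 0<z)) * (z * x) ≈ x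
      undo x = trans (sym (*-assoc _ _ _)) (trans (*-congʳ (*-inverse (z , 0<z))) (*-identityˡ x))

    -- The power of b is that of a times that of b/a. Since b/a > 1, monotonicity in the exponent
    -- puts the second factor below (b/a)^0 = 1.
    pow-antimonoˡ-< : ∀ a b {x} → value a < value b → x < 0# → pow b x < pow a x
    pow-antimonoˡ-< a b {x} a<b x<0 = <-resp₂ (sym (^-distribʳ-* a b/a b x b≈a*b/a)) (*-identityʳ _)
      (*-monoˡ-< (pow-pos a x) (<-respʳ-≈ (pow-0 b/a) (^-monoʳ-< b/a 1<b/a x<0)))
      where
      b/a : Positive
      b/a = value (inverse a) * value b , *-pos (proj₂ (inverse a)) (proj₂ b)
      b≈a*b/a : value b ≈ value a * value b/a
      b≈a*b/a = sym (trans (sym (*-assoc _ _ _))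
        (trans (*-congʳ (trans (*-comm _ _) (*-inverse a))) (*-identityˡ _)))
      1<b/a : 1# < value b/a
      1<b/a = <-respˡ-≈ (*-inverse a) (*-monoˡ-< (proj₂ (inverse a)) a<b)

    fromℕ-+ : ∀ m n → fromℕ (m ℕ.+ n) ≈ fromℕ m + fromℕ n
    fromℕ-+ = ×-homo-+ 1#

    fromℕ-* : ∀ m n → fromℕ (m ℕ.* n) ≈ fromℕ m * fromℕ n
    fromℕ-* = ×1-homo-*

    fromℕ-< : ∀ {m n} → m ℕ.< n → fromℕ m < fromℕ n
    fromℕ-< {m} m<n with ℕ.m≤n⇒∃[o]m+o≡n m<n
    ... | o , ≡.refl = <-respʳ-≈ (trans (sym (fromℕ-+ m (suc o))) (≡⇒≈ (≡.cong fromℕ (ℕ.+-suc m o))))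
      (x<x+y (fromℕ m) (fromℕ-pos o))

    infixr 8 _·_
    _·_ : ℕ → Carrier → Carrier
    n · x = fromℕ n * x

    1·x≈x : ∀ x → 1 · x ≈ x
    1·x≈x x = trans (*-congʳ (+-identityʳ 1#)) (*-identityˡ x)

    ·-assoc : ∀ m n x → m · n · x ≈ (m ℕ.* n) · x
    ·-assoc m n x = trans (sym (*-assoc _ _ _)) (*-congʳ (sym (fromℕ-* m n)))

    ·-monoʳ-< : ∀ n {x y} → x < y → suc n · x < suc n · y
    ·-monoʳ-< n = *-monoˡ-< (fromℕ-pos n)

    ·-monoˡ-< : ∀ {m n x} → 0# < x → m ℕ.< n → m · x < n · x
    ·-monoˡ-< 0<x m<n = <-resp₂ (*-comm _ _) (*-comm _ _) (*-monoˡ-< 0<x (fromℕ-< m<n))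

    -- The inequality bounds x / y by b / suc a, and the numerical condition says that this fraction
    -- is below d / suc c.
    rescale : ∀ {a b x y} c d → 0# < y → suc a · x < b · y →
              suc c ℕ.* b ℕ.< suc a ℕ.* d → suc c · x < d · y
    rescale {a} {b} {x} {y} c d 0<y ax<by cb<ad = *-cancelˡ-< (fromℕ-pos a) (<-trans
      (<-resp₂ (trans (·-assoc (suc c) (suc a) x) (trans (≡⇒≈ (≡.cong (_· x) (ℕ.*-comm (suc c) (suc a))))
                                                          (sym (·-assoc (suc a) (suc c) x))))
               (·-assoc (suc c) b y) (·-monoʳ-< c ax<by))
      (<-respʳ-≈ (sym (·-assoc (suc a) d y)) (·-monoˡ-< 0<y cb<ad)))

    base : ℕ → Positive
    base n = fromℕ (suc n) , fromℕ-pos n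

    pow-+-fromℕ : ∀ n k x → pow (base n) (x + fromℕ k) ≈ (suc n ℕ.^ k) · pow (base n) x
    pow-+-fromℕ n zero x = begin
      pow (base n) (x + 0#)    ≈⟨ ^-congʳ (base n) (+-identityʳ x) ⟩
      pow (base n) x           ≈⟨ *-identityˡ _ ⟨
      1# * pow (base n) x      ≈⟨ *-congʳ (+-identityʳ 1#) ⟨
      1 · pow (base n) x       ∎
    pow-+-fromℕ n (suc k) x = begin
      pow (base n) (x + (1# + fromℕ k))              ≈⟨ ^-congʳ (base n) (solve 3 (λ x y z → x :+ (y :+ z) := y :+ (x :+ z)) refl x 1# (fromℕ k)) ⟩
      pow (base n) (1# + (x + fromℕ k))              ≈⟨ ^-distribˡ-+ (base n) 1# _ ⟩
      pow (base n) 1# * pow (base n) (x + fromℕ k)   ≈⟨ *-cong (^-identityʳ (base n)) (pow-+-fromℕ n k x) ⟩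
      suc n · (suc n ℕ.^ k) · pow (base n) x         ≈⟨ ·-assoc (suc n) (suc n ℕ.^ k) _ ⟩
      (suc n ℕ.^ suc k) · pow (base n) x             ∎

    -- Antimonotonicity in the base at the exponent `x + fromℕ k`, with the integral part split off
    -- afterwards.
    pow-ratio-< : ∀ {m n} k {x} → m ℕ.< n → x + fromℕ k < 0# →
                  (suc n ℕ.^ k) · pow (base n) x < (suc m ℕ.^ k) · pow (base m) x
    pow-ratio-< {m} {n} k {x} m<n x+k<0 = <-resp₂ (pow-+-fromℕ n k x) (pow-+-fromℕ m k x)
      (pow-antimonoˡ-< (base m) (base n) (fromℕ-< (ℕ.s<s m<n)) x+k<0)

    base-antimono-< : ∀ m n {x} → m ℕ.< n → x < 0# → pow (base n) x < pow (base m) x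
    base-antimono-< m n m<n = pow-antimonoˡ-< (base m) (base n) (fromℕ-< (ℕ.s<s m<n))

    -- Midpoint convexity of a ↦ aᵟ at 5, 6, 7: it follows from 5·7 < 6·6.
    module _ {δ} (δ<0 : δ < 0#) where
      private
        U V W : Carrier
        U = 5 ^ℕ δ
        V = 6 ^ℕ δ
        W = 7 ^ℕ δ

      6^<5^ : V < U
      6^<5^ = base-antimono-< 4 5 ℕ.≤-refl δ<0

      7^<6^ : W < V
      7^<6^ = base-antimono-< 5 6 ℕ.≤-refl δ<0

      6^²<5^*7^ : V * V < U * W
      6^²<5^*7^ = <-resp₂ (^-distribʳ-* (base 5) (base 5) (base 35) δ (fromℕ-* 6 6))
                          (^-distribʳ-* (base 4) (base 6) (base 34) δ (fromℕ-* 5 7))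
                          (base-antimono-< 34 35 ℕ.≤-refl δ<0)

      6^+6^<5^+7^ : V + V < U + W
      6^+6^<5^+7^ =
        let h , 0<h , V≈W+h = difference 7^<6^ in
        -- `base 6` is the number 7, so W is cancelled. With V = W + h one has 2VW < 2VW + h² = V² +
        -- W² < UW + W².
        *-cancelˡ-< (pow-pos (base 6) δ) (<-trans
          (<-resp₂ (*-congˡ (+-cong (sym V≈W+h) (sym V≈W+h)))
            (trans (solve 2 (λ W h → W :* ((W :+ h) :+ (W :+ h)) :+ h :* h := (W :+ h) :* (W :+ h) :+ W :* W) refl W h)
                   (+-congʳ (*-cong (sym V≈W+h) (sym V≈W+h))))
            (x<x+y _ (*-pos 0<h 0<h)))
          (<-respʳ-≈ (solve 2 (λ U W → U :* W :+ W :* W := W :* (U :+ W)) refl U W)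
            (+-monoˡ-< (W * W) 6^²<5^*7^)))

    -- By midpoint convexity the drop k from 6^δ to 7^δ is smaller than the drop h from 5^δ to 6^δ;
    -- with q < p this gives q·k < p·h.
    weighted-convexity : ∀ {p q δ} → δ < 0# → 0# < q → q < p →
                         (p + q) * 6 ^ℕ δ < p * 5 ^ℕ δ + q * 7 ^ℕ δ
    weighted-convexity {p} {q} {δ} δ<0 0<q q<p =
      let h , 0<h , U≈V+h = difference (6^<5^ δ<0)
          k , 0<k , V≈W+k = difference (7^<6^ δ<0)
          k<h = +-cancelʳ-< (V + W) (<-resp₂
            (trans (+-congˡ V≈W+k) (solve 3 (λ V W k → V :+ (W :+ k) := k :+ (V :+ W)) refl V W k))
            (trans (+-congʳ U≈V+h) (solve 3 (λ V W h → (V :+ h) :+ W := h :+ (V :+ W)) refl V W h))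
            (6^+6^<5^+7^ δ<0))
      in <-resp₂
        (trans (solve 5 (λ p q V W k → (p :* V :+ q :* W) :+ q :* k := p :* V :+ q :* (W :+ k)) refl p q V W k)
               (trans (+-congˡ (*-congˡ (sym V≈W+k))) (sym (distribʳ V p q))))
        (trans (solve 5 (λ p q V W h → (p :* V :+ q :* W) :+ p :* h := p :* (V :+ h) :+ q :* W) refl p q V W h)
               (+-congʳ (*-congˡ (sym U≈V+h))))
        (+-monoʳ-< (p * V + q * W) (<-trans (*-monoˡ-< 0<q k<h) (<-resp₂ (*-comm h q) (*-comm h p) (*-monoˡ-< 0<h q<p))))
      where
      V W : Carrier
      V = 6 ^ℕ δ
      W = 7 ^ℕ δ

    -- The approximation says (d + 1)·x + m < 1, and m exceeds k·(d + 1) + 1; hence (d + 1)·(x + k)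
    -- < 0.
    -‿bound : ∀ {x} m d k → x ≈-[ m / suc d ] → suc (k ℕ.* suc d) ℕ.< m → x + fromℕ k < 0#
    -‿bound {x} m d k (_ , dx+m<1) kd<m = *-cancelˡ-< (fromℕ-pos d) (+-cancelʳ-< 1# (<-trans
      (<-respˡ-≈
        (trans (+-congˡ (+-congˡ (fromℕ-* k (suc d))))
          (solve 4 (λ d x k o → d :* x :+ (o :+ k :* d) := d :* (x :+ k) :+ o) refl (fromℕ (suc d)) x (fromℕ k) 1#))
        (+-monoʳ-< (fromℕ (suc d) * x) (fromℕ-< kd<m)))
      (<-resp₂ (+-congˡ (-‿involutive (fromℕ m)))
        (solve 2 (λ d o → o := d :* con 0 :+ o) refl (fromℕ (suc d)) 1#) dx+m<1)))

    cancel-negative : ∀ {x y z} → x - y + z ≈ 0# → x + z ≈ y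
    cancel-negative {x} {y} {z} e = begin
      x + z              ≈⟨ +-identityʳ _ ⟨
      x + z + 0#         ≈⟨ +-congˡ (-‿inverseˡ y) ⟨
      x + z + (- y + y)  ≈⟨ solve 4 (λ x y y′ z → (x :+ z) :+ (y′ :+ y) := ((x :+ y′) :+ z) :+ y) refl x y (- y) z ⟩
      x - y + z + y      ≈⟨ +-congʳ e ⟩
      0# + y             ≈⟨ +-identityˡ y ⟩
      y                  ∎

    open SumConnectivity R using (f; g)

    6^suc : ∀ x → 6 ^ℕ (x + 1#) ≈ 6 · 6 ^ℕ x
    6^suc x = trans (^-distribˡ-+ (base 5) x 1#) (trans (*-congˡ (^-identityʳ (base 5))) (*-comm _ _))

    f-root : ∀ {x} → f x ≈ 0# → 5 ^ℕ x + 2 · 7 ^ℕ x ≈ 3 · 6 ^ℕ x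
    f-root {x} fx≈0 = x+x-cancel-≈ (begin
      (p + 2 · r) + (p + 2 · r)  ≈⟨ solve 2 (λ p r → (p :+ numeral 2 :* r) :+ (p :+ numeral 2 :* r) := numeral 2 :* p :+ numeral 4 :* r) refl p r ⟩
      2 · p + 4 · r              ≈⟨ cancel-negative fx≈0 ⟩
      6 ^ℕ (x + 1#)              ≈⟨ 6^suc x ⟩
      6 · q                      ≈⟨ solve 1 (λ q → numeral 6 :* q := numeral 3 :* q :+ numeral 3 :* q) refl q ⟩
      3 · q + 3 · q              ∎)
      where
      p q r : Carrier
      p = 5 ^ℕ x
      q = 6 ^ℕ x
      r = 7 ^ℕ x

    f+g-root : ∀ {x} → f x + g x ≈ 0# → 5 ^ℕ x + 3 · 7 ^ℕ x ≈ 4 · 6 ^ℕ x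
    f+g-root {x} e = +-cancelʳ (p + r + 2 · q) _ _ (begin
      (p + 3 · r) + (p + r + 2 · q)
        ≈⟨ solve 3 (λ p q r → (p :+ numeral 3 :* r) :+ (p :+ r :+ numeral 2 :* q) := numeral 2 :* p :+ numeral 4 :* r :+ numeral 2 :* q) refl p q r ⟩
      2 · p + 4 · r + 2 · q
        -- The solver knows semirings only, so the terms that `f` and `g` subtract are put back as
        -- zeros of the form - y + y.
        ≈⟨ solve 3 (λ a b c → a :+ b :+ c := a :+ b :+ c :+ (con 0 :+ con 0 :+ con 0)) refl (2 · p) (4 · r) (2 · q) ⟩
      2 · p + 4 · r + 2 · q + (0# + 0# + 0#)
        ≈⟨ +-congˡ (+-cong (+-cong (-‿inverseˡ y) (-‿inverseˡ p)) (-‿inverseˡ r)) ⟨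
      2 · p + 4 · r + 2 · q + ((- y + y) + (- p + p) + (- r + r))
        ≈⟨ solve 9 (λ a b c y p r y′ p′ r′ → a :+ b :+ c :+ ((y′ :+ y) :+ (p′ :+ p) :+ (r′ :+ r))
                                          := ((a :+ y′ :+ b) :+ (c :+ p′ :+ r′)) :+ (y :+ p :+ r))
             refl (2 · p) (4 · r) (2 · q) y p r (- y) (- p) (- r) ⟩
      f x + g x + (y + p + r)
        ≈⟨ +-cong e (+-congʳ (+-congʳ (6^suc x))) ⟩
      0# + (6 · q + p + r)
        ≈⟨ solve 3 (λ p q r → con 0 :+ (numeral 6 :* q :+ p :+ r) := numeral 4 :* q :+ (p :+ r :+ numeral 2 :* q)) refl p q r ⟩
      4 · q + (p + r + 2 · q)
        ∎)
      where
      p q r y : Carrier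
      y = 6 ^ℕ (x + 1#)
      p = 5 ^ℕ x
      q = 6 ^ℕ x
      r = 7 ^ℕ x

    pow-shift : ∀ n x y → pow (base n) x * pow (base n) (y - x) ≈ pow (base n) y
    pow-shift n x y = trans (sym (^-distribˡ-+ (base n) x (y - x))) (^-congʳ (base n)
      (trans (+-comm _ _) (trans (+-assoc _ _ _) (trans (+-congˡ (-‿inverseˡ x)) (+-identityʳ y)))))

    -- Weighted convexity with the weights 5^x and (k + 1)·7^x and the exponent y - x. When x is a
    -- root, the sum of the weights is (k + 2)·6^x, so the inequality becomes the sign at y of the
    -- expression that vanishes at x.
    tangent-< : ∀ {x y} k → y < x → suc k · 7 ^ℕ x < 5 ^ℕ x →
                (5 ^ℕ x + suc k · 7 ^ℕ x) * 6 ^ℕ (y - x) < 5 ^ℕ y + suc k · 7 ^ℕ y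
    tangent-< {x} {y} k y<x 7<5 = <-respʳ-≈
      (+-cong (pow-shift 4 x y) (trans (*-assoc _ _ _) (*-congˡ (pow-shift 6 x y))))
      (weighted-convexity (<-respʳ-≈ (-‿inverseʳ x) (+-monoˡ-< (- x) y<x))
        (*-pos (fromℕ-pos k) (pow-pos (base 6) x)) 7<5)

    6^shift : ∀ k {x y} → k · 6 ^ℕ x * 6 ^ℕ (y - x) ≈ k · 6 ^ℕ y
    6^shift k {x} {y} = trans (*-assoc _ _ _) (*-congˡ (pow-shift 5 x y))

    -- The weights are in the required order: x₀ < -3 gives 5^x₀ > (343/125)·7^x₀, which exceeds
    -- 2·7^x₀.
    f>0 : ∀ {x₀ α} → f x₀ ≈ 0# → x₀ + fromℕ 3 < 0# → α < x₀ →
          3 · 6 ^ℕ α < 5 ^ℕ α + 2 · 7 ^ℕ α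
    f>0 {x₀} fx₀≈0 x₀+3<0 α<x₀ = <-respˡ-≈ (trans (*-congʳ (f-root fx₀≈0)) (6^shift 3))
      (tangent-< 1 α<x₀ (<-respʳ-≈ (1·x≈x _) (rescale {342} {125} 1 1 (pow-pos (base 4) x₀) (pow-ratio-< {4} {6} 3 (ℕ.<ᵇ⇒< _ _ tt) x₀+3<0) (ℕ.<ᵇ⇒< _ _ tt))))

    -- The factor 3 calls for the bound -4 instead of -3: 2401/625 exceeds 3, whereas 343/125 does
    -- not.
    f+g>0 : ∀ {x₁ α} → f x₁ + g x₁ ≈ 0# → x₁ + fromℕ 4 < 0# → α < x₁ →
            4 · 6 ^ℕ α < 5 ^ℕ α + 3 · 7 ^ℕ α
    f+g>0 {x₁} e x₁+4<0 α<x₁ = <-respˡ-≈ (trans (*-congʳ (f+g-root e)) (6^shift 4))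
      (tangent-< 2 α<x₁ (<-respʳ-≈ (1·x≈x _) (rescale {2400} {625} 2 1 (pow-pos (base 4) x₁) (pow-ratio-< {4} {6} 4 (ℕ.<ᵇ⇒< _ _ tt) x₁+4<0) (ℕ.<ᵇ⇒< _ _ tt))))

    -- If 3·7^α < 5^α, convexity applies with α and x₁ exchanged.  Otherwise 5^α < (16/5)·7^α, and α < −3 suffices,
    -- since (31/5)·(6/7)³ < 4.
    f+g<0 : ∀ {x₁ α} → f x₁ + g x₁ ≈ 0# → x₁ < α → α + fromℕ 3 < 0# →
            5 ^ℕ α + 3 · 7 ^ℕ α < 4 · 6 ^ℕ α
    f+g<0 {x₁} {α} e x₁<α α+3<0 =
      [ steep , flat ]′ (<-cotrans (·-monoˡ-< {15} {16} (pow-pos (base 6) α) ℕ.≤-refl) (5 · p))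
      where
      p r : Carrier
      p = 5 ^ℕ α
      r = 7 ^ℕ α
      steep : 15 · r < 5 · p → p + 3 · r < 4 · 6 ^ℕ α
      steep 15r<5p = *-cancelˡ-< (pow-pos (base 5) (x₁ - α))
        (<-resp₂ (*-comm _ _) (trans (trans (f+g-root e) (sym (6^shift 4))) (*-comm _ _))
          (tangent-< 2 x₁<α (*-cancelˡ-< (fromℕ-pos 4) (<-respˡ-≈ (sym (·-assoc 5 3 r)) 15r<5p))))
      flat : 5 · p < 16 · r → p + 3 · r < 4 · 6 ^ℕ α
      flat 5p<16r = *-cancelˡ-< (fromℕ-pos 4) (<-trans
        (<-resp₂ (trans (+-congˡ (sym (·-assoc 5 3 r))) (sym (distribˡ _ p (3 · r))))
                 (trans (sym (distribʳ r (fromℕ 16) (fromℕ 15))) (*-congʳ (sym (fromℕ-+ 16 15))))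
          (+-monoˡ-< (15 · r) 5p<16r))
        (<-respʳ-≈ (sym (·-assoc 5 4 _))
          (rescale {342} {216} 30 20 (pow-pos (base 5) α) (pow-ratio-< {5} 3 ℕ.≤-refl α+3<0) (ℕ.<ᵇ⇒< _ _ tt))))

-- The deficit formula

module Deficit where
  open RealPowers
  open Windows using (toℕᵇ)
  open Index
  open Counting

  module _ {c ℓ₁ ℓ₂ : Level} (R : RealNumbers c ℓ₁ ℓ₂) where
    open RealNumbers R
    open RealProperties R
    open CommutativeRing commutativeRing using (commutativeSemiring; +-commutativeMonoid)
    open NaturalSolver commutativeSemiring
    open import Relation.Binary.Reasoning.Setoid setoid

    module DeficitFormula (P : ℕ → Carrier) {E F A : Carrier}
      (6≈7+E : P 6 ≈ P 7 + E)
      (straight : P 5 + (P 7 + P 7) ≈ (P 6 + (P 6 + P 6)) + F)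
      (turns    : P 5 + (P 7 + P 7) ≈ (P 6 + (P 6 + P 8)) + A)
      (τ : ℕ → Bool) where
      open ChainSum +-commutativeMonoid P
      open TailSum τ
      open Lists.Sums +-commutativeMonoid using (sum)

      -- `D` is the sum over a group with exactly one kink, and `end` the sum over an end of the
      -- chain whose last inner square is not a kink.
      D end : Carrier
      D = P 5 + (P 7 + P 7)
      end = P 4 + (P 5 + P 5) + (P 6 + P 6)

      endDeficit : Bool → Carrier
      endDeficit a = toℕᵇ a · E

      pairDeficit : Bool → Bool → Carrier
      pairDeficit a b = toℕᵇ (not a ∧ not b) · F + toℕᵇ (a ∧ b) · A

      deficit : ℕ → ℕ → Carrier
      deficit r j = count (bothStraight τ) r j · F + count (bothTurn τ) r j · A

      -- The last weight of a square is moved to the group of the following square. This regrouping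
      -- is what makes each group depend on only two consecutive values of `κ`.
      tail′ : ℕ → ℕ → Carrier
      tail′ r j = P (6 ℕ.+ after r (suc j) ∸ κ j) + tail r (suc j)

      pair-sum : ∀ a b → (P (6 ℕ.+ toℕᵇ b ∸ toℕᵇ a) + (P (6 ℕ.+ (toℕᵇ a ℕ.+ toℕᵇ b)) + P (6 ℕ.+ toℕᵇ a ∸ toℕᵇ b)))
                         + pairDeficit a b ≈ D
      pair-sum true  true  = trans (solve 4 (λ x y f a → (x :+ (y :+ x)) :+ (numeral 0 :* f :+ numeral 1 :* a) := (x :+ (x :+ y)) :+ a)
        refl (P 6) (P 8) F A) (sym turns)
      pair-sum true  false = solve 4 (λ x y f a → (x :+ (y :+ y)) :+ (numeral 0 :* f :+ numeral 0 :* a) := x :+ (y :+ y))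
        refl (P 5) (P 7) F A
      pair-sum false true  = solve 4 (λ x y f a → (y :+ (y :+ x)) :+ (numeral 0 :* f :+ numeral 0 :* a) := x :+ (y :+ y))
        refl (P 5) (P 7) F A
      pair-sum false false = trans (solve 3 (λ x f a → (x :+ (x :+ x)) :+ (numeral 1 :* f :+ numeral 0 :* a) := (x :+ (x :+ x)) :+ f)
        refl (P 6) F A) (sym straight)

      last-sum : ∀ a → (P (6 ∸ toℕᵇ a) + sum (map P (6 ℕ.+ toℕᵇ a ∷ 4 ∷ 5 ∷ 5 ℕ.+ toℕᵇ a ∷ []))) + ((0# * F + 0# * A) + endDeficit a)
                       ≈ 0# * D + end
      last-sum true = trans
        (solve 8 (λ p₄ p₅ p₆ p₇ e f a d → (p₅ :+ (p₇ :+ (p₄ :+ (p₅ :+ (p₆ :+ con 0))))) :+ ((con 0 :* f :+ con 0 :* a) :+ numeral 1 :* e)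
                                       := con 0 :* d :+ (p₄ :+ (p₅ :+ p₅) :+ (p₆ :+ (p₇ :+ e)))) refl (P 4) (P 5) (P 6) (P 7) E F A D)
        (+-congˡ (+-congˡ (+-congˡ (sym 6≈7+E))))
      last-sum false =
        solve 7 (λ p₄ p₅ p₆ e f a d → (p₆ :+ (p₆ :+ (p₄ :+ (p₅ :+ (p₅ :+ con 0))))) :+ ((con 0 :* f :+ con 0 :* a) :+ numeral 0 :* e)
                                   := con 0 :* d :+ (p₄ :+ (p₅ :+ p₅) :+ (p₆ :+ p₆))) refl (P 4) (P 5) (P 6) E F A D

      tail′-sum : ∀ r j → tail′ r j + (deficit r j + endDeficit (τ (r ℕ.+ j))) ≈ r · D + end
      tail′-sum zero    j = last-sum (τ j)
      tail′-sum (suc r) j = begin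
        (p₁ + ((p₂ + (p₃ + (x + 0#))) + t)) + ((fromℕ (f₁ ℕ.+ f₂) * F + fromℕ (a₁ ℕ.+ a₂) * A) + e)
          ≈⟨ +-congˡ (+-congʳ (+-cong (*-congʳ (fromℕ-+ f₁ f₂)) (*-congʳ (fromℕ-+ a₁ a₂)))) ⟩
        (p₁ + ((p₂ + (p₃ + (x + 0#))) + t)) + (((fromℕ f₁ + fromℕ f₂) * F + (fromℕ a₁ + fromℕ a₂) * A) + e)
          ≈⟨ +-cong (solve 5 (λ p₁ p₂ p₃ x t → p₁ :+ ((p₂ :+ (p₃ :+ (x :+ con 0))) :+ t) := (p₁ :+ (p₂ :+ p₃)) :+ (x :+ t)) refl p₁ p₂ p₃ x t)
               (+-congʳ (solve 6 (λ f₁ f₂ a₁ a₂ F A → (f₁ :+ f₂) :* F :+ (a₁ :+ a₂) :* A := (f₁ :* F :+ a₁ :* A) :+ (f₂ :* F :+ a₂ :* A))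
                 refl (fromℕ f₁) (fromℕ f₂) (fromℕ a₁) (fromℕ a₂) F A)) ⟩
        ((p₁ + (p₂ + p₃)) + (x + t)) + ((pairDeficit (τ j) (τ (suc j)) + deficit r (suc j)) + e)
          ≈⟨ solve 5 (λ p y q z e → (p :+ y) :+ ((q :+ z) :+ e) := (p :+ q) :+ (y :+ (z :+ e))) refl
               (p₁ + (p₂ + p₃)) (x + t) (pairDeficit (τ j) (τ (suc j))) (deficit r (suc j)) e ⟩
        ((p₁ + (p₂ + p₃)) + pairDeficit (τ j) (τ (suc j))) + (tail′ r (suc j) + (deficit r (suc j) + e))
          ≈⟨ +-cong (pair-sum (τ j) (τ (suc j))) (trans
               (+-congˡ (+-congˡ (≡⇒≈ (≡.cong (λ i → endDeficit (τ i)) (≡.sym (ℕ.+-suc r j)))))) (tail′-sum r (suc j))) ⟩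
        D + (r · D + end)
          ≈⟨ solve 3 (λ d r e → d :+ (r :* d :+ e) := (con 1 :+ r) :* d :+ e) refl D (fromℕ r) end ⟩
        suc r · D + end ∎
        where
        p₁ p₂ p₃ x t e : Carrier
        p₁ = P (6 ℕ.+ κ (suc j) ∸ κ j)
        p₂ = P (6 ℕ.+ (κ j ℕ.+ κ (suc j)))
        p₃ = P (6 ℕ.+ κ j ∸ κ (suc j))
        x = P (6 ℕ.+ after r (2 ℕ.+ j) ∸ κ (suc j))
        t = tail r (2 ℕ.+ j)
        e = endDeficit (τ (suc r ℕ.+ j))
        f₁ f₂ a₁ a₂ : ℕ
        f₁ = toℕᵇ (bothStraight τ j)
        f₂ = count (bothStraight τ) r (suc j)
        a₁ = toℕᵇ (bothTurn τ j)
        a₂ = count (bothTurn τ) r (suc j)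

      -- A kink next to the end turns the weights 4, 5, 5, 6, 6 into 4, 5, 6, 7, 5: as multisets
      -- they differ by a 7 in place of a 6, which costs `E`.
      first-sum : ∀ a → sum (map P (4 ∷ 5 ∷ 5 ℕ.+ toℕᵇ a ∷ [])) + (P (6 ℕ.+ toℕᵇ a) + P (6 ∸ toℕᵇ a)) + endDeficit a ≈ end
      first-sum true = trans
        (solve 5 (λ p₄ p₅ p₆ p₇ e → (p₄ :+ (p₅ :+ (p₆ :+ con 0))) :+ (p₇ :+ p₅) :+ numeral 1 :* e
                                 := p₄ :+ (p₅ :+ p₅) :+ (p₆ :+ (p₇ :+ e))) refl (P 4) (P 5) (P 6) (P 7) E)
        (+-congˡ (+-congˡ (sym 6≈7+E)))
      first-sum false = solve 4 (λ p₄ p₅ p₆ e → (p₄ :+ (p₅ :+ (p₅ :+ con 0))) :+ (p₆ :+ p₆) :+ numeral 0 :* e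
                                 := p₄ :+ (p₅ :+ p₅) :+ (p₆ :+ p₆)) refl (P 4) (P 5) (P 6) E

      total-sum : ∀ m → (sum (map P firstWeights) + tail (suc m) 0) +
                  (#ends τ m · E + (#straight τ m · F + #turns τ m · A)) ≈ end + (m · D + end)
      total-sum m = begin
        (w + ((p₂ + (p₃ + (x + 0#))) + t)) + (fromℕ (κ 0 ℕ.+ κ m) * E + δ)
          ≈⟨ +-congˡ (+-congʳ (*-congʳ (fromℕ-+ (κ 0) (κ m)))) ⟩
        (w + ((p₂ + (p₃ + (x + 0#))) + t)) + ((fromℕ (κ 0) + fromℕ (κ m)) * E + δ)
          ≈⟨ solve 9 (λ w p₂ p₃ x t k₀ k E δ → (w :+ ((p₂ :+ (p₃ :+ (x :+ con 0))) :+ t)) :+ ((k₀ :+ k) :* E :+ δ)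
                       := (w :+ (p₂ :+ p₃) :+ k₀ :* E) :+ ((x :+ t) :+ (δ :+ k :* E))) refl w p₂ p₃ x t (fromℕ (κ 0)) (fromℕ (κ m)) E δ ⟩
        (w + (p₂ + p₃) + endDeficit (τ 0)) + (tail′ m 0 + (δ + endDeficit (τ m)))
          ≈⟨ +-cong (first-sum (τ 0)) (trans
               (+-congˡ (+-congˡ (≡⇒≈ (≡.cong (λ i → endDeficit (τ i)) (≡.sym (ℕ.+-identityʳ m)))))) (tail′-sum m 0)) ⟩
        end + (m · D + end) ∎
        where
        w p₂ p₃ x t δ : Carrier
        w = sum (map P firstWeights)
        p₂ = P (6 ℕ.+ κ 0)
        p₃ = P (6 ∸ κ 0)
        x = P (6 ℕ.+ after m 1 ∸ κ 0)
        t = tail m 1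
        δ = deficit m 0

-- Comparison of chains and the three ranges of α

module Main where
  open ≡ using (_≡_)
  open RealPowers
  open Chains
  open Windows
  open Index
  open Counting
  open Deficit
  open Iso
  open Segments
  open Classes
  open Staircases

  ≅-refl : ∀ {G} → G ≅ G
  ≅-refl = record { vertices = ↔-id _ ; adjacency = λ _ _ → ⇔-id _ }

  module _ {n m} (n≡ : n ≡ 3 ℕ.+ m) (B : PolyominoChain n) (ω : Ω B) where
    open ChainSegments n≡ B
    open Chain C
    open ChainProperties C
    open SegmentCounts n≡ B

    module _ (t≡0 : turns ≡ 0) (x≡0 : straights ≡ 0) (e≤1 : ends ℕ.≤ 1) where

      zigzag : Zigzag m s
      zigzag = record
        { d = d ; step = step ; noReversal = no-reversal₁ ; staircase = staircase ω ; alternating = alternating }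
        where
        alternating : ∀ {j} → j ℕ.< m → turnAt (suc j) ≡ not (turnAt j)
        alternating {j} j<m with turnAt j in eq | turnAt (suc j) in eq′
        ... | true  | false = ≡.refl
        ... | false | true  = ≡.refl
        ... | true  | true  = contradiction (≡.subst (1 ℕ.≤_) t≡0 (hit⇒1≤count (bothTurn turnAt) m (turnsAt⁺ j<m eq eq′))) ℕ.1+n≰n
        ... | false | false = contradiction (≡.subst (1 ℕ.≤_) x≡0 (hit⇒1≤count (bothStraight turnAt) m (straightAt⁺ j<m eq eq′))) ℕ.1+n≰n

      -- As `ends` is at most 1, at least one end has no kink beside it. The chain is read from such
      -- an end, where the model staircase begins as well.
      zigzag-≅ : PolyominoChain.chainGraph B ≅ graph (pathCells (3 ℕ.+ m))
      zigzag-≅ = from-first (turnAt 0) (turnAt m) ≡.refl ≡.refl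
        where
        from-first : ∀ first last → turnAt 0 ≡ first → turnAt m ≡ last → PolyominoChain.chainGraph B ≅ graph (pathCells (3 ℕ.+ m))
        from-first false _ first _ = path-≅ zigzag first (λ c∈ → ∈-squares⁻ n≡ B c∈) (λ {k} _ → cell-∈ n≡ B k)
        from-first true true first last = contradiction (ℕ.≤-trans (both-ends first last) e≤1) (λ { (ℕ.s≤s ()) })
        from-first true false _ last = path-≅ (reverse zigzag) (≡.trans (turn-opp (d m) (d (suc m))) last)
          (λ c∈ → let k , k≤l , c≡ = ∈-squares⁻ n≡ B c∈ in
            l ∸ k , ℕ.m∸n≤m l k , ≡.trans c≡ (≡.cong s (≡.sym (ℕ.m∸[m∸n]≡n k≤l))))
          (λ {k} _ → cell-∈ n≡ B (l ∸ k))

  nonzero : ∀ {t k} → ¬ (t ≡ 0 × k ℕ.≤ 1) → 1 ℕ.≤ t ⊎ 2 ℕ.≤ k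
  nonzero {t} {k} ¬best with t ℕ.≟ 0 | k ℕ.≤? 1
  ... | yes t≡0 | yes k≤1 = contradiction (t≡0 , k≤1) ¬best
  ... | no t≢0  | _       = inj₁ (ℕ.n≢0⇒n>0 t≢0)
  ... | yes _   | no k≰1  = inj₂ (ℕ.≰⇒> k≰1)

  exceed : ∀ {t j k} → ¬ (t ≡ 0 × j ≡ 0 × k ℕ.≤ 1) → 1 ℕ.≤ t ⊎ 1 ℕ.≤ j ⊎ 2 ℕ.≤ k
  exceed {t} {j} {k} ¬best with t ℕ.≟ 0
  ... | no t≢0  = inj₁ (ℕ.n≢0⇒n>0 t≢0)
  ... | yes t≡0 = inj₂ (nonzero λ jk → ¬best (t≡0 , jk))

  module _ {c ℓ₁ ℓ₂ : Level} (R : RealNumbers c ℓ₁ ℓ₂) where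
    open RealNumbers R
    open RealProperties R
    open SumConnectivity R
    open CommutativeRing commutativeRing using (ring; commutativeSemiring; +-commutativeMonoid)
    open RingProperties ring using (+-cancelʳ)
    open NaturalSolver commutativeSemiring
    open import Relation.Binary.Reasoning.Setoid setoid

    infix 4 _≼_
    -- Stronger than `≤`, which is the mere negation of the reversed strict order and cannot be
    -- split into cases. The disjunction is available here because it comes from comparisons of
    -- natural numbers.
    _≼_ : Carrier → Carrier → Set _
    x ≼ y = x < y ⊎ x ≈ y

    ≼-<-trans : ∀ {x y z} → x ≼ y → y < z → x < z
    ≼-<-trans (inj₁ x<y) y<z = <-trans x<y y<z
    ≼-<-trans (inj₂ x≈y) y<z = <-respˡ-≈ (sym x≈y) y<z

    <-≼-trans : ∀ {x y z} → x < y → y ≼ z → x < z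
    <-≼-trans x<y (inj₁ y<z) = <-trans x<y y<z
    <-≼-trans x<y (inj₂ y≈z) = <-respʳ-≈ y≈z x<y

    ≼-trans : ∀ {x y z} → x ≼ y → y ≼ z → x ≼ z
    ≼-trans x≼y (inj₁ y<z) = inj₁ (≼-<-trans x≼y y<z)
    ≼-trans (inj₁ x<y) (inj₂ y≈z) = inj₁ (<-respʳ-≈ y≈z x<y)
    ≼-trans (inj₂ x≈y) (inj₂ y≈z) = inj₂ (trans x≈y y≈z)

    +-mono-≼ : ∀ {x y u v} → x ≼ y → u ≼ v → x + u ≼ y + v
    +-mono-≼ (inj₁ p) (inj₁ q) = inj₁ (+-mono-< p q)
    +-mono-≼ (inj₁ p) (inj₂ q) = inj₁ (<-respʳ-≈ (+-congˡ q) (+-monoˡ-< _ p))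
    +-mono-≼ (inj₂ p) (inj₁ q) = inj₁ (<-respˡ-≈ (+-congʳ (sym p)) (+-monoʳ-< _ q))
    +-mono-≼ (inj₂ p) (inj₂ q) = inj₂ (+-cong p q)

    ·-mono-≼ : ∀ {j k x} → 0# < x → j ℕ.≤ k → j · x ≼ k · x
    ·-mono-≼ 0<x j≤k with ℕ.m≤n⇒m<n∨m≡n j≤k
    ... | inj₁ j<k    = inj₁ (·-monoˡ-< 0<x j<k)
    ... | inj₂ ≡.refl = inj₂ refl

    0≼· : ∀ k {x} → 0# < x → 0# ≼ k · x
    0≼· k 0<x = ≼-trans (inj₂ (sym (zeroˡ _))) (·-mono-≼ {0} {k} 0<x ℕ.z≤n)

    Δ : (E F A : Carrier) → ℕ → ℕ → ℕ → Carrier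
    Δ E F A e x t = e · E + (x · F + t · A)

    module _ {E F A} (0<E : 0# < E) (0<F : 0# < F) (0<A : 0# < A) where
      ends≼Δ : ∀ e x t → e · E ≼ Δ E F A e x t
      ends≼Δ e x t = ≼-trans (inj₂ (solve 1 (λ a → a := a :+ (con 0 :+ con 0)) refl (e · E)))
        (+-mono-≼ (inj₂ refl) (+-mono-≼ (0≼· x 0<F) (0≼· t 0<A)))

      straights≼Δ : ∀ e x t → x · F ≼ Δ E F A e x t
      straights≼Δ e x t = ≼-trans (inj₂ (solve 1 (λ a → a := con 0 :+ (a :+ con 0)) refl (x · F)))
        (+-mono-≼ (0≼· e 0<E) (+-mono-≼ (inj₂ refl) (0≼· t 0<A)))

      turns≼Δ : ∀ e x t → t · A ≼ Δ E F A e x t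
      turns≼Δ e x t = ≼-trans (inj₂ (solve 1 (λ a → a := con 0 :+ (con 0 :+ a)) refl (t · A)))
        (+-mono-≼ (0≼· e 0<E) (+-mono-≼ (0≼· x 0<F) (inj₂ refl)))

    <-multiple : ∀ {x y} k → 0# < y → x < y → 1 ℕ.≤ k → x < k · y
    <-multiple k 0<y x<y 1≤k = <-≼-trans (<-respʳ-≈ (sym (1·x≈x _)) x<y) (·-mono-≼ 0<y 1≤k)

    <-2-multiple : ∀ {x} k → 0# < x → 2 ℕ.≤ k → x < k · x
    <-2-multiple k 0<x 2≤k = <-≼-trans (<-respˡ-≈ (1·x≈x _) (·-monoˡ-< {1} {2} 0<x ℕ.≤-refl)) (·-mono-≼ 0<x 2≤k)

    ≼-1-multiple : ∀ {x} k → 0# < x → k ℕ.≤ 1 → k · x ≼ x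
    ≼-1-multiple k 0<x k≤1 = ≼-trans (·-mono-≼ 0<x k≤1) (inj₂ (1·x≈x _))

    -- `x` and `y` cannot be compared directly, but `P` will be a condition on natural numbers and
    -- is decidable: it yields either equality or strict inequality.
    ≤-and-equality : ∀ x y {p q} {P : Set p} {Q : Set q} → Dec P → (P → x ≈ y) → (¬ P → x < y) → (P → Q) → (Q → x ≈ y) →
                     x ≤ y × (x ≈ y ⇔ Q)
    ≤-and-equality x y (yes p) equal _ to from = ≈⇒≤ (equal p) , mk⇔ (λ _ → to p) from
    ≤-and-equality x y (no ¬p) _ less to from  = <⇒≤ (less ¬p) , mk⇔ (λ eq → contradiction eq (<⇒≉ (less ¬p))) from

    module AtExponent (α : Carrier) {E F G} (0<E : 0# < E) (0<F : 0# < F) (0<G : 0# < G)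
      (6≈7+E : 6 ^ℕ α ≈ 7 ^ℕ α + E) (6≈8+G : 6 ^ℕ α ≈ 8 ^ℕ α + G)
      (straight : 5 ^ℕ α + 2 · 7 ^ℕ α ≈ 3 · 6 ^ℕ α + F) {m : ℕ} where

      -- A group with two kinks has the weights 6, 6, 8 against 6, 6, 6 without kinks, so it costs
      -- 6^α - 8^α = `G` more.
      A : Carrier
      A = F + G

      private
        P : ℕ → Carrier
        P w = w ^ℕ α

        straight′ : P 5 + (P 7 + P 7) ≈ (P 6 + (P 6 + P 6)) + F
        straight′ = trans (solve 2 (λ p r → p :+ (r :+ r) := p :+ numeral 2 :* r) refl (P 5) (P 7))
          (trans straight (solve 2 (λ q f → numeral 3 :* q :+ f := (q :+ (q :+ q)) :+ f) refl (P 6) F))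

        turns′ : P 5 + (P 7 + P 7) ≈ (P 6 + (P 6 + P 8)) + A
        turns′ = trans straight′ (trans (+-congʳ (+-congˡ (+-congˡ 6≈8+G)))
          (solve 4 (λ q s g f → (q :+ (q :+ (s :+ g))) :+ f := (q :+ (q :+ s)) :+ (f :+ g)) refl (P 6) (P 8) G F))

        K : Carrier
        K = let open DeficitFormula R P 6≈7+E straight′ turns′ (λ _ → false) in end + (m · D + end)

      F<A : F < A
      F<A = x<x+y F 0<G

      0<A : 0# < A
      0<A = <-trans 0<F F<A

      module _ {n} (n≡ : n ≡ 3 ℕ.+ m) where
        deficit : PolyominoChain n → Carrier
        deficit B = Δ E F A ends straights turns
          where open SegmentCounts n≡ B

        χ+deficit : ∀ B → Ω B → χ α B + deficit B ≈ K
        χ+deficit B ω = trans (+-congʳ (ChainSum.edgeSum-tail +-commutativeMonoid P C squares-cover (staircase ω)))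
          (DeficitFormula.total-sum R P 6≈7+E straight′ turns′ (ChainProperties.turnAt C) m)
          where open ChainSegments n≡ B

        χ-< : ∀ B Z → Ω B → Ω Z → deficit Z < deficit B → χ α B < χ α Z
        χ-< B Z ωB ωZ lt = +-cancelʳ-< (deficit B) (<-respˡ-≈ (trans (χ+deficit Z ωZ) (sym (χ+deficit B ωB))) (+-monoʳ-< (χ α Z) lt))

        χ-≈ : ∀ B Z → Ω B → Ω Z → deficit B ≈ deficit Z → χ α B ≈ χ α Z
        χ-≈ B Z ωB ωZ eq = +-cancelʳ (deficit B) _ _ (trans (χ+deficit B ωB) (trans (sym (χ+deficit Z ωZ)) (+-congˡ (sym eq))))

        χ-≅ : ∀ (B C : PolyominoChain n) → B ≅ᶜ C → χ α B ≈ χ α C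
        χ-≅ B C i = edgeSum-≅ i +-commutativeMonoid P

        module Counts (B : PolyominoChain n) = SegmentCounts n≡ B

        number : PolyominoChain n → ℕ
        number B = ends ℕ.+ (straights ℕ.+ turns)
          where open Counts B

        parity : ∀ B → odd (number B) ≡ odd m
        parity B = total-parity (ChainProperties.turnAt C) m
          where open ChainSegments n≡ B

        -- Both totals have the parity of `m`. This is why all members of an extremal class have one
        -- and the same index.
        same-number : ∀ B Z {k k′} → number B ≡ k → number Z ≡ k′ → k ℕ.≤ 1 → k′ ℕ.≤ 1 → k ≡ k′
        same-number B Z e e′ k≤1 k′≤1 = odd-injective k≤1 k′≤1
          (≡.trans (≡.cong odd (≡.sym e)) (≡.trans (parity B) (≡.trans (≡.sym (parity Z)) (≡.cong odd e′))))

        -- When the parity forces a nonzero total, the cheapest way to reach it is one `F`, that is,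
        -- a single segment of length 4.
        module EndsExpensive (F<E : F < E) where
          Best : PolyominoChain n → Set
          Best B = turns ≡ 0 × ends ≡ 0 × straights ℕ.≤ 1
            where open Counts B

          best? : ∀ B → Dec (Best B)
          best? B = (turns ℕ.≟ 0) ×-dec ((ends ℕ.≟ 0) ×-dec (straights ℕ.≤? 1))
            where open Counts B

          deficit≈ : ∀ B → Best B → deficit B ≈ Counts.straights B · F
          deficit≈ B (t , e , _) = trans
            (+-cong (*-congʳ (≡⇒≈ (≡.cong fromℕ e))) (+-congˡ (*-congʳ (≡⇒≈ (≡.cong fromℕ t)))))
            (solve 3 (λ a b c → con 0 :* a :+ (b :+ con 0 :* c) := b) refl E (Counts.straights B · F) A)

          equal : ∀ B Z → Ω B → Ω Z → Best B → Best Z → χ α B ≈ χ α Z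
          equal B Z ωB ωZ b@(t , e , x≤1) b′@(t′ , e′ , x′≤1) = χ-≈ B Z ωB ωZ (trans (deficit≈ B b)
            (trans (≡⇒≈ (≡.cong (_· F) (same-number B Z (total B b) (total Z b′) x≤1 x′≤1))) (sym (deficit≈ Z b′))))
            where
            total : ∀ B → Best B → let open Counts B in ends ℕ.+ (straights ℕ.+ turns) ≡ straights
            total B (t , e , _) = ≡.trans (≡.cong₂ (λ i j → i ℕ.+ (straights ℕ.+ j)) e t) (ℕ.+-identityʳ straights)
              where open Counts B

          -- A best chain pays at most `F`. Any other pays at least `A`, `E` or twice `F`, each of
          -- which is more.
          less : ∀ B Z → Ω B → Ω Z → ¬ Best B → Best Z → χ α B < χ α Z
          less B Z ωB ωZ ¬best best@(_ , _ , x′≤1) = χ-< B Z ωB ωZ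
            (≼-<-trans (≼-trans (inj₂ (deficit≈ Z best)) (≼-1-multiple _ 0<F x′≤1)) F<deficit)
            where
            open Counts B
            F<deficit : F < deficit B
            F<deficit = [ (λ 1≤t → <-≼-trans (<-multiple turns 0<A F<A 1≤t) (turns≼Δ 0<E 0<F 0<A ends straights turns))
                        , [ (λ 1≤e → <-≼-trans (<-multiple ends 0<E F<E 1≤e) (ends≼Δ 0<E 0<F 0<A ends straights turns))
                          , (λ 2≤x → <-≼-trans (<-2-multiple straights 0<F 2≤x) (straights≼Δ 0<E 0<F 0<A ends straights turns)) ]′ ]′
                        (exceed ¬best)

          maximum : ∀ B Z → Ω B → 𝒵* Z → χ α B ≤ χ α Z × (χ α B ≈ χ α Z ⇔ (∃ λ (C : PolyominoChain n) → 𝒵* C × B ≅ᶜ C))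
          maximum B Z ωB z = ≤-and-equality (χ α B) (χ α Z) (best? B)
            (λ b → equal B Z ωB ωZ b bestZ) (λ ¬b → less B Z ωB ωZ ¬b bestZ)
            (λ (t , e , x) → B , Counts.𝒵*⇐ B ωB t e x , ≅-refl)
            (λ (C , c , i) → trans (χ-≅ B C i) (equal C Z (𝒵*.inΩ c) ωZ (Counts.𝒵*⇒ C c) bestZ))
            where
            ωZ : Ω Z
            ωZ = 𝒵*.inΩ z
            bestZ : Best Z
            bestZ = Counts.𝒵*⇒ Z z

        -- Here the cheapest unit is `E`: an odd total is best made up by one external segment of
        -- length 2.
        module EndsCheap (E<F : E < F) where
          Best : PolyominoChain n → Set
          Best B = turns ≡ 0 × straights ≡ 0 × ends ℕ.≤ 1
            where open Counts B

          best? : ∀ B → Dec (Best B)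
          best? B = (turns ℕ.≟ 0) ×-dec ((straights ℕ.≟ 0) ×-dec (ends ℕ.≤? 1))
            where open Counts B

          deficit≈ : ∀ B → Best B → deficit B ≈ Counts.ends B · E
          deficit≈ B (t , x , _) = trans
            (+-congˡ (+-cong (*-congʳ (≡⇒≈ (≡.cong fromℕ x))) (*-congʳ (≡⇒≈ (≡.cong fromℕ t)))))
            (solve 3 (λ a b c → a :+ (con 0 :* b :+ con 0 :* c) := a) refl (Counts.ends B · E) F A)

          equal : ∀ B Z → Ω B → Ω Z → Best B → Best Z → χ α B ≈ χ α Z
          equal B Z ωB ωZ b@(_ , _ , e≤1) b′@(_ , _ , e′≤1) = χ-≈ B Z ωB ωZ (trans (deficit≈ B b)
            (trans (≡⇒≈ (≡.cong (_· E) (same-number B Z (total B b) (total Z b′) e≤1 e′≤1))) (sym (deficit≈ Z b′))))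
            where
            total : ∀ B → Best B → let open Counts B in ends ℕ.+ (straights ℕ.+ turns) ≡ ends
            total B (t , x , _) = ≡.trans (≡.cong₂ (λ i j → ends ℕ.+ (i ℕ.+ j)) x t) (ℕ.+-identityʳ ends)
              where open Counts B

          less : ∀ B Z → Ω B → Ω Z → ¬ Best B → Best Z → χ α B < χ α Z
          less B Z ωB ωZ ¬best best@(_ , _ , e′≤1) = χ-< B Z ωB ωZ
            (≼-<-trans (≼-trans (inj₂ (deficit≈ Z best)) (≼-1-multiple _ 0<E e′≤1)) E<deficit)
            where
            open Counts B
            E<deficit : E < deficit B
            E<deficit = [ (λ 1≤t → <-≼-trans (<-multiple turns 0<A (<-trans E<F F<A) 1≤t) (turns≼Δ 0<E 0<F 0<A ends straights turns))
                        , [ (λ 1≤x → <-≼-trans (<-multiple straights 0<F E<F 1≤x) (straights≼Δ 0<E 0<F 0<A ends straights turns))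
                          , (λ 2≤e → <-≼-trans (<-2-multiple ends 0<E 2≤e) (ends≼Δ 0<E 0<F 0<A ends straights turns)) ]′ ]′
                        (exceed ¬best)

          maximum : ∀ B Z → Ω B → Z† Z → χ α B ≤ χ α Z × (χ α B ≈ χ α Z ⇔ B ≅ᶜ Z)
          maximum B Z ωB z = ≤-and-equality (χ α B) (χ α Z) (best? B)
            (λ b → equal B Z ωB ωZ b bestZ) (λ ¬b → less B Z ωB ωZ ¬b bestZ)
            (λ (t , x , e) → ≅-trans (zigzag-≅ n≡ B ωB t x e) (≅-sym (zigzag-≅ n≡ Z ωZ (proj₁ bestZ) (proj₁ (proj₂ bestZ)) (proj₂ (proj₂ bestZ)))))
            (χ-≅ B Z)
            where
            ωZ : Ω Z
            ωZ = Z†.inΩ z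
            bestZ : Best Z
            bestZ = Counts.Z†⇒ Z z

    -- With `F` equal to `E` both corrections of the parity cost the same, so only the sum of `ends`
    -- and `straights` matters.
    module Balanced (α : Carrier) {E G} (0<E : 0# < E) (0<G : 0# < G)
      (6≈7+E : 6 ^ℕ α ≈ 7 ^ℕ α + E) (6≈8+G : 6 ^ℕ α ≈ 8 ^ℕ α + G)
      (straight : 5 ^ℕ α + 2 · 7 ^ℕ α ≈ 3 · 6 ^ℕ α + E) {n m} (n≡ : n ≡ 3 ℕ.+ m) where
      open AtExponent α 0<E 0<E 0<G 6≈7+E 6≈8+G straight {m}

      Best : PolyominoChain n → Set
      Best B = turns ≡ 0 × ends ℕ.+ straights ℕ.≤ 1
        where open Counts n≡ B

      best? : ∀ B → Dec (Best B)
      best? B = (turns ℕ.≟ 0) ×-dec (ends ℕ.+ straights ℕ.≤? 1)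
        where open Counts n≡ B

      deficit≈ : ∀ B → let open Counts n≡ B in deficit n≡ B ≈ (ends ℕ.+ straights) · E + turns · (E + G)
      deficit≈ B = trans (solve 4 (λ e x E a → e :* E :+ (x :* E :+ a) := (e :+ x) :* E :+ a) refl (fromℕ ends) (fromℕ straights) E (turns · (E + G)))
        (+-congʳ (*-congʳ (sym (fromℕ-+ ends straights))))
        where open Counts n≡ B

      best-deficit≈ : ∀ B → Best B → let open Counts n≡ B in deficit n≡ B ≈ (ends ℕ.+ straights) · E
      best-deficit≈ B (t , _) = trans (deficit≈ B) (trans (+-congˡ (trans (*-congʳ (≡⇒≈ (≡.cong fromℕ t))) (zeroˡ _))) (+-identityʳ _))

      equal : ∀ B Z → Ω B → Ω Z → Best B → Best Z → χ α B ≈ χ α Z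
      equal B Z ωB ωZ b@(_ , ≤1) b′@(_ , ≤1′) = χ-≈ n≡ B Z ωB ωZ (trans (best-deficit≈ B b)
        (trans (≡⇒≈ (≡.cong (_· E) (same-number n≡ B Z (total B b) (total Z b′) ≤1 ≤1′))) (sym (best-deficit≈ Z b′))))
        where
        total : ∀ B → Best B → let open Counts n≡ B in ends ℕ.+ (straights ℕ.+ turns) ≡ ends ℕ.+ straights
        total B (t , _) = ≡.cong (ends ℕ.+_) (≡.trans (≡.cong (straights ℕ.+_) t) (ℕ.+-identityʳ straights))
          where open Counts n≡ B

      less : ∀ B Z → Ω B → Ω Z → ¬ Best B → Best Z → χ α B < χ α Z
      less B Z ωB ωZ ¬best best@(_ , ≤1) = χ-< n≡ B Z ωB ωZ
        (≼-<-trans (≼-trans (inj₂ (best-deficit≈ Z best)) (≼-1-multiple _ 0<E ≤1)) E<deficit)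
        where
        open Counts n≡ B
        E<deficit : E < deficit n≡ B
        E<deficit = [ (λ 1≤t → <-≼-trans (<-multiple turns 0<A F<A 1≤t) (turns≼Δ 0<E 0<E 0<A ends straights turns))
                    , (λ 2≤e+x → <-≼-trans (<-2-multiple (ends ℕ.+ straights) 0<E 2≤e+x)
                        (≼-trans (≼-trans (inj₂ (sym (+-identityʳ _))) (+-mono-≼ (inj₂ refl) (0≼· turns 0<A))) (inj₂ (sym (deficit≈ B))))) ]′
                    (nonzero ¬best)

      maximum : ∀ B Z → Ω B → 𝒵 Z → χ α B ≤ χ α Z × (χ α B ≈ χ α Z ⇔ (∃ λ (C : PolyominoChain n) → 𝒵 C × B ≅ᶜ C))
      maximum B Z ωB z = ≤-and-equality (χ α B) (χ α Z) (best? B)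
        (λ b → equal B Z ωB ωZ b bestZ) (λ ¬b → less B Z ωB ωZ ¬b bestZ)
        (λ (t , ≤1) → B , Counts.𝒵⇐ n≡ B ωB t ≤1 , ≅-refl)
        (λ (C , c , i) → trans (χ-≅ n≡ B C i) (equal C Z (𝒵.inΩ c) ωZ (Counts.𝒵⇒ n≡ C c) bestZ))
        where
        ωZ : Ω Z
        ωZ = 𝒵.inΩ z
        bestZ : Best Z
        bestZ = Counts.𝒵⇒ n≡ Z z

    negative : ∀ {x} k → x + fromℕ (suc k) < 0# → x < 0#
    negative {x} k = <-trans (x<x+y x (fromℕ-pos k))

    module Extrema {x₀ x₁} (fx₀≈0 : f x₀ ≈ 0#) (x₀≈ : x₀ ≈-[ 309997 / 100000 ])
             (f+g≈0 : f x₁ + g x₁ ≈ 0#) (x₁≈ : x₁ ≈-[ 546343 / 100000 ])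
             {n m} (n≡ : n ≡ 3 ℕ.+ m) (B : PolyominoChain n) (ωB : Ω B) where
      x₀+3<0 : x₀ + fromℕ 3 < 0#
      x₀+3<0 = -‿bound 309997 99999 3 x₀≈ (ℕ.<ᵇ⇒< _ _ tt)
      x₁+4<0 : x₁ + fromℕ 4 < 0#
      x₁+4<0 = -‿bound 546343 99999 4 x₁≈ (ℕ.<ᵇ⇒< _ _ tt)

      private module Gaps {α} (α<0 : α < 0#) where
        6-7 = difference (base-antimono-< 5 6 ℕ.≤-refl α<0)
        6-8 = difference (base-antimono-< 5 7 (ℕ.n≤1+n 6) α<0)
        0<E = proj₁ (proj₂ 6-7)
        0<G = proj₁ (proj₂ 6-8)
        6≈7+E = proj₂ (proj₂ 6-7)
        6≈8+G = proj₂ (proj₂ 6-8)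
        E = proj₁ 6-7

        3·7 : 3 · 7 ^ℕ α ≈ 2 · 7 ^ℕ α + 7 ^ℕ α
        3·7 = solve 1 (λ r → numeral 3 :* r := numeral 2 :* r :+ r) refl (7 ^ℕ α)

        4·6 : 4 · 6 ^ℕ α ≈ (3 · 6 ^ℕ α + E) + 7 ^ℕ α
        4·6 = trans (solve 1 (λ q → numeral 4 :* q := numeral 3 :* q :+ q) refl (6 ^ℕ α))
          (trans (+-congˡ 6≈7+E) (solve 3 (λ q r e → q :+ (r :+ e) := (q :+ e) :+ r) refl (3 · 6 ^ℕ α) (7 ^ℕ α) E))

      between : (α : Carrier) → x₁ < α → α < x₀ → (Z : PolyominoChain n) → 𝒵* Z →
        χ α B ≤ χ α Z × (χ α B ≈ χ α Z ⇔ (∃ λ (C : PolyominoChain n) → 𝒵* C × B ≅ᶜ C))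
      between α x₁<α α<x₀ Z = EndsExpensive.maximum n≡ F<E B Z ωB
        where
        α+3<0 : α + fromℕ 3 < 0#
        α+3<0 = <-trans (+-monoˡ-< _ α<x₀) x₀+3<0
        open Gaps (negative 2 α+3<0)
        gap = difference (f>0 fx₀≈0 x₀+3<0 α<x₀)
        open AtExponent α 0<E (proj₁ (proj₂ gap)) 0<G 6≈7+E 6≈8+G (proj₂ (proj₂ gap))
        -- Adding 3·6^α + 7^α to both sides turns this into 5^α + 3·7^α < 4·6^α.
        F<E : proj₁ gap < E
        F<E = +-cancelʳ-< (3 · 6 ^ℕ α + 7 ^ℕ α) (<-resp₂
          (trans (+-congˡ 3·7) (trans (sym (+-assoc _ _ _)) (trans (+-congʳ (proj₂ (proj₂ gap)))
            (solve 3 (λ q r f → (q :+ f) :+ r := f :+ (q :+ r)) refl (3 · 6 ^ℕ α) (7 ^ℕ α) (proj₁ gap)))))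
          (trans 4·6 (solve 3 (λ q r e → (q :+ e) :+ r := e :+ (q :+ r)) refl (3 · 6 ^ℕ α) (7 ^ℕ α) E))
          (f+g<0 f+g≈0 x₁<α α+3<0))

      at-root : (Z : PolyominoChain n) → 𝒵 Z →
        χ x₁ B ≤ χ x₁ Z × (χ x₁ B ≈ χ x₁ Z ⇔ (∃ λ (C : PolyominoChain n) → 𝒵 C × B ≅ᶜ C))
      at-root Z = Balanced.maximum x₁ 0<E 0<G 6≈7+E 6≈8+G straight n≡ B Z ωB
        where
        open Gaps (negative 3 x₁+4<0)
        -- The root equation 5^x₁ + 3·7^x₁ = 4·6^x₁ with 7^x₁ cancelled: at this exponent `F` is
        -- `E`.
        straight : 5 ^ℕ x₁ + 2 · 7 ^ℕ x₁ ≈ 3 · 6 ^ℕ x₁ + E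
        straight = +-cancelʳ (7 ^ℕ x₁) _ _ (trans (+-assoc _ _ _) (trans (+-congˡ (sym 3·7)) (trans (f+g-root f+g≈0) 4·6)))

      below : (α : Carrier) → α < x₁ → (Z : PolyominoChain n) → Z† Z →
        χ α B ≤ χ α Z × (χ α B ≈ χ α Z ⇔ B ≅ᶜ Z)
      below α α<x₁ Z = EndsCheap.maximum n≡ (x<x+y E 0<H) B Z ωB
        where
        open Gaps (<-trans α<x₁ (negative 3 x₁+4<0))
        gap = difference (f+g>0 f+g≈0 x₁+4<0 α<x₁)
        -- `H` is the value of f + g at α. Writing `F` as `E + H` yields both 0 < F and E < F from
        -- the positivity of `H`.
        H = proj₁ gap
        0<H = proj₁ (proj₂ gap)
        straight : 5 ^ℕ α + 2 · 7 ^ℕ α ≈ 3 · 6 ^ℕ α + (E + H)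
        straight = +-cancelʳ (7 ^ℕ α) _ _ (trans (+-assoc _ _ _) (trans (+-congˡ (sym 3·7))
          (trans (proj₂ (proj₂ gap)) (trans (+-congʳ 4·6)
            (solve 4 (λ q e r h → ((q :+ e) :+ r) :+ h := (q :+ (e :+ h)) :+ r) refl (3 · 6 ^ℕ α) E (7 ^ℕ α) H)))))
        open AtExponent α 0<E (0<x+y 0<E 0<H) 0<G 6≈7+E 6≈8+G straight

proposition2p7 : {c ℓ₁ ℓ₂ : Level} (R : RealNumbers c ℓ₁ ℓ₂) →
  let open RealNumbers R in
  let open SumConnectivity R in
  (x₀ x₁ : Carrier) →
  f x₀ ≈ 0# → x₀ ≈-[ 309997 / 100000 ] →
  f x₁ + g x₁ ≈ 0# → x₁ ≈-[ 546343 / 100000 ] →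
  (n : ℕ) → 3 ℕ.≤ n →
  (B : PolyominoChain n) → Ω B →
  ((α : Carrier) → x₁ < α → α < x₀ →
   (Z : PolyominoChain n) → 𝒵* Z →
   χ α B ≤ χ α Z × (χ α B ≈ χ α Z ⇔ (∃ λ (C : PolyominoChain n) → 𝒵* C × B ≅ᶜ C)))
  ×
  ((Z : PolyominoChain n) → 𝒵 Z →
   χ x₁ B ≤ χ x₁ Z × (χ x₁ B ≈ χ x₁ Z ⇔ (∃ λ (C : PolyominoChain n) → 𝒵 C × B ≅ᶜ C)))
  ×
  ((α : Carrier) → α < x₁ →
   (Z : PolyominoChain n) → Z† Z →
   χ α B ≤ χ α Z × (χ α B ≈ χ α Z ⇔ B ≅ᶜ Z))
proposition2p7 R x₀ x₁ fx₀≈0 x₀≈ f+g≈0 x₁≈ n 3≤n B ωB = between , at-root , below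
  where
  open Main.Extrema R fx₀≈0 x₀≈ f+g≈0 x₁≈ (≡.sym (proj₂ (ℕ.m≤n⇒∃[o]m+o≡n 3≤n))) B ωB
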